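{- Let $m\neq n$ be positive integers and let $x$ be a nonzero real number with $\Phi_m(x)=\Phi_n(x)$. Then $\frac12<|x|<2$, except in the case $x=2$ and $\{m,n\}=\{2,6\}$ (where indeed $\Phi_2(2)=\Phi_6(2)$).
   Context: For a positive integer $n$, $\Phi_n$ denotes the $n$-th cyclotomic polynomial, $\Phi_n(x)=\prod_{1\le a\le n,\ \gcd(a,n)=1}(x-\zeta_n^a)$, where $\zeta_n$ is a primitive $n$-th root of unity (so $\Phi_1(x)=x-1$). -}

module Defs where

open import Algebra.Bundles.Raw using (RawRing)
import Algebra.Definitions.RawSemiring as RawSemiringDefinitions
open import Data.List.Base using (List; filter; foldr; map; upTo)
open import Data.Nat.Base as ℕ using (ℕ; suc)
open import Data.Nat.GCD using (gcd)
import Data.Nat.Properties as ℕ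
open import Data.Product.Base using (∃; _×_; _,_; proj₁; proj₂)
open import Data.Rational.Base
open import Data.Rational.Properties
open import Data.Rational.Solver using (module +-*-Solver)
open import Data.Sum.Base using (inj₁; inj₂)
open import Level using (0ℓ)
open import Relation.Binary.PropositionalEquality
open import Relation.Nullary using (¬_)

IsCauchy : (ℕ → ℚ) → Set
IsCauchy s = ∀ ε → 0ℚ < ε → ∃ λ N → ∀ i j → N ℕ.≤ i → N ℕ.≤ j →
             ∣ s i - s j ∣ < ε

-- Proofs about concrete rationals have huge normal forms; those that occur
-- in data, and the moduli built from them, are therefore kept opaque.
private
  module Identities where
    open +-*-Solver

    swap-sub : ∀ p q → p - q ≡ - (q - p)
    swap-sub = solve 2 (λ p q → p :- q := :- (q :- p)) refl

    sub-neg : ∀ p q → q - p ≡ - p - - q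
    sub-neg = solve 2 (λ p q → q :- p := :- p :- (:- q)) refl

    sub-add : ∀ p q → p ≡ (p - q) + q
    sub-add = solve 2 (λ p q → p := (p :- q) :+ q) refl

    add-sub : ∀ p q → p + q - q ≡ p
    add-sub = solve 2 (λ p q → p :+ q :- q := p) refl

    +-sub-+ : ∀ p q r s → (p + q) - (r + s) ≡ (p - r) + (q - s)
    +-sub-+ = solve 4 (λ p q r s → (p :+ q) :- (r :+ s) := (p :- r) :+ (q :- s)) refl

    *-sub-* : ∀ p q r s → p * q - r * s ≡ p * (q - s) + s * (p - r)
    *-sub-* = solve 4 (λ p q r s → p :* q :- r :* s := p :* (q :- s) :+ s :* (p :- r)) refl

    *-swap : ∀ p q r → p * (q * r) ≡ q * (p * r)
    *-swap = solve 3 (λ p q r → p :* (q :* r) := q :* (p :* r)) refl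

  open Identities

  halves : ∀ ε → ε * ½ + ε * ½ ≡ ε
  halves ε = trans (sym (*-distribˡ-+ ε ½ ½)) (*-identityʳ ε)

  opaque
    half-pos : ∀ {ε} → 0ℚ < ε → 0ℚ < ε * ½
    half-pos {ε} 0<ε = subst (_< ε * ½) (*-zeroˡ ½) (*-monoˡ-<-pos ½ 0<ε)

  ∣p-q∣≡∣q-p∣ : ∀ p q → ∣ p - q ∣ ≡ ∣ q - p ∣
  ∣p-q∣≡∣q-p∣ p q = trans (cong ∣_∣ (swap-sub p q))
                          (∣-p∣≡∣p∣ (q - p))

  ∣p∣-∣q∣≤∣p-q∣ : ∀ p q → ∣ p ∣ - ∣ q ∣ ≤ ∣ p - q ∣
  ∣p∣-∣q∣≤∣p-q∣ p q = begin
    ∣ p ∣ - ∣ q ∣                ≡⟨ cong (λ r → ∣ r ∣ - ∣ q ∣) (sub-add p q) ⟩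
    ∣ (p - q) + q ∣ - ∣ q ∣      ≤⟨ +-monoˡ-≤ (- ∣ q ∣) (∣p+q∣≤∣p∣+∣q∣ (p - q) q) ⟩
    ∣ p - q ∣ + ∣ q ∣ - ∣ q ∣    ≡⟨ add-sub ∣ p - q ∣ ∣ q ∣ ⟩
    ∣ p - q ∣                    ∎
    where open ≤-Reasoning

  ∣∣p∣-∣q∣∣≤∣p-q∣ : ∀ p q → ∣ ∣ p ∣ - ∣ q ∣ ∣ ≤ ∣ p - q ∣
  ∣∣p∣-∣q∣∣≤∣p-q∣ p q with ∣p∣≡p∨∣p∣≡-p (∣ p ∣ - ∣ q ∣)
  ... | inj₁ eq = subst (_≤ ∣ p - q ∣) (sym eq) (∣p∣-∣q∣≤∣p-q∣ p q)
  ... | inj₂ eq = subst₂ _≤_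
      (sym (trans eq (sym (swap-sub ∣ q ∣ ∣ p ∣))))
      (∣p-q∣≡∣q-p∣ q p) (∣p∣-∣q∣≤∣p-q∣ q p)

opaque
  const-cauchy : ∀ p → IsCauchy (λ _ → p)
  const-cauchy p ε 0<ε = 0 , λ _ _ _ _ → subst (_< ε) (sym (cong ∣_∣ (+-inverseʳ p))) 0<ε

opaque
  +-cauchy : ∀ s t → IsCauchy s → IsCauchy t → IsCauchy (λ i → s i + t i)
  +-cauchy s t cs ct ε 0<ε with cs (ε * ½) (half-pos 0<ε) | ct (ε * ½) (half-pos 0<ε)
  ... | M , p | N , q = M ℕ.⊔ N , λ i j i≥ j≥ → begin-strict
      ∣ (s i + t i) - (s j + t j) ∣    ≡⟨ cong ∣_∣ (+-sub-+ (s i) (t i) (s j) (t j)) ⟩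
      ∣ (s i - s j) + (t i - t j) ∣    ≤⟨ ∣p+q∣≤∣p∣+∣q∣ (s i - s j) (t i - t j) ⟩
      ∣ s i - s j ∣ + ∣ t i - t j ∣    <⟨ +-mono-< (p i j (ℕ.m⊔n≤o⇒m≤o M N i≥) (ℕ.m⊔n≤o⇒m≤o M N j≥))
                                                   (q i j (ℕ.m⊔n≤o⇒n≤o M N i≥) (ℕ.m⊔n≤o⇒n≤o M N j≥)) ⟩
      ε * ½ + ε * ½                    ≡⟨ halves ε ⟩
      ε                                ∎
      where open ≤-Reasoning

opaque
  neg-cauchy : ∀ s → IsCauchy s → IsCauchy (λ i → - s i)
  neg-cauchy s cs ε 0<ε with cs ε 0<ε
  ... | N , p = N , λ i j i≥ j≥ → subst (_< ε)
      (trans (∣p-q∣≡∣q-p∣ (s i) (s j))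
             (cong ∣_∣ (sub-neg (s i) (s j))))
      (p i j i≥ j≥)

opaque
  abs-cauchy : ∀ s → IsCauchy s → IsCauchy (λ i → ∣ s i ∣)
  abs-cauchy s cs ε 0<ε with cs ε 0<ε
  ... | N , p = N , λ i j i≥ j≥ → ≤-<-trans (∣∣p∣-∣q∣∣≤∣p-q∣ (s i) (s j)) (p i j i≥ j≥)

private
  opaque
    eventually-bounded : ∀ {s} → IsCauchy s →
                         ∃ λ B → 0ℚ < B × ∃ λ N → ∀ i → N ℕ.≤ i → ∣ s i ∣ < B
    eventually-bounded {s} cs with cs 1ℚ (positive⁻¹ 1ℚ)
    ... | N , p = ∣ s N ∣ + 1ℚ , +-mono-≤-< (0≤∣p∣ (s N)) (positive⁻¹ 1ℚ) , N , λ i i≥ → begin-strict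
        ∣ s i ∣                    ≡⟨ cong ∣_∣ (trans (sub-add (s i) (s N)) (+-comm (s i - s N) (s N))) ⟩
        ∣ s N + (s i - s N) ∣      ≤⟨ ∣p+q∣≤∣p∣+∣q∣ (s N) (s i - s N) ⟩
        ∣ s N ∣ + ∣ s i - s N ∣    <⟨ +-monoʳ-< ∣ s N ∣ (p i N i≥ ℕ.≤-refl) ⟩
        ∣ s N ∣ + 1ℚ               ∎
        where open ≤-Reasoning

private
  opaque
    quotient : ∀ {ε D} → 0ℚ < ε → 0ℚ < D → ∃ λ δ → 0ℚ < δ × D * δ ≡ ε
    quotient {ε} {D} 0<ε 0<D = ε * D⁻¹ , 0<δ , D*δ
      where
      D⁻¹ : ℚ
      D⁻¹ = (1/ D) {{pos⇒nonZero D {{positive 0<D}}}}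

      0<δ : 0ℚ < ε * D⁻¹
      0<δ = subst (_< ε * D⁻¹) (*-zeroˡ D⁻¹)
        (*-monoˡ-<-pos D⁻¹ {{1/pos⇒pos D {{positive 0<D}}}} 0<ε)

      D*δ : D * (ε * D⁻¹) ≡ ε
      D*δ = trans (*-swap D ε D⁻¹)
        (trans (cong (ε *_) (*-inverseʳ D {{pos⇒nonZero D {{positive 0<D}}}})) (*-identityʳ ε))

  ∣∣*∣∣< : ∀ {D δ ε} u v → 0ℚ < D → D * δ ≡ ε → ∣ u ∣ < D → ∣ v ∣ < δ → ∣ u ∣ * ∣ v ∣ < ε
  ∣∣*∣∣< {D} {δ} {ε} u v 0<D D*δ≡ε u<D v<δ = begin-strict
    ∣ u ∣ * ∣ v ∣    ≤⟨ *-monoʳ-≤-nonNeg ∣ v ∣ {{∣-∣-nonNeg v}} (<⇒≤ u<D) ⟩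
    D * ∣ v ∣        <⟨ *-monoʳ-<-pos D {{positive 0<D}} v<δ ⟩
    D * δ            ≡⟨ D*δ≡ε ⟩
    ε                ∎
    where open ≤-Reasoning

  common-bound : ∀ {s t} → IsCauchy s → IsCauchy t →
                 ∃ λ B → 0ℚ < B × ∃ λ N → ∀ i → N ℕ.≤ i → ∣ s i ∣ < B × ∣ t i ∣ < B
  common-bound {s} {t} cs ct with eventually-bounded {s} cs | eventually-bounded {t} ct
  ... | B , 0<B , M , bs | C , 0<C , N , bt =
    B ⊔ C , <-≤-trans 0<B (p≤p⊔q B C) , M ℕ.⊔ N , λ i i≥ →
      <-≤-trans (bs i (ℕ.m⊔n≤o⇒m≤o M N i≥)) (p≤p⊔q B C) ,
      <-≤-trans (bt i (ℕ.m⊔n≤o⇒n≤o M N i≥)) (p≤q⊔p B C)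

  ∣*-sub-*∣≤ : ∀ p q r s → ∣ p * q - r * s ∣ ≤ ∣ p ∣ * ∣ q - s ∣ + ∣ s ∣ * ∣ p - r ∣
  ∣*-sub-*∣≤ p q r s = begin
    ∣ p * q - r * s ∣                        ≡⟨ cong ∣_∣ (*-sub-* p q r s) ⟩
    ∣ p * (q - s) + s * (p - r) ∣            ≤⟨ ∣p+q∣≤∣p∣+∣q∣ (p * (q - s)) (s * (p - r)) ⟩
    ∣ p * (q - s) ∣ + ∣ s * (p - r) ∣        ≡⟨ cong₂ _+_ (∣p*q∣≡∣p∣*∣q∣ p (q - s)) (∣p*q∣≡∣p∣*∣q∣ s (p - r)) ⟩
    ∣ p ∣ * ∣ q - s ∣ + ∣ s ∣ * ∣ p - r ∣    ∎
    where open ≤-Reasoning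

opaque
  *-cauchy : ∀ s t → IsCauchy s → IsCauchy t → IsCauchy (λ i → s i * t i)
  *-cauchy s t cs ct ε 0<ε with common-bound {s} {t} cs ct
  ... | B , 0<B , K , b with quotient {ε * ½} {B} (half-pos 0<ε) 0<B
  ... | δ , 0<δ , B*δ with cs δ 0<δ | ct δ 0<δ
  ... | M , p | N , q = K ℕ.⊔ (M ℕ.⊔ N) , λ i j i≥ j≥ →
      let i≥MN = ℕ.m⊔n≤o⇒n≤o K (M ℕ.⊔ N) i≥
          j≥MN = ℕ.m⊔n≤o⇒n≤o K (M ℕ.⊔ N) j≥
      in begin-strict
        ∣ s i * t i - s j * t j ∣
          ≤⟨ ∣*-sub-*∣≤ (s i) (t i) (s j) (t j) ⟩
        ∣ s i ∣ * ∣ t i - t j ∣ + ∣ t j ∣ * ∣ s i - s j ∣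
          <⟨ +-mono-<
               (∣∣*∣∣< {B} {δ} {ε * ½} (s i) (t i - t j) 0<B B*δ (proj₁ (b i (ℕ.m⊔n≤o⇒m≤o K (M ℕ.⊔ N) i≥)))
                 (q i j (ℕ.m⊔n≤o⇒n≤o M N i≥MN) (ℕ.m⊔n≤o⇒n≤o M N j≥MN)))
               (∣∣*∣∣< {B} {δ} {ε * ½} (t j) (s i - s j) 0<B B*δ (proj₂ (b j (ℕ.m⊔n≤o⇒m≤o K (M ℕ.⊔ N) j≥)))
                 (p i j (ℕ.m⊔n≤o⇒m≤o M N i≥MN) (ℕ.m⊔n≤o⇒m≤o M N j≥MN))) ⟩
        ε * ½ + ε * ½
          ≡⟨ halves ε ⟩
        ε ∎
      where open ≤-Reasoning

record ℝ : Set where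
  constructor mkℝ
  field
    seq    : ℕ → ℚ
    cauchy : IsCauchy seq

open ℝ public

infix  4 _≃ᴿ_ _<ᴿ_
infixl 6 _+ᴿ_
infixl 7 _*ᴿ_
infix  8 -ᴿ_

-- Equality of reals is the setoid relation "the difference tends to 0".
_≃ᴿ_ : ℝ → ℝ → Set
x ≃ᴿ y = ∀ ε → 0ℚ < ε → ∃ λ N → ∀ i → N ℕ.≤ i → ∣ seq x i - seq y i ∣ < ε

-- The rational gap ε is essential: a termwise inequality only gives ≤ in the limit.
_<ᴿ_ : ℝ → ℝ → Set
x <ᴿ y = ∃ λ ε → 0ℚ < ε × ∃ λ N → ∀ i → N ℕ.≤ i → seq x i + ε < seq y i

fromℚ : ℚ → ℝ
fromℚ p = mkℝ (λ _ → p) (const-cauchy p)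

0ᴿ ½ᴿ 1ᴿ 2ᴿ : ℝ
0ᴿ = fromℚ 0ℚ
½ᴿ = fromℚ ½
1ᴿ = fromℚ 1ℚ
2ᴿ = fromℚ (1ℚ + 1ℚ)

_+ᴿ_ : ℝ → ℝ → ℝ
x +ᴿ y = mkℝ (λ i → seq x i + seq y i) (+-cauchy (seq x) (seq y) (cauchy x) (cauchy y))

_*ᴿ_ : ℝ → ℝ → ℝ
x *ᴿ y = mkℝ (λ i → seq x i * seq y i) (*-cauchy (seq x) (seq y) (cauchy x) (cauchy y))

-ᴿ_ : ℝ → ℝ
-ᴿ x = mkℝ (λ i → - seq x i) (neg-cauchy (seq x) (cauchy x))

∣_∣ᴿ : ℝ → ℝ
∣ x ∣ᴿ = mkℝ (λ i → ∣ seq x i ∣) (abs-cauchy (seq x) (cauchy x))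

record ℂ : Set where
  constructor _+i_
  field
    re im : ℝ

open ℂ public

infix 4 _≃ᶜ_

_≃ᶜ_ : ℂ → ℂ → Set
z ≃ᶜ w = re z ≃ᴿ re w × im z ≃ᴿ im w

fromℝ : ℝ → ℂ
fromℝ x = x +i 0ᴿ

ℂ-rawRing : RawRing 0ℓ 0ℓ
ℂ-rawRing = record
  { Carrier = ℂ
  ; _≈_     = _≃ᶜ_
  ; _+_     = λ z w → (re z +ᴿ re w) +i (im z +ᴿ im w)
  ; _*_     = λ z w → (re z *ᴿ re w +ᴿ -ᴿ (im z *ᴿ im w)) +i (re z *ᴿ im w +ᴿ im z *ᴿ re w)
  ; -_      = λ z → (-ᴿ re z) +i (-ᴿ im z)
  ; 0#      = fromℝ 0ᴿ
  ; 1#      = fromℝ 1ᴿ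
  }

open RawRing ℂ-rawRing public using ()
  renaming (_+_ to _+ᶜ_; _*_ to _*ᶜ_; -_ to -ᶜ_; 0# to 0ᶜ; 1# to 1ᶜ)

open RawSemiringDefinitions (RawRing.rawSemiring ℂ-rawRing) public using ()
  renaming (_^_ to _^ᶜ_)

IsPrimitiveRoot : ℕ → ℂ → Set
IsPrimitiveRoot n ζ = ζ ^ᶜ n ≃ᶜ 1ᶜ × (∀ k → 0 ℕ.< k → k ℕ.< n → ¬ (ζ ^ᶜ k ≃ᶜ 1ᶜ))

totatives : ℕ → List ℕ
totatives n = filter (λ a → gcd a n ℕ.≟ 1) (map suc (upTo n))

-- Φ n ζ z is the value at z of the n-th cyclotomic polynomial, written as
-- the product over the powers of a primitive n-th root of unity ζ.  The
-- value does not depend on which primitive root is used.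
Φ : ℕ → ℂ → ℂ → ℂ
Φ n ζ z = foldr _*ᶜ_ 1ᶜ (map (λ a → z +ᶜ -ᶜ (ζ ^ᶜ a)) (totatives n))

{-# OPTIONS --safe #-}

-- Write n = a ∏P, where P is the set of primes dividing n.  Then Φ_n(x) = ± B(x^a)^{±1}
-- with B(y) = ∏ (1 − y^f)^{μ(f)} over the divisors f of ∏P, and the exponent is the sign of
-- (−1)^|P|.  Adding a prime p to P divides B(y) by B(y^p), so for 0 < y ≤ ½ induction gives
-- 1 − y ≤ B(y) ≤ (1 − y) / ∏_{p ∈ P} (1 − y^p) < 1.  Hence the value Φ_n(x), 0 < x ≤ ½,
-- determines the parity of |P| (which side of 1 it lies on), then a, and then P (of two sets
-- the one containing the first prime of the symmetric difference has the larger B).  Negative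
-- x are reduced to positive ones by Φ_n(−x) = ± Φ_{n*}(x) with n* ∈ {n, 2n, n/2}.
--
-- For |x| ≥ 2 use Φ_n(x) = ± x^{φ(n)} Φ_n(1/x).  Since φ(n) is even for n ≥ 3, unequal degrees
-- either differ by at least 2, which outweighs 1 − |1/x| ≤ |Φ_n(1/x)| ≤ 1 / (1 − |1/x|), or
-- they are 1 and 2, which leaves only {2, 6}.
--
-- All estimates are made at rational points, with an explicit gap q^K, for the polynomial T
-- obtained by clearing denominators in Φ_m(x) = Φ_n(x).  A real x with T(x) = 0 is then
-- excluded along its Cauchy sequence, and Lipschitz continuity of T carries the estimates
-- past the end points ½ and 2.

module Submission where

open import Data.Nat.Base using (ℕ; NonZero)
open import Data.Product.Base using (_×_)
open import Data.Sum.Base using (_⊎_)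
open import Relation.Binary.PropositionalEquality using (_≡_; _≢_)
open import Relation.Nullary using (¬_)
open import Defs

open import Algebra.Bundles using (CommutativeRing)
open import Algebra.Bundles.Raw using (RawRing)
import Algebra.Definitions.RawSemiring as RawSemiringDefinitions
open import Data.Bool.Base using (if_then_else_)
open import Data.Empty using (⊥; ⊥-elim)
open import Data.List.Base using (List; []; _∷_; _++_; map; filter; foldr; applyUpTo; upTo)
open import Data.List.Relation.Unary.All using (All; []; _∷_)
open import Data.List.Relation.Unary.Linked using (Linked; [-]; _∷_)
import Data.Nat.Base as ℕ
open import Data.Nat.Base using (zero; suc; s≤s; z≤n)
open import Data.Nat.Divisibility
  using (_∣_; _∣?_; ∣⇒≤; >⇒∤; divides; divides-refl; ∣-refl; ∣n⇒∣m*n; m∣m*n; n∣m*n; ∣m+n∣m⇒∣n)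
open import Data.Nat.GCD using (gcd)
open import Data.Nat.Primality using (Prime; prime?; prime[2]; euclidsLemma)
import Data.Nat.Properties as ℕ
open import Data.Product.Base using (∃; _,_; proj₁; proj₂)
open import Data.Sum.Base using (inj₁; inj₂; [_,_]′)
open import Level using (0ℓ)
open import Relation.Binary.Definitions using (tri<; tri≈; tri>)
open import Relation.Nullary using (Dec; yes; no; does)
open import Relation.Nullary.Decidable using (from-yes; from-no)

-- The point ½ enters through two facts: for `q ≤ ½` a power `q^d` is at least the sum of all higher
-- powers, and `q² ≤ (1 − q)²`. Both are sharp at ½, so rough bounds do not suffice there. Two
-- comparisons of `B` have too little room if only the order of the primes is used; parity supplies
-- the rest. When the exponents are 1 and 2, the even exponent forces 2 to be among the primes of
-- its number, which raises that `B`. Behind a common prime all primes are odd, so the first prime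
-- of the difference is followed by a gap.
--
-- For `Φ₂` and `Φ₆` there is no room at all at 2, since `1 − q + q² = q + q²` at `q = ½`. There the
-- argument changes from excluding a zero near 2 to forcing convergence to 2.
--
-- The sign of a real `x` cannot be decided, and near 0 the terms of its sequence may change sign
-- forever. Hence every estimate is made for both signs and applied index by index, according to the
-- sign of the rational term.

infixl 6 _⊕_ _⊖_
infixl 7 _⊗_
infix  9 X^_

-- A syntax, so that one expression has values both in ℂ, where the roots of unity are, and in ℚ,
-- where the estimates are made. It has no division; quotients are kept as pairs of numerator and
-- denominator.
data Poly : Set where
  X^_         : ℕ → Poly
  _⊕_ _⊖_ _⊗_ : Poly → Poly → Poly

module Eval {c ℓ} (R : RawRing c ℓ) where
  open RawRing R
  open RawSemiringDefinitions rawSemiring using (_^_)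

  ⟦_⟧ : Poly → Carrier → Carrier
  ⟦ X^ n ⟧  x = x ^ n
  ⟦ e ⊕ f ⟧ x = ⟦ e ⟧ x + ⟦ f ⟧ x
  ⟦ e ⊖ f ⟧ x = ⟦ e ⟧ x + - ⟦ f ⟧ x
  ⟦ e ⊗ f ⟧ x = ⟦ e ⟧ x * ⟦ f ⟧ x

-- With B(y) = ∏ (1 − y^f)^{μ(f)} over the squarefree f composed of the primes
-- in ps, N ps a / M ps a is B(X^a); adding p divides B(y) by B(y^p).
N M : List ℕ → ℕ → Poly
N []       a = X^ 0 ⊖ X^ a
N (p ∷ ps) a = N ps a ⊗ M ps (p ℕ.* a)
M []       a = X^ 0
M (p ∷ ps) a = M ps a ⊗ N ps (p ℕ.* a)

-- Likewise U ps a / V ps a is ∏ (1 − y^f)^{μ(∏ps / f)} at y = X^a, which up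
-- to sign is the cyclotomic polynomial of a ∏ps.
U V : List ℕ → ℕ → Poly
U []       a = N [] a
U (p ∷ ps) a = V ps a ⊗ U ps (p ℕ.* a)
V []       a = M [] a
V (p ∷ ps) a = U ps a ⊗ V ps (p ℕ.* a)

-- W ps a / V ps a is the cyclotomic polynomial itself; only Φ₁ = −(1 − x) needs the sign.
W : List ℕ → ℕ → Poly
W []       a = X^ a ⊖ X^ 0
W (p ∷ ps) a = U (p ∷ ps) a

T : ℕ → List ℕ → ℕ → List ℕ → Poly
T a ps b qs = W ps a ⊗ V qs b ⊖ W qs b ⊗ V ps a

-- Prime factorisations

module Arithmetic where
  open import Data.List.Membership.Propositional using (_∈_)
  import Data.List.Relation.Unary.All as All
  open import Data.List.Relation.Unary.Any using (here; there)
  open import Data.Nat.Base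
  open import Data.Nat.Divisibility
  open import Data.Nat.GCD
  open import Data.Nat.Induction using (<-wellFounded)
  open import Data.Nat.ListAction using (product)
  open import Data.Nat.ListAction.Properties using (∈⇒∣product)
  open import Data.Nat.Primality
  open import Data.Nat.Primality.Factorisation using (factorisationHasAllPrimeFactors)
  open import Data.Nat.Properties
  open import Induction.WellFounded using (Acc; acc)
  open import Relation.Binary.PropositionalEquality

  Ascending : List ℕ → Set
  Ascending ps = Linked _<_ (1 ∷ ps)

  lower-head : ∀ {c d ks} → c ≤ d → Linked _<_ (d ∷ ks) → Linked _<_ (c ∷ ks)
  lower-head c≤d [-]           = [-]
  lower-head c≤d (d<k ∷ k<ks) = ≤-<-trans c≤d d<k ∷ k<ks

  tail-asc : ∀ {p ps} → Ascending (p ∷ ps) → Ascending ps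
  tail-asc (1<p ∷ p<ps) = lower-head (<⇒≤ 1<p) p<ps

  -- Only the spacing is recorded: odd primes are at least 2 apart, and starting the chain at 1
  -- makes the first of them at least 3. This is what a comparison with a geometric series of ratio
  -- `y²` uses.
  OddAfter2 : List ℕ → Set
  OddAfter2 ps = Gap ps ⊎ ∃ λ ps′ → ps ≡ 2 ∷ ps′ × Gap ps′
    where Gap = λ ps → Linked (λ j k → 2 + j ≤ k) (1 ∷ ps)

  *-swap : ∀ p r a → p * (r * a) ≡ r * (p * a)
  *-swap p r a = trans (sym (*-assoc p r a)) (trans (cong (_* a) (*-comm p r)) (*-assoc r p a))

  1<prime : ∀ {p} → Prime p → 1 < p
  1<prime pp = nonTrivial⇒n>1 _ {{prime⇒nonTrivial pp}}

  -- Roughness is returned beside primality because `build` puts `p` in front of an ascending list: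
  -- no prime factor of the cofactor may be smaller.
  least-prime-factor : ∀ n → 1 < n → ∃ λ p → Prime p × p ∣ n × p Rough n
  least-prime-factor n 1<n = search (n ∸ 2) 2 (s≤s (s≤s z≤n)) 2-rough (m+[n∸m]≡n 1<n)
    where
    instance _ = n>1⇒nonTrivial 1<n

    search : ∀ k d → 1 < d → d Rough n → d + k ≡ n → ∃ λ p → Prime p × p ∣ n × p Rough n
    search k d 1<d rough d+k≡n with d ∣? n
    ... | yes d∣n = d , rough∧∣⇒prime {{n>1⇒nonTrivial 1<d}} rough d∣n , d∣n , rough
    search zero    d _ _ d+0≡n | no d∤n =
      ⊥-elim (d∤n (∣-reflexive (trans (sym (+-identityʳ d)) d+0≡n)))
    search (suc k) d 1<d rough d+k≡n | no d∤n =
      search k (suc d) (m≤n⇒m≤1+n 1<d) (∤⇒rough-suc d∤n rough) (trans (sym (+-suc d k)) d+k≡n)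

  prime∣prime : ∀ {p r} → Prime p → Prime r → p ∣ r → p ≡ r
  prime∣prime pp pr p∣r with prime⇒irreducible pr p∣r
  ... | inj₁ refl = ⊥-elim (¬prime[1] pp)
  ... | inj₂ p≡r  = p≡r

  -- n = a ∏ps built prime by prime: old and new are the cases Φ_{pn}(x) = Φ_n(x^p)
  -- and Φ_{pn}(x) Φ_n(x) = Φ_n(x^p) of the recursion for Φ.
  data Built : ℕ → ℕ → List ℕ → Set where
    one : Built 1 1 []
    old : ∀ {p n a ps} → Prime p → p ∣ n → Built n a ps → Built (p * n) (p * a) ps
    new : ∀ {p n a ps} → Prime p → ¬ p ∣ n → Linked _<_ (p ∷ ps) → Built n a ps → Built (p * n) a (p ∷ ps)

  -- What the estimates use of `n = a ∏ps`. Through `support` the exponent constrains the primes: an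
  -- empty list forces `a ≡ 1`, and an even `a` forces 2 into the list.
  record Shape (a : ℕ) (ps : List ℕ) : Set where
    field
      1≤a     : 1 ≤ a
      primes  : All Prime ps
      asc     : Ascending ps
      support : ∀ {p} → Prime p → p ∣ a → p ∈ ps

  open Shape

  built-≡ : ∀ {n a ps} → Built n a ps → n ≡ a * product ps
  built-≡ one = refl
  built-≡ (old {p} {n} {a} _ _ b) = trans (cong (p *_) (built-≡ b)) (sym (*-assoc p a _))
  built-≡ (new {p} {n} {a} {ps} _ _ _ b) = begin
    p * n                 ≡⟨ cong (p *_) (built-≡ b) ⟩
    p * (a * product ps)  ≡⟨ sym (*-assoc p a _) ⟩
    p * a * product ps    ≡⟨ cong (_* product ps) (*-comm p a) ⟩
    a * p * product ps    ≡⟨ *-assoc a p _ ⟩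
    a * (p * product ps)  ∎
    where open ≡-Reasoning

  built-shape : ∀ {n a ps} → Built n a ps → Shape a ps
  built-shape one = record
    { 1≤a = ≤-refl ; primes = [] ; asc = [-]
    ; support = λ pp p∣1 → ⊥-elim (¬prime[1] (subst Prime (∣1⇒≡1 p∣1) pp)) }
  built-shape (old {p} {n} {a} {ps} pp p∣n b) = record
    { 1≤a     = *-mono-≤ (<⇒≤ (1<prime pp)) (1≤a sh)
    ; primes  = primes sh
    ; asc     = asc sh
    ; support = supp }
    where
    sh = built-shape b
    p∈ps : p ∈ ps
    p∈ps with euclidsLemma a (product ps) pp (subst (p ∣_) (built-≡ b) p∣n)
    ... | inj₁ p∣a = support sh pp p∣a
    ... | inj₂ p∣  = factorisationHasAllPrimeFactors pp p∣ (primes sh)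
    supp : ∀ {r} → Prime r → r ∣ p * a → r ∈ ps
    supp pr r∣ with euclidsLemma p a pr r∣
    ... | inj₁ r∣p = subst (_∈ ps) (sym (prime∣prime pr pp r∣p)) p∈ps
    ... | inj₂ r∣a = support sh pr r∣a
  built-shape (new pp _ p<ps b) = record
    { 1≤a     = 1≤a sh
    ; primes  = pp ∷ primes sh
    ; asc     = 1<prime pp ∷ p<ps
    ; support = λ pr r∣a → there (support sh pr r∣a) }
    where sh = built-shape b

  built-1≤ : ∀ {n a ps} → Built n a ps → 1 ≤ n
  built-1≤ one           = ≤-refl
  built-1≤ (old pp _ b)   = *-mono-≤ (<⇒≤ (1<prime pp)) (built-1≤ b)
  built-1≤ (new pp _ _ b) = *-mono-≤ (<⇒≤ (1<prime pp)) (built-1≤ b)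

  build : ∀ n → 1 ≤ n → ∃ λ a → ∃ λ ps → Built n a ps
  build n = go n (<-wellFounded n)
    where
    go : ∀ n → Acc _<_ n → 1 ≤ n → ∃ λ a → ∃ λ ps → Built n a ps
    go 1 _ _ = 1 , [] , one
    go n@(suc (suc _)) (acc rec) _ with least-prime-factor n (s≤s (s≤s z≤n))
    ... | p , pp , p∣n , rough with go n′ (rec (quotient-< p∣n)) (>-nonZero⁻¹ n′ {{quotient≢0 p∣n}})
      where
      n′ = quotient p∣n
      instance _ = prime⇒nonTrivial pp
    ... | a , ps , b = result (p ∣? n′)
      where
      n′ = quotient p∣n

      p<head : ∀ ps → All Prime ps → Ascending ps → (∀ {r} → r ∈ ps → r ∣ n′) → ¬ p ∣ n′ → Linked _<_ (p ∷ ps)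
      p<head []       _        _          _   _   = [-]
      p<head (r ∷ ps) (pr ∷ _) (_ ∷ r<ps) div p∤n′ =
        -- A prime `r < p` in the list would be a factor of `n` below its least one, and `r ≡ p`
        -- would make `p` divide `n′`.
        ≤∧≢⇒< (≮⇒≥ λ r<p → rough (hasNonTrivialDivisor {{prime⇒nonTrivial pr}} r<p (∣-trans (div (here refl)) (quotient-∣ p∣n))))
               (λ { refl → p∤n′ (div (here refl)) }) ∷ r<ps

      in-terms-of-n : ∀ {a ps} → Built (p * n′) a ps → Built n a ps
      in-terms-of-n {a} {ps} = subst (λ n → Built n a ps) (sym (m∣n⇒n≡m*quotient p∣n))

      result : _ → ∃ λ a → ∃ λ ps → Built n a ps
      result (yes p∣n′) = p * a , ps , in-terms-of-n (old pp p∣n′ b)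
      result (no p∤n′)  = a , p ∷ ps , in-terms-of-n (new pp p∤n′ (p<head ps (primes sh) (asc sh)
          (λ r∈ → subst (_ ∣_) (sym (built-≡ b)) (∣n⇒∣m*n a (∈⇒∣product r∈))) p∤n′) b)
        where sh = built-shape b

  2∣⊎2∣suc : ∀ n → 2 ∣ n ⊎ 2 ∣ suc n
  2∣⊎2∣suc zero    = inj₁ (2 ∣0)
  2∣⊎2∣suc (suc n) with 2∣⊎2∣suc n
  ... | inj₁ 2∣n  = inj₂ (∣m∣n⇒∣m+n (n∣n {2}) 2∣n)
  ... | inj₂ 2∣sn = inj₁ 2∣sn

  odd-prime : ∀ {p} → Prime p → 2 < p → ¬ 2 ∣ p
  odd-prime pp 2<p 2∣p = <⇒≢ 2<p (prime∣prime prime[2] pp 2∣p)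

  odd⇒2∣pred : ∀ {p} → 1 < p → ¬ 2 ∣ p → 2 ∣ p ∸ 1
  odd⇒2∣pred {suc p} _ 2∤ with 2∣⊎2∣suc p
  ... | inj₁ 2∣p  = 2∣p
  ... | inj₂ 2∣sp = ⊥-elim (2∤ 2∣sp)

  odd-gap : ∀ {p r} → ¬ 2 ∣ p → ¬ 2 ∣ r → p < r → 2 + p ≤ r
  odd-gap {p} 2∤p 2∤r p<r = ≤∧≢⇒< p<r λ sp≡r → absurd sp≡r (2∣⊎2∣suc p)
    where
    absurd : suc p ≡ _ → ¬ (2 ∣ p ⊎ 2 ∣ suc p)
    absurd _    (inj₁ 2∣p)  = 2∤p 2∣p
    absurd sp≡r (inj₂ 2∣sp) = 2∤r (subst (2 ∣_) sp≡r 2∣sp)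

  OddPrimes : List ℕ → Set
  OddPrimes = All (λ p → ¬ 2 ∣ p)

  odd-primes : ∀ {d ps} → 2 ≤ d → Linked _<_ (d ∷ ps) → All Prime ps → OddPrimes ps
  odd-primes 2≤d [-]          []         = []
  odd-primes 2≤d (d<p ∷ p<ps) (pp ∷ pps) =
    odd-prime pp 2<p ∷ odd-primes (<⇒≤ 2<p) p<ps pps
    where 2<p = ≤-<-trans 2≤d d<p

  odd-gaps : ∀ {d ps} → ¬ 2 ∣ d → OddPrimes ps → Linked _<_ (d ∷ ps) → Linked (λ j k → 2 + j ≤ k) (d ∷ ps)
  odd-gaps 2∤d []         [-]          = [-]
  odd-gaps 2∤d (2∤p ∷ odds) (d<p ∷ p<ps) = odd-gap 2∤d 2∤p d<p ∷ odd-gaps 2∤p odds p<ps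

  2∤1 : ¬ 2 ∣ 1
  2∤1 2∣1 with ∣1⇒≡1 2∣1
  ... | ()

  data TwoFirst : List ℕ → Set where
    two  : ∀ {ps} → OddPrimes ps → TwoFirst (2 ∷ ps)
    odds : ∀ {ps} → OddPrimes ps → TwoFirst ps

  two-first : ∀ {ps} → Ascending ps → All Prime ps → TwoFirst ps
  two-first {[]}      _              _          = odds []
  two-first {p ∷ ps} (1<p ∷ p<ps) (pp ∷ pps) with m≤n⇒m<n∨m≡n 1<p
  ... | inj₂ refl = two (odd-primes ≤-refl p<ps pps)
  ... | inj₁ 2<p  = odds (odd-prime pp 2<p ∷ odd-primes (<⇒≤ 2<p) p<ps pps)

  odd-after-2 : ∀ {ps} → Ascending ps → All Prime ps → OddAfter2 ps
  odd-after-2 asc pps with two-first asc pps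
  ... | two o  = inj₂ (_ , refl , odd-gaps 2∤1 o (tail-asc asc))
  ... | odds o = inj₁ (odd-gaps 2∤1 o asc)

  2∈⇒head : ∀ {ps} → Ascending ps → 2 ∈ ps → ∃ λ ps′ → ps ≡ 2 ∷ ps′
  2∈⇒head {p ∷ ps} _ (here refl) = ps , refl
  2∈⇒head {p ∷ ps} (1<p ∷ p<ps) (there 2∈) = ⊥-elim (<⇒≱ (above p<ps 2∈) 1<p)
    where
    above : ∀ {d r ps} → Linked _<_ (d ∷ ps) → r ∈ ps → d < r
    above (d<p ∷ _)    (here refl) = d<p
    above (d<p ∷ p<ps) (there r∈)  = <-trans d<p (above p<ps r∈)

  -- After a common prime p is odd, and so are the primes in qs; hence they exceed p + 1.
  data FirstDifference : List ℕ → List ℕ → Set where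
    differ : ∀ cs p ps qs → Prime p → Linked _<_ (p ∷ qs) → cs ≡ [] ⊎ (3 ≤ p × Linked _<_ (suc p ∷ qs)) →
             FirstDifference (cs ++ p ∷ ps) (cs ++ qs)

  first-difference : ∀ {ps qs} → Ascending ps → Ascending qs → All Prime ps → All Prime qs → ps ≢ qs →
                     FirstDifference ps qs ⊎ FirstDifference qs ps
  first-difference {[]}     {[]}     _ _ _ _ ne = ⊥-elim (ne refl)
  first-difference {[]}     {q ∷ qs} _ _ _ (pq ∷ _) _ = inj₂ (differ [] q qs [] pq [-] (inj₁ refl))
  first-difference {p ∷ ps} {[]}     _ _ (pp ∷ _) _ _ = inj₁ (differ [] p ps [] pp [-] (inj₁ refl))
  first-difference {p ∷ ps} {q ∷ qs} (1<p ∷ ascP) (1<q ∷ ascQ) (pp ∷ pps) (pq ∷ pqs) ne with <-cmp p q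
  ... | tri< p<q _ _ = inj₁ (differ [] p ps (q ∷ qs) pp (p<q ∷ ascQ) (inj₁ refl))
  ... | tri> _ _ q<p = inj₂ (differ [] q qs (p ∷ ps) pq (q<p ∷ ascP) (inj₁ refl))
  ... | tri≈ _ refl _ = add-common (go 1<p ascP ascQ pps pqs (λ ps≡qs → ne (cong (p ∷_) ps≡qs)))
    where
    Later : List ℕ → List ℕ → Set
    Later ps qs = ∃ λ cs → ∃ λ r → ∃ λ rs → ∃ λ ss → Prime r × 3 ≤ r × Linked _<_ (suc r ∷ ss) ×
                  ps ≡ cs ++ r ∷ rs × qs ≡ cs ++ ss

    gap : ∀ {r ss} → Prime r → 2 < r → Linked _<_ (r ∷ ss) → All Prime ss → Linked _<_ (suc r ∷ ss)
    gap pr 2<r [-]          []       = [-]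
    gap pr 2<r (r<s ∷ s<ss) (ps ∷ _) = odd-gap (odd-prime pr 2<r) (odd-prime ps (<-trans 2<r r<s)) r<s ∷ s<ss

    go : ∀ {d ps qs} → 2 ≤ d → Linked _<_ (d ∷ ps) → Linked _<_ (d ∷ qs) → All Prime ps → All Prime qs →
         ps ≢ qs → Later ps qs ⊎ Later qs ps
    go {ps = []}     {[]}     _ _ _ _ _ ne = ⊥-elim (ne refl)
    go {ps = []}     {q ∷ qs} 2≤d _ (d<q ∷ _) _ (pq ∷ _) _ =
      inj₂ ([] , q , qs , [] , pq , ≤-<-trans 2≤d d<q , [-] , refl , refl)
    go {ps = p ∷ ps} {[]}     2≤d (d<p ∷ _) _ (pp ∷ _) _ _ =
      inj₁ ([] , p , ps , [] , pp , ≤-<-trans 2≤d d<p , [-] , refl , refl)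
    go {ps = p ∷ ps} {q ∷ qs} 2≤d (d<p ∷ ascP) (d<q ∷ ascQ) (pp ∷ pps) (pq ∷ pqs) ne with <-cmp p q
    ... | tri< p<q _ _ = inj₁ ([] , p , ps , q ∷ qs , pp , ≤-<-trans 2≤d d<p ,
                               gap pp (≤-<-trans 2≤d d<p) (p<q ∷ ascQ) (pq ∷ pqs) , refl , refl)
    ... | tri> _ _ q<p = inj₂ ([] , q , qs , p ∷ ps , pq , ≤-<-trans 2≤d d<q ,
                               gap pq (≤-<-trans 2≤d d<q) (q<p ∷ ascP) (pp ∷ pps) , refl , refl)
    ... | tri≈ _ refl _ with go (<⇒≤ (≤-<-trans 2≤d d<p)) ascP ascQ pps pqs (λ ps≡qs → ne (cong (p ∷_) ps≡qs))
    ...   | inj₁ (cs , r , rs , ss , pr , 3≤r , r<ss , refl , refl) = inj₁ (p ∷ cs , r , rs , ss , pr , 3≤r , r<ss , refl , refl)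
    ...   | inj₂ (cs , r , rs , ss , pr , 3≤r , r<ss , refl , refl) = inj₂ (p ∷ cs , r , rs , ss , pr , 3≤r , r<ss , refl , refl)

    difference : ∀ {ps qs} → Later ps qs → FirstDifference (p ∷ ps) (p ∷ qs)
    difference (cs , r , rs , ss , pr , 3≤r , r<ss , refl , refl) =
      differ (p ∷ cs) r rs ss pr (lower-head (n≤1+n r) r<ss) (inj₂ (3≤r , r<ss))

    add-common : Later ps qs ⊎ Later qs ps → FirstDifference (p ∷ ps) (p ∷ qs) ⊎ FirstDifference (p ∷ qs) (p ∷ ps)
    add-common (inj₁ l) = inj₁ (difference l)
    add-common (inj₂ l) = inj₂ (difference l)

  -- φ is applied to the primes of n = a ∏ps, so that degree a ps is Euler's φ(n).
  φ : List ℕ → ℕ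
  φ []       = 1
  φ (p ∷ ps) = (p ∸ 1) * φ ps

  degree : ℕ → List ℕ → ℕ
  degree a ps = a * φ ps

  no-prime-factor⇒≡1 : ∀ {a} → 1 ≤ a → (∀ {p} → Prime p → ¬ p ∣ a) → a ≡ 1
  no-prime-factor⇒≡1 {a} 1≤a none with m≤n⇒m<n∨m≡n 1≤a
  ... | inj₂ 1≡a = sym 1≡a
  ... | inj₁ 1<a with least-prime-factor a 1<a
  ...   | p , pp , p∣a , _ = ⊥-elim (none pp p∣a)

  shape-[]⇒≡1 : ∀ {a} → Shape a [] → a ≡ 1
  shape-[]⇒≡1 {a} sh = no-prime-factor⇒≡1 (1≤a sh) none
    where
    none : ∀ {p} → Prime p → ¬ p ∣ a
    none pp p∣a with support sh pp p∣a
    ... | ()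

  -- An odd prime `p` contributes the even factor `p − 1`. If 2 is the only prime, an even `a` is
  -- itself an even factor. The remaining numbers are 1 and 2, where Euler's function is 1.
  degree-parity : ∀ {a ps} → Shape a ps → (a ≡ 1 × (ps ≡ [] ⊎ ps ≡ 2 ∷ [])) ⊎ 2 ∣ degree a ps
  degree-parity {a} {[]} sh = inj₁ (shape-[]⇒≡1 sh , inj₁ refl)
  degree-parity {a} {p ∷ ps} sh with two-first (asc sh) (primes sh)
  ... | odds (2∤p ∷ _) = inj₂ (∣n⇒∣m*n a (∣m⇒∣m*n (φ ps) (odd⇒2∣pred (1<prime (All.head (primes sh))) 2∤p)))
  ... | two {r ∷ _} (2∤r ∷ _) with asc sh
  ...   | 1<2 ∷ 2<r ∷ _ = inj₂ (∣n⇒∣m*n a (∣n⇒∣m*n 1 (∣m⇒∣m*n _ (odd⇒2∣pred (<-trans 1<2 2<r) 2∤r))))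
  degree-parity {a} {p ∷ []} sh | two [] with 2 ∣? a
  ...   | yes 2∣a = inj₂ (∣m⇒∣m*n _ 2∣a)
  ...   | no 2∤a  = inj₁ (no-prime-factor⇒≡1 (1≤a sh) none , inj₂ refl)
    where
    none : ∀ {p} → Prime p → ¬ p ∣ a
    none pp p∣a with support sh pp p∣a
    ... | here refl = 2∤a p∣a

  φ≡1 : ∀ {d ps} → 2 ≤ d → Linked _<_ (d ∷ ps) → φ ps ≡ 1 → ps ≡ []
  φ≡1 {ps = []}     _   _         _  = refl
  φ≡1 {ps = p ∷ ps} 2≤d (d<p ∷ _) eq with p | m*n≡1⇒m≡1 (p ∸ 1) (φ ps) eq
  ... | suc p′ | refl = ⊥-elim (<⇒≱ d<p 2≤d)

  -- `q − 1` divides 2, so `1 < p < q ≤ 3`. Among the numbers with at least two prime factors this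
  -- singles out 6, the source of the exceptional pair.
  degree≡2 : ∀ {a p q ps} → Ascending (p ∷ q ∷ ps) → degree a (p ∷ q ∷ ps) ≡ 2 →
             a ≡ 1 × p ≡ 2 × q ≡ 3 × ps ≡ []
  degree≡2 {a} {suc p} {suc q} {ps} (s≤s 1≤p ∷ s≤s p<q ∷ q<ps) eq = finish q≡2 p≡1 eq q<ps
    where
    q∣2 : q ∣ 2
    q∣2 = subst (q ∣_) eq (∣n⇒∣m*n a (∣n⇒∣m*n p (m∣m*n (φ ps))))
    q≡2 : q ≡ 2
    q≡2 = ≤-antisym (∣⇒≤ q∣2) (≤-<-trans 1≤p p<q)
    p≡1 : p ≡ 1
    p≡1 = ≤-antisym (s≤s⁻¹ (subst (p <_) q≡2 p<q)) 1≤p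
    finish : ∀ {p q} → q ≡ 2 → p ≡ 1 → a * (p * (q * φ ps)) ≡ 2 → Linked _<_ (suc q ∷ ps) →
             a ≡ 1 × suc p ≡ 2 × suc q ≡ 3 × ps ≡ []
    finish refl refl eq 3<ps = m*n≡1⇒m≡1 a (φ ps) aφ≡1 , refl , refl ,
      φ≡1 (s≤s (s≤s z≤n)) 3<ps (m*n≡1⇒n≡1 a (φ ps) aφ≡1)
      where
      open ≡-Reasoning
      aφ≡1 : a * φ ps ≡ 1
      aφ≡1 = *-cancelˡ-≡ _ _ 2 (begin
        2 * (a * φ ps)        ≡⟨ sym (*-assoc 2 a _) ⟩
        2 * a * φ ps          ≡⟨ cong (_* φ ps) (*-comm 2 a) ⟩
        a * 2 * φ ps          ≡⟨ *-assoc a 2 _ ⟩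
        a * (2 * φ ps)        ≡⟨ cong (a *_) (sym (*-identityˡ (2 * φ ps))) ⟩
        a * (1 * (2 * φ ps))  ≡⟨ eq ⟩
        2                     ∎)

  -- Star a ps qs: the cyclotomic polynomial of a ∏qs is that of a ∏ps at −x, up to sign.
  data Star (a : ℕ) : List ℕ → List ℕ → Set where
    keep : ∀ {ps} → 2 ∣ a → Star a ps ps
    drop : ∀ {ps} → ¬ 2 ∣ a → OddPrimes ps → Star a (2 ∷ ps) ps
    add  : ∀ {ps} → ¬ 2 ∣ a → OddPrimes ps → Star a ps (2 ∷ ps)

  star : ∀ {a ps} → Shape a ps → ∃ λ qs → Star a ps qs
  star {a} {ps} sh with 2 ∣? a
  ... | yes 2∣a = ps , keep 2∣a
  ... | no 2∤a with two-first (asc sh) (primes sh)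
  ...   | two {ps′} o = ps′ , drop 2∤a o
  ...   | odds o      = 2 ∷ ps , add 2∤a o

  star-shape : ∀ {a ps qs} → Shape a ps → Star a ps qs → Shape a qs
  star-shape sh (keep _)     = sh
  star-shape sh (drop 2∤a _) = record
    { 1≤a = 1≤a sh ; primes = All.tail (primes sh) ; asc = tail-asc (asc sh)
    ; support = λ pp p∣a → other (support sh pp p∣a) p∣a }
    where
    other : ∀ {p ps} → p ∈ 2 ∷ ps → p ∣ _ → p ∈ ps
    other (here refl) 2∣a = ⊥-elim (2∤a 2∣a)
    other (there p∈)  _   = p∈
  star-shape {ps = ps} sh (add _ o) = record
    { 1≤a = 1≤a sh ; primes = prime[2] ∷ primes sh ; asc = s≤s (s≤s z≤n) ∷ above (asc sh) o
    ; support = λ pp p∣a → there (support sh pp p∣a) }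
    where
    above : ∀ {ps} → Ascending ps → OddPrimes ps → Linked _<_ (2 ∷ ps)
    above [-]          []      = [-]
    above (1<p ∷ p<ps) (2∤p ∷ _) = ≤∧≢⇒< 1<p (λ { refl → 2∤p ∣-refl }) ∷ p<ps

  -- Two different numbers stay different when `x` is replaced by `−x`. The mixed cases contradict
  -- either the parity of `a` or the oddness of the remaining primes.
  star-injective : ∀ {a ps qs rs} → Star a ps rs → Star a qs rs → ps ≡ qs
  star-injective (keep _)     (keep _)     = refl
  star-injective (keep 2∣a)   (drop 2∤a _) = ⊥-elim (2∤a 2∣a)
  star-injective (keep 2∣a)   (add 2∤a _)  = ⊥-elim (2∤a 2∣a)
  star-injective (drop 2∤a _) (keep 2∣a)   = ⊥-elim (2∤a 2∣a)
  star-injective (drop _ _)   (drop _ _)   = refl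
  star-injective (drop _ (2∤2 ∷ _)) (add _ _) = ⊥-elim (2∤2 ∣-refl)
  star-injective (add 2∤a _)  (keep 2∣a)   = ⊥-elim (2∤a 2∣a)
  star-injective (add _ _)    (drop _ (2∤2 ∷ _)) = ⊥-elim (2∤2 ∣-refl)
  star-injective (add _ _)    (add _ _)    = refl

  -- Coprimality and multiplication by a prime

  NoCommonPrime : ℕ → ℕ → Set
  NoCommonPrime x n = ∀ {r} → Prime r → r ∣ x → ¬ r ∣ n

  gcd≡1⇒ : ∀ x n → gcd x n ≡ 1 → NoCommonPrime x n
  gcd≡1⇒ x n eq pr r∣x r∣n = ¬prime[1] (subst Prime (∣1⇒≡1 (subst (_ ∣_) eq (gcd-greatest r∣x r∣n))) pr)

  ⇒gcd≡1 : ∀ x n → 1 ≤ n → NoCommonPrime x n → gcd x n ≡ 1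
  ⇒gcd≡1 x n@(suc _) _ none = no-prime-factor⇒≡1
    (>-nonZero⁻¹ (gcd x n) {{≢-nonZero (gcd[m,n]≢0 x n (inj₂ λ ()))}})
    λ pr r∣g → none pr (∣-trans r∣g (gcd[m,n]∣m x n)) (∣-trans r∣g (gcd[m,n]∣n x n))

  module _ {p n} (pp : Prime p) (1≤n : 1 ≤ n) where

    private
      1≤pn : 1 ≤ p * n
      1≤pn = *-mono-≤ (<⇒≤ (1<prime pp)) 1≤n

    gcd-*⇒ : ∀ x → gcd x (p * n) ≡ 1 → gcd x n ≡ 1
    gcd-*⇒ x eq = ⇒gcd≡1 x n 1≤n λ pr r∣x r∣n → gcd≡1⇒ x (p * n) eq pr r∣x (∣n⇒∣m*n p r∣n)

    gcd-*⇐-∣ : p ∣ n → ∀ x → gcd x n ≡ 1 → gcd x (p * n) ≡ 1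
    gcd-*⇐-∣ p∣n x eq = ⇒gcd≡1 x (p * n) 1≤pn common
      where
      common : NoCommonPrime x (p * n)
      common pr r∣x r∣pn with euclidsLemma p n pr r∣pn
      ... | inj₂ r∣n = gcd≡1⇒ x n eq pr r∣x r∣n
      ... | inj₁ r∣p = gcd≡1⇒ x n eq pr r∣x (subst (_∣ n) (sym (prime∣prime pr pp r∣p)) p∣n)

    gcd-*⇐-∤ : ∀ x → ¬ p ∣ x → gcd x n ≡ 1 → gcd x (p * n) ≡ 1
    gcd-*⇐-∤ x p∤x eq = ⇒gcd≡1 x (p * n) 1≤pn common
      where
      common : NoCommonPrime x (p * n)
      common pr r∣x r∣pn with euclidsLemma p n pr r∣pn
      ... | inj₂ r∣n = gcd≡1⇒ x n eq pr r∣x r∣n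
      ... | inj₁ r∣p = p∤x (subst (_∣ x) (prime∣prime pr pp r∣p) r∣x)

    gcd-*≢1 : ∀ x → p ∣ x → gcd x (p * n) ≢ 1
    gcd-*≢1 x p∣x eq = gcd≡1⇒ x (p * n) eq pp p∣x (m∣m*n n)

    gcd-p*⇒ : ∀ x → gcd (p * x) n ≡ 1 → gcd x n ≡ 1
    gcd-p*⇒ x eq = ⇒gcd≡1 x n 1≤n λ pr r∣x r∣n → gcd≡1⇒ (p * x) n eq pr (∣n⇒∣m*n p r∣x) r∣n

    gcd-p*⇐ : ¬ p ∣ n → ∀ x → gcd x n ≡ 1 → gcd (p * x) n ≡ 1
    gcd-p*⇐ p∤n x eq = ⇒gcd≡1 (p * x) n 1≤n common
      where
      common : NoCommonPrime (p * x) n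
      common pr r∣px r∣n with euclidsLemma p x pr r∣px
      ... | inj₁ r∣p = p∤n (subst (_∣ n) (prime∣prime pr pp r∣p) r∣n)
      ... | inj₂ r∣x = gcd≡1⇒ x n eq pr r∣x r∣n

  gcd-shift⇒ : ∀ {n} x j → 1 ≤ n → gcd (j * n + x) n ≡ 1 → gcd x n ≡ 1
  gcd-shift⇒ {n} x j 1≤n eq = ⇒gcd≡1 x n 1≤n λ pr r∣x r∣n →
    gcd≡1⇒ (j * n + x) n eq pr (∣m∣n⇒∣m+n (∣n⇒∣m*n j r∣n) r∣x) r∣n

  gcd-shift⇐ : ∀ {n} x j → 1 ≤ n → gcd x n ≡ 1 → gcd (j * n + x) n ≡ 1
  gcd-shift⇐ {n} x j 1≤n eq = ⇒gcd≡1 (j * n + x) n 1≤n λ pr r∣ r∣n →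
    gcd≡1⇒ x n eq pr (∣m+n∣m⇒∣n r∣ (∣n⇒∣m*n j r∣n)) r∣n

-- Cyclotomic polynomials over an integral domain

open Arithmetic

module Cyclotomic {c ℓ} (R : CommutativeRing c ℓ)
  (cancel : ∀ x y → CommutativeRing._≈_ R (CommutativeRing._*_ R x y) (CommutativeRing.0# R) →
            ¬ CommutativeRing._≈_ R x (CommutativeRing.0# R) → CommutativeRing._≈_ R y (CommutativeRing.0# R)) where

  open CommutativeRing R hiding (zero)
  open import Algebra.Properties.CommutativeSemiring.Exp commutativeSemiring
  open import Algebra.Properties.Ring ring
    using (-1*x≈-x; -‿distribˡ-*; -‿involutive; -‿+-comm; +-cancelʳ; +-inverseˡ-unique)
  open import Algebra.Solver.Ring.NaturalCoefficients.Default commutativeSemiring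
    using (solve; _:=_; _:+_; _:*_; con)
  open import Function.Base using (_∘_)
  import Relation.Binary.PropositionalEquality as ≡
  open import Relation.Binary.Reasoning.Setoid setoid
  open Eval rawRing

  ∏ : (ℕ → Carrier) → ℕ → Carrier
  ∏ f zero    = 1#
  ∏ f (suc n) = f 0 * ∏ (f ∘ suc) n

  ∏-cong : ∀ {f g} n → (∀ k → k ℕ.< n → f k ≈ g k) → ∏ f n ≈ ∏ g n
  ∏-cong zero    f≈g = refl
  ∏-cong (suc n) f≈g = *-cong (f≈g 0 (ℕ.s≤s ℕ.z≤n)) (∏-cong n λ k k<n → f≈g (suc k) (ℕ.s≤s k<n))

  ∏-1 : ∀ n → ∏ (λ _ → 1#) n ≈ 1#
  ∏-1 zero    = refl
  ∏-1 (suc n) = trans (*-identityˡ _) (∏-1 n)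

  ∏-* : ∀ f g n → ∏ (λ k → f k * g k) n ≈ ∏ f n * ∏ g n
  ∏-* f g zero    = sym (*-identityˡ 1#)
  ∏-* f g (suc n) = trans (*-congˡ (∏-* (f ∘ suc) (g ∘ suc) n))
    (solve 4 (λ a b x y → a :* b :* (x :* y) := a :* x :* (b :* y)) refl (f 0) (g 0) (∏ (f ∘ suc) n) (∏ (g ∘ suc) n))

  ∏-+ : ∀ f m n → ∏ f (m ℕ.+ n) ≈ ∏ f m * ∏ (λ k → f (m ℕ.+ k)) n
  ∏-+ f zero    n = sym (*-identityˡ _)
  ∏-+ f (suc m) n = trans (*-congˡ (∏-+ (f ∘ suc) m n)) (sym (*-assoc _ _ _))

  ∏-suc : ∀ f n → ∏ f (suc n) ≈ ∏ f n * f n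
  ∏-suc f n = begin
    ∏ f (suc n)                        ≡⟨ ≡.cong (∏ f) (≡.sym (ℕ.+-comm n 1)) ⟩
    ∏ f (n ℕ.+ 1)                      ≈⟨ ∏-+ f n 1 ⟩
    ∏ f n * (f (n ℕ.+ 0) * 1#)         ≈⟨ *-congˡ (*-identityʳ _) ⟩
    ∏ f n * f (n ℕ.+ 0)                ≡⟨ ≡.cong (λ k → ∏ f n * f k) (ℕ.+-identityʳ n) ⟩
    ∏ f n * f n                        ∎

  ∏-blocks : ∀ f m n → ∏ f (m ℕ.* n) ≈ ∏ (λ j → ∏ (λ k → f (j ℕ.* n ℕ.+ k)) n) m
  ∏-blocks f zero    n = refl
  ∏-blocks f (suc m) n = begin
    ∏ f (n ℕ.+ m ℕ.* n)                                     ≈⟨ ∏-+ f n (m ℕ.* n) ⟩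
    ∏ f n * ∏ (λ k → f (n ℕ.+ k)) (m ℕ.* n)                 ≈⟨ *-congˡ (∏-blocks (λ k → f (n ℕ.+ k)) m n) ⟩
    ∏ f n * ∏ (λ j → ∏ (λ k → f (n ℕ.+ (j ℕ.* n ℕ.+ k))) n) m
      ≈⟨ *-congˡ (∏-cong m λ j _ → ∏-cong n λ k _ → reflexive (≡.cong f (≡.sym (ℕ.+-assoc n (j ℕ.* n) k)))) ⟩
    ∏ f n * ∏ (λ j → ∏ (λ k → f (n ℕ.+ j ℕ.* n ℕ.+ k)) n) m ∎

  ∏-swap : ∀ (f : ℕ → ℕ → Carrier) m n → ∏ (λ j → ∏ (f j) n) m ≈ ∏ (λ k → ∏ (λ j → f j k) m) n
  ∏-swap f zero    n = sym (∏-1 n)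
  ∏-swap f (suc m) n = trans (*-congˡ (∏-swap (f ∘ suc) m n)) (sym (∏-* (f 0) (λ k → ∏ (λ j → f (suc j) k) m) n))

  ∏-vanishing : ∀ f n → f 0 ≈ 0# → ∏ f (suc n) ≈ 0#
  ∏-vanishing f n f0≈0 = trans (*-congʳ f0≈0) (zeroˡ _)

  -- The elementary symmetric polynomials of 1, ω, …, ω^{n−1}.
  esym : Carrier → ℕ → ℕ → Carrier
  esym ω n       zero    = 1#
  esym ω zero    (suc k) = 0#
  esym ω (suc n) (suc k) = esym ω n (suc k) + ω ^ n * esym ω n k

  esym-vanish : ∀ ω {n k} → n ℕ.< k → esym ω n k ≈ 0#
  esym-vanish ω {zero}  {suc k} _           = refl
  esym-vanish ω {suc n} {suc k} (ℕ.s≤s n<k) = trans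
    (+-cong (esym-vanish ω (ℕ.m<n⇒m<1+n n<k)) (trans (*-congˡ (esym-vanish ω n<k)) (zeroʳ _))) (+-identityˡ 0#)

  -- This is (ω^{k+1} − 1) e_{k+1} = (ω^n − ω^k) e_k without subtraction.
  esym-recurrence : ∀ ω n k → ω ^ suc k * esym ω n (suc k) + ω ^ k * esym ω n k ≈ esym ω n (suc k) + ω ^ n * esym ω n k
  esym-recurrence ω zero    zero    = +-congʳ (zeroʳ _)
  esym-recurrence ω zero    (suc k) = +-cong (zeroʳ _) (trans (zeroʳ _) (sym (zeroʳ _)))
  esym-recurrence ω (suc n) zero    = begin
    ω ^ 1 * (e₁ + O * 1#) + 1# * 1#         ≈⟨ solve 4 (λ A e O x → A :* (e :+ O :* con 1) :+ con 1 :* con 1 := A :* e :+ con 1 :* con 1 :+ A :* O) refl (ω ^ 1) e₁ O 1# ⟩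
    (ω ^ 1 * e₁ + 1# * 1#) + ω ^ 1 * O      ≈⟨ +-congʳ (esym-recurrence ω n zero) ⟩
    (e₁ + O * 1#) + ω ^ 1 * O               ≈⟨ +-congˡ (*-congʳ (*-identityʳ ω)) ⟩
    (e₁ + O * 1#) + ω * O                   ≈⟨ +-congˡ (sym (*-identityʳ (ω * O))) ⟩
    (e₁ + O * 1#) + ω * O * 1#              ∎
    where
    e₁ = esym ω n 1
    O = ω ^ n
  esym-recurrence ω (suc n) (suc k) = begin
    ω * K * (e₂ + O * e₁) + K * (e₁ + O * e₀)
      ≈⟨ solve 6 (λ ω K O e₂ e₁ e₀ → ω :* K :* (e₂ :+ O :* e₁) :+ K :* (e₁ :+ O :* e₀) :=
           (ω :* K :* e₂ :+ K :* e₁) :+ (ω :* K :* O :* e₁ :+ K :* O :* e₀)) refl ω K O e₂ e₁ e₀ ⟩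
    (ω * K * e₂ + K * e₁) + (ω * K * O * e₁ + ω * ω ^ k * O * e₀)
      ≈⟨ +-cong (esym-recurrence ω n (suc k))
           (solve 6 (λ ω K k O e₁ e₀ → ω :* K :* O :* e₁ :+ ω :* k :* O :* e₀ := ω :* O :* (K :* e₁ :+ k :* e₀)) refl ω K (ω ^ k) O e₁ e₀) ⟩
    (e₂ + O * e₁) + ω * O * (K * e₁ + ω ^ k * e₀)    ≈⟨ +-congˡ (*-congˡ (esym-recurrence ω n k)) ⟩
    (e₂ + O * e₁) + ω * O * (e₁ + O * e₀)            ∎
    where
    K = ω ^ suc k
    O = ω ^ n
    e₀ = esym ω n k
    e₁ = esym ω n (suc k)
    e₂ = esym ω n (suc (suc k))

  -- H g z c n = ∑_{k ≤ n} g k c^k z^{n−k}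
  H : (ℕ → Carrier) → Carrier → Carrier → ℕ → Carrier
  H g z c zero    = g 0
  H g z c (suc n) = z * H g z c n + g (suc n) * c ^ suc n

  -- The recursion of `esym` in `n`, summed over all coefficients: this is multiplication by the
  -- next factor `z + c ω^n`.
  H-esym-suc : ∀ ω z c n m → H (esym ω (suc n)) z c (suc m) ≈ H (esym ω n) z c (suc m) + ω ^ n * c * H (esym ω n) z c m
  H-esym-suc ω z c n zero = solve 4 (λ z e O c → z :* con 1 :+ (e :+ O :* con 1) :* (c :* con 1) :=
    z :* con 1 :+ e :* (c :* con 1) :+ O :* c :* con 1) refl z (esym ω n 1) (ω ^ n) c
  H-esym-suc ω z c n (suc m) = begin
    z * H (esym ω (suc n)) z c (suc m) + (e₂ + O * e₁) * (c * C)      ≈⟨ +-congʳ (*-congˡ (H-esym-suc ω z c n m)) ⟩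
    z * (z * h + e₁ * C + O * c * h) + (e₂ + O * e₁) * (c * C)
      ≈⟨ solve 7 (λ z h e₁ e₂ C O c → z :* (z :* h :+ e₁ :* C :+ O :* c :* h) :+ (e₂ :+ O :* e₁) :* (c :* C) :=
           z :* (z :* h :+ e₁ :* C) :+ e₂ :* (c :* C) :+ O :* c :* (z :* h :+ e₁ :* C)) refl z h e₁ e₂ C O c ⟩
    z * (z * h + e₁ * C) + e₂ * (c * C) + O * c * (z * h + e₁ * C)    ∎
    where
    h = H (esym ω n) z c m
    C = c ^ suc m
    O = ω ^ n
    e₁ = esym ω n (suc m)
    e₂ = esym ω n (suc (suc m))

  ∏≈H : ∀ ω z c n → ∏ (λ j → z + c * ω ^ j) n ≈ H (esym ω n) z c n
  ∏≈H ω z c zero    = refl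
  ∏≈H ω z c (suc n) = begin
    ∏ (λ j → z + c * ω ^ j) (suc n)                  ≈⟨ ∏-suc _ n ⟩
    ∏ (λ j → z + c * ω ^ j) n * (z + c * O)          ≈⟨ *-congʳ (∏≈H ω z c n) ⟩
    h * (z + c * O)                                  ≈⟨ solve 4 (λ h z c O → h :* (z :+ c :* O) := z :* h :+ O :* c :* h) refl h z c O ⟩
    z * h + O * c * h                                ≈⟨ +-congʳ (sym (trans (+-congˡ (trans (*-congʳ (esym-vanish ω (ℕ.n<1+n n))) (zeroˡ _))) (+-identityʳ _))) ⟩
    z * h + esym ω n (suc n) * c ^ suc n + O * c * h ≈⟨ sym (H-esym-suc ω z c n n) ⟩
    H (esym ω (suc n)) z c (suc n)                   ∎
    where
    h = H (esym ω n) z c n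
    O = ω ^ n

  IsPrimitive : ℕ → Carrier → Set ℓ
  IsPrimitive n ζ = ζ ^ n ≈ 1# × (∀ k → 0 ℕ.< k → k ℕ.< n → ¬ ζ ^ k ≈ 1#)

  x-y≈0⇒x≈y : ∀ {x y} → x - y ≈ 0# → x ≈ y
  x-y≈0⇒x≈y {x} {y} x-y≈0 = trans (+-inverseˡ-unique x (- y) x-y≈0) (-‿involutive y)

  [x-y]z≈0 : ∀ {x y z} → x * z ≈ y * z → (x - y) * z ≈ 0#
  [x-y]z≈0 {x} {y} {z} xz≈yz = begin
    (x - y) * z        ≈⟨ distribʳ z x (- y) ⟩
    x * z + - y * z    ≈⟨ +-cong xz≈yz (sym (-‿distribˡ-* y z)) ⟩
    y * z - y * z      ≈⟨ -‿inverseʳ (y * z) ⟩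
    0#                 ∎

  x≈yx⇒x≈0 : ∀ {x y} → ¬ y ≈ 1# → y * x ≈ x → x ≈ 0#
  x≈yx⇒x≈0 {x} y≉1 yx≈x = cancel _ _ ([x-y]z≈0 (trans yx≈x (sym (*-identityˡ x)))) (λ y-1≈0 → y≉1 (x-y≈0⇒x≈y y-1≈0))

  *-cancelʳ-≉0 : ∀ {x y z} → ¬ z ≈ 0# → x * z ≈ y * z → x ≈ y
  *-cancelʳ-≉0 {x} {y} {z} z≉0 xz≈yz = x-y≈0⇒x≈y (cancel _ _ (trans (*-comm z (x - y)) ([x-y]z≈0 xz≈yz)) z≉0)

  -- In `esym-recurrence` at `n = p` the side `(ω^p − ω^k) e_k` vanishes: for `k = 0` because
  -- `ω^p = 1`, for larger `k` because `e_k = 0` by induction. Since `ω^(k+1) ≠ 1`, the domain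
  -- property gives `e_(k+1) = 0`.
  esym-primitive : ∀ {ω p} → IsPrimitive p ω → ∀ k → suc k ℕ.< p → esym ω p (suc k) ≈ 0#
  esym-primitive {ω} {p} prim@(ω^p≈1 , ω^k≉1) k k<p = x≈yx⇒x≈0 (ω^k≉1 (suc k) (ℕ.s≤s ℕ.z≤n) k<p)
    (+-cancelʳ (esym ω p k) _ _ (begin
      ω ^ suc k * e₁ + e₀          ≈⟨ +-congˡ (sym (lower k k<p)) ⟩
      ω ^ suc k * e₁ + ω ^ k * e₀  ≈⟨ esym-recurrence ω p k ⟩
      e₁ + ω ^ p * e₀              ≈⟨ +-congˡ (trans (*-congʳ ω^p≈1) (*-identityˡ e₀)) ⟩
      e₁ + e₀                      ∎))
    where
    e₀ = esym ω p k
    e₁ = esym ω p (suc k)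
    lower : ∀ k → suc k ℕ.< p → ω ^ k * esym ω p k ≈ esym ω p k
    lower zero    _   = *-identityˡ 1#
    lower (suc k) k<p = trans (*-congˡ e≈0) (trans (zeroʳ _) (sym e≈0))
      where e≈0 = esym-primitive prim k (ℕ.<-trans (ℕ.n<1+n (suc k)) k<p)

  H-primitive : ∀ {ω p} → IsPrimitive (suc p) ω → ∀ z c →
                H (esym ω (suc p)) z c (suc p) ≈ z ^ suc p + esym ω (suc p) (suc p) * c ^ suc p
  H-primitive {ω} {p} prim z c = +-congʳ (*-congˡ (leading p ℕ.≤-refl))
    where
    leading : ∀ m → m ℕ.≤ p → H (esym ω (suc p)) z c m ≈ z ^ m
    leading zero    _   = refl
    leading (suc m) m<p = begin
      z * H (esym ω (suc p)) z c m + esym ω (suc p) (suc m) * c ^ suc m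
        ≈⟨ +-cong (*-congˡ (leading m (ℕ.<⇒≤ m<p))) (trans (*-congʳ (esym-primitive prim m (ℕ.s≤s m<p))) (zeroˡ _)) ⟩
      z * z ^ m + 0#    ≈⟨ +-identityʳ _ ⟩
      z ^ suc m         ∎

  1^ : ∀ n → 1# ^ n ≈ 1#
  1^ zero    = refl
  1^ (suc n) = trans (*-identityˡ _) (1^ n)

  -- All middle symmetric functions of the powers of `ω` vanish, so the product has only its two
  -- extreme terms. This argument concerns values only and avoids polynomial division and the
  -- counting of roots.
  ∏-roots : ∀ {ω p} → 1 ℕ.≤ p → IsPrimitive p ω → ∀ z u → ∏ (λ j → z + - (u * ω ^ j)) p ≈ z ^ p + - (u ^ p)
  ∏-roots {ω} {suc p} _ prim z u = begin
    ∏ (λ j → z + - (u * ω ^ j)) (suc p)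
      ≈⟨ ∏-cong (suc p) (λ j _ → +-congˡ {z} (trans (sym (-1*x≈-x _)) (sym (*-assoc (- 1#) u (ω ^ j))))) ⟩
    ∏ (λ j → z + - 1# * u * ω ^ j) (suc p)         ≈⟨ expand z (- 1# * u) ⟩
    z ^ suc p + e * (- 1# * u) ^ suc p             ≈⟨ +-congˡ (*-congˡ (^-distrib-* (- 1#) u (suc p))) ⟩
    z ^ suc p + e * ((- 1#) ^ suc p * u ^ suc p)   ≈⟨ +-congˡ (sym (*-assoc e _ _)) ⟩
    z ^ suc p + e * (- 1#) ^ suc p * u ^ suc p     ≈⟨ +-congˡ (*-congʳ constant) ⟩
    z ^ suc p + - 1# * u ^ suc p                   ≈⟨ +-congˡ (-1*x≈-x _) ⟩
    z ^ suc p + - (u ^ suc p)                      ∎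
    where
    e = esym ω (suc p) (suc p)
    expand : ∀ z c → ∏ (λ j → z + c * ω ^ j) (suc p) ≈ z ^ suc p + e * c ^ suc p
    expand z c = trans (∏≈H ω z c (suc p)) (H-primitive prim z c)
    -- The last symmetric function is read off at `z = 1`, `c = −1`: there the factor with `j = 0`
    -- vanishes, so the two extreme terms add up to 0.
    constant : e * (- 1#) ^ suc p ≈ - 1#
    constant = +-inverseˡ-unique _ _ (begin
      e * (- 1#) ^ suc p + 1#            ≈⟨ +-comm _ 1# ⟩
      1# + e * (- 1#) ^ suc p            ≈⟨ +-congʳ (sym (1^ (suc p))) ⟩
      1# ^ suc p + e * (- 1#) ^ suc p    ≈⟨ sym (expand 1# (- 1#)) ⟩
      ∏ (λ j → 1# + - 1# * ω ^ j) (suc p)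
        ≈⟨ ∏-vanishing (λ j → 1# + - 1# * ω ^ j) p (trans (+-congˡ (*-identityʳ _)) (-‿inverseʳ 1#)) ⟩
      0#                                 ∎)

  -- Products over totatives

  select : ∀ {p} {P : Set p} → Dec P → Carrier → Carrier
  select P? x = if does P? then x else 1#

  select-cong : ∀ {p q} {P : Set p} {Q : Set q} (P? : Dec P) (Q? : Dec Q) {x y} → (P → Q) → (Q → P) → x ≈ y →
                select P? x ≈ select Q? y
  select-cong (yes p) (yes q) _   _   x≈y = x≈y
  select-cong (no ¬p) (no ¬q) _   _   x≈y = refl
  select-cong (yes p) (no ¬q) P⇒Q _   x≈y = ⊥-elim (¬q (P⇒Q p))
  select-cong (no ¬p) (yes q) _   Q⇒P x≈y = ⊥-elim (¬p (Q⇒P q))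

  select-∏ : ∀ {p} {P : Set p} (P? : Dec P) f n → ∏ (λ j → select P? (f j)) n ≈ select P? (∏ f n)
  select-∏ (yes _) f n = refl
  select-∏ (no _)  f n = ∏-1 n

  root-factor : Carrier → Carrier → ℕ → Carrier
  root-factor ζ z a = z + - (ζ ^ a)

  -- Definitionally equal to Φ when R is ℂ.
  cyclotomic : ℕ → Carrier → Carrier → Carrier
  cyclotomic n ζ z = foldr _*_ 1# (map (root-factor ζ z) (filter (λ a → gcd a n ℕ.≟ 1) (map suc (upTo n))))

  totative-product : ℕ → Carrier → Carrier → Carrier
  totative-product n ζ z = ∏ (λ k → select (gcd (suc k) n ℕ.≟ 1) (root-factor ζ z (suc k))) n

  -- Turns the filtered list into a product over a full interval of indices, which can be cut into
  -- blocks and reordered. The general `g` is for the induction: removing the first index replaces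
  -- `g` by `g ∘ suc`.
  foldr-filter : ∀ {p} {P : ℕ → Set p} (P? : ∀ k → Dec (P k)) f g m →
    foldr _*_ 1# (map f (filter P? (map suc (applyUpTo g m)))) ≈ ∏ (λ k → select (P? (suc (g k))) (f (suc (g k)))) m
  foldr-filter P? f g zero    = refl
  foldr-filter P? f g (suc m) with P? (suc (g 0))
  ... | yes _ = *-congˡ (foldr-filter P? f (g ∘ suc) m)
  ... | no _  = trans (foldr-filter P? f (g ∘ suc) m) (sym (*-identityˡ _))

  cyclotomic≈ : ∀ n ζ z → cyclotomic n ζ z ≈ totative-product n ζ z
  cyclotomic≈ n ζ z = foldr-filter (λ a → gcd a n ℕ.≟ 1) (root-factor ζ z) (λ k → k) n

  ^-comm : ∀ x m n → (x ^ m) ^ n ≈ (x ^ n) ^ m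
  ^-comm x m n = trans (^-assocʳ x m n) (trans (^-congʳ x (ℕ.*-comm m n)) (sym (^-assocʳ x n m)))

  primitive-^ : ∀ {p n ζ} → 1 ℕ.≤ p → IsPrimitive (p ℕ.* n) ζ → IsPrimitive n (ζ ^ p)
  primitive-^ {p} {n} {ζ} 1≤p (ζ^pn≈1 , ζ^k≉1) = trans (^-assocʳ ζ p n) ζ^pn≈1 , λ k 0<k k<n ζ^pk≈1 →
    ζ^k≉1 (p ℕ.* k) (ℕ.*-mono-≤ 1≤p 0<k) (ℕ.*-monoʳ-< p {{ℕ.>-nonZero 1≤p}} k<n) (trans (sym (^-assocʳ ζ p k)) ζ^pk≈1)

  module _ {p n} (1≤p : 1 ℕ.≤ p) (1≤n : 1 ℕ.≤ n) {ζ} (prim : IsPrimitive (p ℕ.* n) ζ) where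

    unity-power : IsPrimitive p (ζ ^ n)
    unity-power = primitive-^ 1≤n (≡.subst (λ m → IsPrimitive m ζ) (ℕ.*-comm p n) prim)

    -- A residue `k + 1` coprime to `n` has the `p` lifts `j n + k + 1`, and `ζ^(j n + k + 1)` is
    -- `ζ^(k+1)` times the `j`-th power of the primitive `p`-th root `ζ^n`. Thus `∏-roots` collapses
    -- each fibre to one factor at `z^p`.
    all-lifts : ∀ z → ∏ (λ l → select (gcd (suc l) n ℕ.≟ 1) (root-factor ζ z (suc l))) (p ℕ.* n) ≈
                      totative-product n (ζ ^ p) (z ^ p)
    all-lifts z = begin
      ∏ (λ l → chosen (suc l) (suc l)) (p ℕ.* n)                             ≈⟨ ∏-blocks (λ l → chosen (suc l) (suc l)) p n ⟩
      ∏ (λ j → ∏ (λ k → chosen (suc (j ℕ.* n ℕ.+ k)) (suc (j ℕ.* n ℕ.+ k))) n) p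
        ≈⟨ ∏-cong p (λ j _ → ∏-cong n λ k _ → shifted j k) ⟩
      ∏ (λ j → ∏ (λ k → chosen (suc k) (j ℕ.* n ℕ.+ suc k)) n) p             ≈⟨ ∏-swap (λ j k → chosen (suc k) (j ℕ.* n ℕ.+ suc k)) p n ⟩
      ∏ (λ k → ∏ (λ j → chosen (suc k) (j ℕ.* n ℕ.+ suc k)) p) n             ≈⟨ ∏-cong n (λ k _ → fibre k) ⟩
      totative-product n (ζ ^ p) (z ^ p)                                     ∎
      where
      chosen : ℕ → ℕ → Carrier
      chosen a b = select (gcd a n ℕ.≟ 1) (root-factor ζ z b)

      shifted : ∀ j k → chosen (suc (j ℕ.* n ℕ.+ k)) (suc (j ℕ.* n ℕ.+ k)) ≈ chosen (suc k) (j ℕ.* n ℕ.+ suc k)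
      shifted j k = trans (reflexive (≡.cong (λ l → chosen l l) (≡.sym (ℕ.+-suc (j ℕ.* n) k))))
        (select-cong (gcd (j ℕ.* n ℕ.+ suc k) n ℕ.≟ 1) (gcd (suc k) n ℕ.≟ 1)
          (gcd-shift⇒ (suc k) j 1≤n) (gcd-shift⇐ (suc k) j 1≤n) refl)

      fibre : ∀ k → ∏ (λ j → chosen (suc k) (j ℕ.* n ℕ.+ suc k)) p ≈ select (gcd (suc k) n ℕ.≟ 1) (root-factor (ζ ^ p) (z ^ p) (suc k))
      fibre k = trans (select-∏ (gcd (suc k) n ℕ.≟ 1) (λ j → root-factor ζ z (j ℕ.* n ℕ.+ suc k)) p)
        (select-cong (gcd (suc k) n ℕ.≟ 1) (gcd (suc k) n ℕ.≟ 1) (λ x → x) (λ x → x) (begin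
          ∏ (λ j → z + - (ζ ^ (j ℕ.* n ℕ.+ suc k))) p        ≈⟨ ∏-cong p (λ j _ → +-congˡ {z} (-‿cong (power j))) ⟩
          ∏ (λ j → z + - (ζ ^ suc k * (ζ ^ n) ^ j)) p        ≈⟨ ∏-roots 1≤p unity-power z (ζ ^ suc k) ⟩
          z ^ p + - ((ζ ^ suc k) ^ p)                        ≈⟨ +-congˡ {z ^ p} (-‿cong (^-comm ζ (suc k) p)) ⟩
          z ^ p + - ((ζ ^ p) ^ suc k)                        ∎))
        where
        power : ∀ j → ζ ^ (j ℕ.* n ℕ.+ suc k) ≈ ζ ^ suc k * (ζ ^ n) ^ j
        power j = trans (^-homo-* ζ (j ℕ.* n) (suc k)) (trans (*-comm _ _)
          (*-congˡ (trans (^-congʳ ζ (ℕ.*-comm j n)) (sym (^-assocʳ ζ n j)))))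

    totatives-∣ : Prime p → p ∣ n → ∀ z → totative-product (p ℕ.* n) ζ z ≈ totative-product n (ζ ^ p) (z ^ p)
    totatives-∣ pp p∣n z = trans (∏-cong (p ℕ.* n) λ l _ → select-cong (gcd (suc l) (p ℕ.* n) ℕ.≟ 1) (gcd (suc l) n ℕ.≟ 1)
        (gcd-*⇒ pp 1≤n (suc l)) (gcd-*⇐-∣ pp 1≤n p∣n (suc l)) refl)
      (all-lifts z)

    -- A number coprime to `n` is either coprime to `p n` or a multiple `p b` with `b` coprime to
    -- `n`. The multiples contribute the powers of `ζ^p`, that is, the value of `Φ_n` at `z` itself.
    totatives-∤ : Prime p → ¬ p ∣ n → ∀ z →
      totative-product (p ℕ.* n) ζ z * totative-product n (ζ ^ p) z ≈ totative-product n (ζ ^ p) (z ^ p)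
    totatives-∤ pp p∤n z = begin
      totative-product (p ℕ.* n) ζ z * totative-product n (ζ ^ p) z    ≈⟨ *-congˡ (sym multiples) ⟩
      totative-product (p ℕ.* n) ζ z * ∏ multiple (p ℕ.* n)            ≈⟨ sym (∏-* _ multiple (p ℕ.* n)) ⟩
      ∏ (λ l → select (gcd (suc l) (p ℕ.* n) ℕ.≟ 1) (root-factor ζ z (suc l)) * multiple l) (p ℕ.* n)
        ≈⟨ ∏-cong (p ℕ.* n) (λ l _ → divided l) ⟩
      ∏ (λ l → select (gcd (suc l) n ℕ.≟ 1) (root-factor ζ z (suc l))) (p ℕ.* n)
        ≈⟨ all-lifts z ⟩
      totative-product n (ζ ^ p) (z ^ p)                               ∎
      where
      multiple : ℕ → Carrier
      multiple l = select (p ∣? suc l) (select (gcd (suc l) n ℕ.≟ 1) (root-factor ζ z (suc l)))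

      divided : ∀ l → select (gcd (suc l) (p ℕ.* n) ℕ.≟ 1) (root-factor ζ z (suc l)) * multiple l ≈
                      select (gcd (suc l) n ℕ.≟ 1) (root-factor ζ z (suc l))
      divided l with p ∣? suc l
      ... | yes p∣l = trans (*-congʳ (select-cong {Q = ⊥} (gcd (suc l) (p ℕ.* n) ℕ.≟ 1) (no λ ())
              (λ eq → ⊥-elim (gcd-*≢1 pp 1≤n (suc l) p∣l eq)) (λ ()) refl)) (*-identityˡ _)
      ... | no p∤l  = trans (*-identityʳ _) (select-cong (gcd (suc l) (p ℕ.* n) ℕ.≟ 1) (gcd (suc l) n ℕ.≟ 1)
              (gcd-*⇒ pp 1≤n (suc l)) (gcd-*⇐-∤ pp 1≤n (suc l) p∤l) refl)

      multiples : ∏ multiple (p ℕ.* n) ≈ totative-product n (ζ ^ p) z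
      multiples = begin
        ∏ multiple (p ℕ.* n)                                    ≡⟨ ≡.cong (∏ multiple) (ℕ.*-comm p n) ⟩
        ∏ multiple (n ℕ.* p)                                    ≈⟨ ∏-blocks multiple n p ⟩
        ∏ (λ b → ∏ (λ r → multiple (b ℕ.* p ℕ.+ r)) p) n        ≈⟨ ∏-cong n (λ b _ → block b) ⟩
        totative-product n (ζ ^ p) z                            ∎
        where
        -- The index `l` stands for the exponent `l + 1`; the multiple of `p` in a block therefore
        -- sits at its last place `r = p − 1`.
        last : ∀ {p} b (f : ℕ → Carrier) → 1 ℕ.≤ p → (∀ r → r ℕ.< p ℕ.∸ 1 → f (b ℕ.* p ℕ.+ r) ≈ 1#) →
               ∏ (λ r → f (b ℕ.* p ℕ.+ r)) p ≈ f (b ℕ.* p ℕ.+ (p ℕ.∸ 1))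
        last {suc p} b f _ trivial = trans (∏-suc (λ r → f (b ℕ.* suc p ℕ.+ r)) p)
          (trans (*-congʳ (trans (∏-cong p trivial) (∏-1 p))) (*-identityˡ _))

        block : ∀ b → ∏ (λ r → multiple (b ℕ.* p ℕ.+ r)) p ≈ select (gcd (suc b) n ℕ.≟ 1) (root-factor (ζ ^ p) z (suc b))
        block b = trans (last b multiple 1≤p nondivisible) (trans (reflexive (≡.cong multiple′ position)) (select-cong (p ∣? (p ℕ.* suc b)) (yes pp)
            (λ _ → pp) (λ _ → m∣m*n (suc b)) (select-cong (gcd (p ℕ.* suc b) n ℕ.≟ 1) (gcd (suc b) n ℕ.≟ 1)
              (gcd-p*⇒ pp 1≤n (suc b)) (gcd-p*⇐ pp 1≤n p∤n (suc b)) (+-congˡ {z} (-‿cong (sym (^-assocʳ ζ p (suc b))))))))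
          where
          multiple′ : ℕ → Carrier
          multiple′ l = select (p ∣? l) (select (gcd l n ℕ.≟ 1) (root-factor ζ z l))

          position : suc (b ℕ.* p ℕ.+ (p ℕ.∸ 1)) ≡ p ℕ.* suc b
          position = ≡.trans (≡.sym (ℕ.+-suc (b ℕ.* p) (p ℕ.∸ 1))) (≡.trans (≡.cong (b ℕ.* p ℕ.+_) (ℕ.m+[n∸m]≡n 1≤p))
            (≡.trans (ℕ.+-comm (b ℕ.* p) p) (ℕ.*-comm (suc b) p)))

          nondivisible : ∀ r → r ℕ.< p ℕ.∸ 1 → multiple (b ℕ.* p ℕ.+ r) ≈ 1#
          nondivisible r r<p-1 = select-cong {Q = ⊥} (p ∣? suc (b ℕ.* p ℕ.+ r)) (no λ ())
            (λ p∣ → ⊥-elim (>⇒∤ r+1<p (∣m+n∣m⇒∣n (≡.subst (p ∣_) (≡.sym (ℕ.+-suc (b ℕ.* p) r)) p∣) (n∣m*n b)))) (λ ()) refl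
            where
            r+1<p : suc r ℕ.< p
            r+1<p = ≡.subst (suc (suc r) ℕ.≤_) (ℕ.m+[n∸m]≡n 1≤p) (ℕ.s≤s r<p-1)

  -- Cyclotomic values as quotients

  UV-^ : ∀ ps a p z → ⟦ U ps a ⟧ (z ^ p) ≈ ⟦ U ps (p ℕ.* a) ⟧ z × ⟦ V ps a ⟧ (z ^ p) ≈ ⟦ V ps (p ℕ.* a) ⟧ z
  UV-^ []       a p z = +-congˡ (-‿cong (^-assocʳ z p a)) , refl
  UV-^ (r ∷ ps) a p z with UV-^ ps a p z | UV-^ ps (r ℕ.* a) p z
  ... | u , v | u′ , v′ rewrite ≡.sym (*-swap p r a) = *-cong v u′ , *-cong u v′

  W-^ : ∀ ps a p z → ⟦ W ps a ⟧ (z ^ p) ≈ ⟦ W ps (p ℕ.* a) ⟧ z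
  W-^ []       a p z = +-congʳ (^-assocʳ z p a)
  W-^ (r ∷ ps) a p z = proj₁ (UV-^ (r ∷ ps) a p z)

  signum : List ℕ → Carrier
  signum []      = - 1#
  signum (_ ∷ _) = 1#

  signum² : ∀ ps x → signum ps * (signum ps * x) ≈ x
  signum² []      x = trans (-1*x≈-x _) (trans (-‿cong (-1*x≈-x x)) (-‿involutive x))
  signum² (_ ∷ _) x = trans (*-identityˡ _) (*-identityˡ x)

  W≈ : ∀ ps a z → ⟦ W ps a ⟧ z ≈ signum ps * ⟦ U ps a ⟧ z
  W≈ []       a z = sym (trans (-1*x≈-x _) (trans (sym (-‿+-comm _ _)) (trans (+-congˡ (-‿involutive _)) (+-comm _ _))))
  W≈ (_ ∷ ps) a z = sym (*-identityˡ _)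

  -- For a new prime the denominator contains the factor `U ps a`, which by induction is `Φ_n` times
  -- `V ps a` up to sign. So `Φ_(pn) Φ_n` appears, and `totatives-∤` applies without a division by
  -- `Φ_n`, which may vanish at `z`.
  totatives-U/V : ∀ {n a ps} → Built n a ps → ∀ {ζ} → IsPrimitive n ζ → ∀ z →
                  totative-product n ζ z * ⟦ V ps a ⟧ z ≈ ⟦ W ps a ⟧ z
  totatives-U/V one (ζ≈1 , _) z = trans (*-identityʳ _) (trans (*-identityʳ _) (+-cong (sym (*-identityʳ z)) (-‿cong ζ≈1)))
  totatives-U/V (old {p} {n} {a} {ps} pp p∣n b) {ζ} prim z = begin
    totative-product (p ℕ.* n) ζ z * ⟦ V ps (p ℕ.* a) ⟧ z
      ≈⟨ *-cong (totatives-∣ 1≤p 1≤n prim pp p∣n z) (sym (proj₂ (UV-^ ps a p z))) ⟩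
    totative-product n (ζ ^ p) (z ^ p) * ⟦ V ps a ⟧ (z ^ p)
      ≈⟨ totatives-U/V b (primitive-^ 1≤p prim) (z ^ p) ⟩
    ⟦ W ps a ⟧ (z ^ p)        ≈⟨ W-^ ps a p z ⟩
    ⟦ W ps (p ℕ.* a) ⟧ z      ∎
    where
    1≤p = ℕ.<⇒≤ (1<prime pp)
    1≤n = built-1≤ b
  totatives-U/V (new {p} {n} {a} {ps} pp p∤n _ b) {ζ} prim z = begin
    -- The sign is inserted twice: the induction hypothesis speaks of `W ps a`, the denominator
    -- contains `U ps a`, and they differ when `ps` is empty.
    Φpn * (u * v′)                       ≈⟨ sym (signum² ps _) ⟩
    s * (s * (Φpn * (u * v′)))           ≈⟨ *-congˡ (solve 4 (λ s Φ u v′ → s :* (Φ :* (u :* v′)) := Φ :* (s :* u) :* v′) refl s Φpn u v′) ⟩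
    s * (Φpn * (s * u) * v′)             ≈⟨ *-congˡ (*-congʳ (*-congˡ (trans (sym (W≈ ps a z)) (sym (totatives-U/V b prim′ z))))) ⟩
    s * (Φpn * (Φn * v) * v′)            ≈⟨ *-congˡ (solve 4 (λ Φ Φ′ v v′ → Φ :* (Φ′ :* v) :* v′ := (Φ :* Φ′) :* v′ :* v) refl Φpn Φn v v′) ⟩
    s * ((Φpn * Φn) * v′ * v)
      ≈⟨ *-congˡ (*-congʳ (*-cong (totatives-∤ 1≤p 1≤n prim pp p∤n z) (sym (proj₂ (UV-^ ps a p z))))) ⟩
    s * (totative-product n (ζ ^ p) (z ^ p) * ⟦ V ps a ⟧ (z ^ p) * v)
      ≈⟨ *-congˡ (*-congʳ (trans (totatives-U/V b prim′ (z ^ p)) (trans (W-^ ps a p z) (W≈ ps (p ℕ.* a) z)))) ⟩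
    s * (s * u′ * v)                     ≈⟨ *-congˡ (*-assoc s u′ v) ⟩
    s * (s * (u′ * v))                   ≈⟨ signum² ps _ ⟩
    u′ * v                               ≈⟨ *-comm u′ v ⟩
    v * u′                               ∎
    where
    1≤p = ℕ.<⇒≤ (1<prime pp)
    1≤n = built-1≤ b
    prim′ = primitive-^ 1≤p prim
    s = signum ps
    Φpn = totative-product (p ℕ.* n) ζ z
    Φn = totative-product n (ζ ^ p) z
    u = ⟦ U ps a ⟧ z
    v = ⟦ V ps a ⟧ z
    u′ = ⟦ U ps (p ℕ.* a) ⟧ z
    v′ = ⟦ V ps (p ℕ.* a) ⟧ z

  cyclotomic-U/V : ∀ {n a ps} → Built n a ps → ∀ {ζ} → IsPrimitive n ζ → ∀ z →
                   cyclotomic n ζ z * ⟦ V ps a ⟧ z ≈ ⟦ W ps a ⟧ z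
  cyclotomic-U/V {n} b {ζ} prim z = trans (*-congʳ (cyclotomic≈ n ζ z)) (totatives-U/V b prim z)

  coincidence⇒T≈0 : ∀ {m n a b ps qs} → Built m a ps → Built n b qs → ∀ {ζ ξ} → IsPrimitive m ζ → IsPrimitive n ξ →
                    ∀ z → cyclotomic m ζ z ≈ cyclotomic n ξ z → ⟦ T a ps b qs ⟧ z ≈ 0#
  coincidence⇒T≈0 {m} {n} {a} {b} {ps} {qs} bm bn {ζ} {ξ} ζ-prim ξ-prim z Φm≈Φn = trans (+-congʳ (begin
    ⟦ W ps a ⟧ z * ⟦ V qs b ⟧ z                         ≈⟨ *-congʳ (sym (cyclotomic-U/V bm ζ-prim z)) ⟩
    cyclotomic m ζ z * ⟦ V ps a ⟧ z * ⟦ V qs b ⟧ z      ≈⟨ *-congʳ (*-congʳ Φm≈Φn) ⟩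
    cyclotomic n ξ z * ⟦ V ps a ⟧ z * ⟦ V qs b ⟧ z
      ≈⟨ solve 3 (λ Φ v v′ → Φ :* v :* v′ := Φ :* v′ :* v) refl (cyclotomic n ξ z) (⟦ V ps a ⟧ z) (⟦ V qs b ⟧ z) ⟩
    cyclotomic n ξ z * ⟦ V qs b ⟧ z * ⟦ V ps a ⟧ z      ≈⟨ *-congʳ (cyclotomic-U/V bn ξ-prim z) ⟩
    ⟦ W qs b ⟧ z * ⟦ V ps a ⟧ z                         ∎)) (-‿inverseʳ _)

-- Products over divisors at rational arguments

import Algebra.Properties.Semiring.Exp as Exp
open import Data.List.Properties using (++-assoc; ++-identityʳ)
open import Data.Rational.Base hiding (NonZero)
open import Data.Rational.Properties
open import Data.Rational.Solver using (module +-*-Solver)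
open import Relation.Binary.PropositionalEquality using (refl; sym; trans; cong; cong₂; subst; subst₂; module ≡-Reasoning)
open +-*-Solver using (solve; _:=_; _:+_; _:*_; _:-_; :-_; con)
open Eval +-*-rawRing
open RawSemiringDefinitions (RawRing.rawSemiring +-*-rawRing) using (_^_)
private module E = Exp (CommutativeRing.semiring +-*-commutativeRing)

≤-by : ∀ {p q} d → 0ℚ ≤ d → q ≡ p + d → p ≤ q
≤-by {p} d 0≤d refl = subst (_≤ p + d) (+-identityʳ p) (+-monoʳ-≤ p 0≤d)

0≤q-p : ∀ {p q} → p ≤ q → 0ℚ ≤ q - p
0≤q-p {p} {q} p≤q = subst (_≤ q - p) (+-inverseʳ p) (+-monoˡ-≤ (- p) p≤q)

0≤+ : ∀ {p q} → 0ℚ ≤ p → 0ℚ ≤ q → 0ℚ ≤ p + q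
0≤+ 0≤p 0≤q = +-mono-≤ 0≤p 0≤q

0≤* : ∀ {p q} → 0ℚ ≤ p → 0ℚ ≤ q → 0ℚ ≤ p * q
0≤* {p} {q} 0≤p 0≤q = subst (_≤ p * q) (*-zeroˡ q)
  (*-monoʳ-≤-nonNeg q {{nonNegative 0≤q}} 0≤p)

0<* : ∀ {p q} → 0ℚ < p → 0ℚ < q → 0ℚ < p * q
0<* {p} {q} 0<p 0<q = subst (_< p * q) (*-zeroˡ q)
  (*-monoˡ-<-pos q {{positive 0<q}} 0<p)

*-mono-≤ : ∀ {p q r s} → 0ℚ ≤ p → 0ℚ ≤ r → p ≤ q → r ≤ s → p * r ≤ q * s
*-mono-≤ {p} {q} {r} {s} 0≤p 0≤r p≤q r≤s =
  ≤-trans (*-monoʳ-≤-nonNeg r {{nonNegative 0≤r}} p≤q)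
          (*-monoˡ-≤-nonNeg q {{nonNegative (≤-trans 0≤p p≤q)}} r≤s)

*-monoˡ : ∀ {q r} p → 0ℚ ≤ p → q ≤ r → p * q ≤ p * r
*-monoˡ p 0≤p = *-monoˡ-≤-nonNeg p {{nonNegative 0≤p}}

cancel-≤ : ∀ {q r} p → 0ℚ < p → p * q ≤ p * r → q ≤ r
cancel-≤ p 0<p = *-cancelˡ-≤-pos p {{positive 0<p}}

0≤1 : 0ℚ ≤ 1ℚ
0≤1 = nonNegative⁻¹ 1ℚ

0≤½ : 0ℚ ≤ ½
0≤½ = nonNegative⁻¹ ½

module _ {q : ℚ} (0<q : 0ℚ < q) where

  0<^ : ∀ n → 0ℚ < q ^ n
  0<^ zero    = positive⁻¹ 1ℚ
  0<^ (suc n) = 0<* 0<q (0<^ n)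

  0≤^ : ∀ n → 0ℚ ≤ q ^ n
  0≤^ n = <⇒≤ (0<^ n)

^-* : ∀ q m n → (q ^ m) ^ n ≡ q ^ (m ℕ.* n)
^-* = E.^-assocʳ

^-+ : ∀ q m n → q ^ (m ℕ.+ n) ≡ q ^ m * q ^ n
^-+ = E.^-homo-*

^-≤1 : ∀ {q} → 0ℚ ≤ q → q ≤ 1ℚ → ∀ n → 0ℚ ≤ q ^ n × q ^ n ≤ 1ℚ
^-≤1 0≤q q≤1 zero    = 0≤1 , ≤-refl
^-≤1 0≤q q≤1 (suc n) with ^-≤1 0≤q q≤1 n
... | 0≤ , ≤1 = 0≤* 0≤q 0≤ , *-mono-≤ 0≤q 0≤ q≤1 ≤1

record Small (q : ℚ) : Set where
  constructor small
  field
    0<q : 0ℚ < q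
    q≤½ : q ≤ ½

  0≤q : 0ℚ ≤ q
  0≤q = <⇒≤ 0<q

  q≤1 : q ≤ 1ℚ
  q≤1 = ≤-trans q≤½ (≤ᵇ⇒≤ _)

  2q≤1 : 0ℚ ≤ 1ℚ - (q + q)
  2q≤1 = 0≤q-p (+-mono-≤ q≤½ q≤½)

open Small

^-anti : ∀ {q m n} → Small q → m ℕ.≤ n → q ^ n ≤ q ^ m
^-anti {q} {m} {n} s m≤n = subst₂ _≤_
  (trans (sym (^-+ q m (n ℕ.∸ m))) (cong (q ^_) (ℕ.m+[n∸m]≡n m≤n)))
  (*-identityʳ (q ^ m))
  (*-monoˡ (q ^ m) (0≤^ (0<q s) m) (proj₂ (^-≤1 (0≤q s) (q≤1 s) (n ℕ.∸ m))))

^-double : ∀ {q m n} → Small q → m ℕ.< n → q ^ n + q ^ n ≤ q ^ m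
^-double {q} {m} {n} s m<n = ≤-trans (+-mono-≤ (^-anti s m<n) (^-anti s m<n))
  (≤-by ((1ℚ - (q + q)) * q ^ m) (0≤* (2q≤1 s) (0≤^ (0<q s) m))
    (solve 2 (λ q m → m := q :* m :+ q :* m :+ (con 1ℚ :- (q :+ q)) :* m) refl q (q ^ m)))

small-^ : ∀ {q a} → Small q → 1 ℕ.≤ a → Small (q ^ a)
small-^ {q} {a} s 1≤a = small (0<^ (0<q s) a)
  (≤-trans (^-anti s 1≤a) (subst (_≤ ½) (sym (*-identityʳ q)) (q≤½ s)))

-- A lower bound by a power of q is what survives passage from the rational
-- terms of a Cauchy sequence to its limit.
Pos : (ℚ → ℚ) → Set
Pos f = ∃ λ K → ∀ q → Small q → q ^ K ≤ f q

infix 4 _≺_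
_≺_ : (ℚ → ℚ) → (ℚ → ℚ) → Set
f ≺ g = Pos (λ q → g q - f q)

pos⇒0< : ∀ {f} → Pos f → ∀ q → Small q → 0ℚ < f q
pos⇒0< (K , f≥) q s = <-≤-trans (0<^ (0<q s) K) (f≥ q s)

pos⇒0≤ : ∀ {f} → Pos f → ∀ q → Small q → 0ℚ ≤ f q
pos⇒0≤ pf q s = <⇒≤ (pos⇒0< pf q s)

≺⇒≤ : ∀ f g → f ≺ g → ∀ {q} → Small q → f q ≤ g q
≺⇒≤ f g f≺g {q} s = ≤-by (g q - f q) (pos⇒0≤ f≺g q s)
  (solve 2 (λ f g → g := f :+ (g :- f)) refl (f q) (g q))

pos-≤ : ∀ {f g} → Pos f → (∀ q → Small q → f q ≤ g q) → Pos g
pos-≤ (K , f≥) f≤g = K , λ q s → ≤-trans (f≥ q s) (f≤g q s)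

pos-* : ∀ {f g} → Pos f → Pos g → Pos (λ q → f q * g q)
pos-* (K , f≥) (L , g≥) = K ℕ.+ L , λ q s → subst (_≤ _) (sym (^-+ q K L))
  (*-mono-≤ (0≤^ (0<q s) K) (0≤^ (0<q s) L) (f≥ q s) (g≥ q s))

pos-∘^ : ∀ {f a} → 1 ℕ.≤ a → Pos f → Pos (λ q → f (q ^ a))
pos-∘^ {f} {a} 1≤a (K , f≥) = a ℕ.* K , λ q s →
  subst (_≤ _) (^-* q a K) (f≥ (q ^ a) (small-^ s 1≤a))

pos-^ : ∀ n → Pos (_^ n)
pos-^ n = n , λ _ _ → ≤-refl

pos-1 : Pos (λ _ → 1ℚ)
pos-1 = pos-^ 0

q≤1-q^a : ∀ {q a} → Small q → 1 ℕ.≤ a → q ≤ 1ℚ - q ^ a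
q≤1-q^a {q} {a} s 1≤a = ≤-by ((½ - q) + (½ - q ^ a))
  (0≤+ (0≤q-p (q≤½ s)) (0≤q-p (q≤½ (small-^ s 1≤a))))
  (solve 2 (λ q y → con 1ℚ :- y := q :+ ((con ½ :- q) :+ (con ½ :- y))) refl q (q ^ a))

pos-q≤ : ∀ {f} → (∀ q → Small q → q ≤ f q) → Pos f
pos-q≤ {f} q≤f = 1 , λ q s → subst (_≤ f q) (sym (*-identityʳ q)) (q≤f q s)

pos-1-^ : ∀ {a} → 1 ℕ.≤ a → Pos (λ q → 1ℚ - q ^ a)
pos-1-^ 1≤a = pos-q≤ λ q s → q≤1-q^a s 1≤a

1-^≤1 : ∀ {q} → Small q → ∀ a → 1ℚ - q ^ a ≤ 1ℚ
1-^≤1 {q} s a = ≤-by (q ^ a) (0≤^ (0<q s) a)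
  (solve 1 (λ y → con 1ℚ := con 1ℚ :- y :+ y) refl (q ^ a))

0≤1-^ : ∀ {q} → Small q → ∀ a → 0ℚ ≤ 1ℚ - q ^ a
0≤1-^ s a = 0≤q-p (proj₂ (^-≤1 (0≤q s) (q≤1 s) a))

∏1- : List ℕ → ℚ → ℚ
∏1- []       q = 1ℚ
∏1- (k ∷ ks) q = (1ℚ - q ^ k) * ∏1- ks q

∏1-∈[0,1] : ∀ ks {q} → Small q → 0ℚ ≤ ∏1- ks q × ∏1- ks q ≤ 1ℚ
∏1-∈[0,1] []       s = 0≤1 , ≤-refl
∏1-∈[0,1] (k ∷ ks) s with ∏1-∈[0,1] ks s
... | 0≤ , ≤1 = 0≤* (0≤1-^ s k) 0≤ , *-mono-≤ (0≤1-^ s k) 0≤ (1-^≤1 s k) ≤1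

-- At q ≤ ½ the term q^d outweighs all later powers together.
∏1-≻ : ∀ d ks → Linked ℕ._<_ (d ∷ ks) → (λ q → 1ℚ - q ^ d) ≺ ∏1- ks
∏1-≻ d []       _             = pos-≤ (pos-^ d) λ q _ → ≤-reflexive
  (solve 1 (λ y → y := con 1ℚ :- (con 1ℚ :- y)) refl (q ^ d))
∏1-≻ d (k ∷ ks) (d<k ∷ k<ks) with ∏1-≻ k ks k<ks
... | K , f≥ = suc K , λ q s →
  let y = q ^ k
      1≤k = ℕ.≤-trans (s≤s z≤n) d<k
  in ≤-by ((1ℚ - y) * (∏1- ks q - (1ℚ - y) - q ^ K) + (q ^ d - (y + y)) + y * y
             + q ^ K * ((1ℚ - y) - q))
       (0≤+ (0≤+ (0≤+ (0≤* (0≤1-^ s k) (0≤q-p (f≥ q s)))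
                      (0≤q-p (^-double s d<k)))
                 (0≤* (0≤^ (0<q s) k) (0≤^ (0<q s) k)))
            (0≤* (0≤^ (0<q s) K) (0≤q-p (q≤1-q^a s 1≤k))))
       (solve 5 (λ q y w d K →
          (con 1ℚ :- y) :* w :- (con 1ℚ :- d) :=
          q :* K :+ ((con 1ℚ :- y) :* (w :- (con 1ℚ :- y) :- K) :+ (d :- (y :+ y)) :+ y :* y
             :+ K :* ((con 1ℚ :- y) :- q))) refl q y (∏1- ks q) (q ^ d) (q ^ K))

-- With exponents at least 2 apart, the sum of the `q^k` is at most `q^(2+d) / (1 − q²)`. The factor
-- `1 − q²` clears this denominator and is at the same time the factor of the prime 2.
∏1-gap : ∀ d ks → Linked (λ j k → 2 ℕ.+ j ℕ.≤ k) (d ∷ ks) →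
         (λ q → 1ℚ - q ^ 2 - q ^ (2 ℕ.+ d)) ≺ (λ q → (1ℚ - q ^ 2) * ∏1- ks q)
∏1-gap d []       _             = pos-≤ (pos-^ (2 ℕ.+ d)) λ q _ → ≤-reflexive
  (solve 2 (λ x y → y := (con 1ℚ :- x) :* con 1ℚ :- (con 1ℚ :- x :- y)) refl (q ^ 2) (q ^ (2 ℕ.+ d)))
∏1-gap d (k ∷ ks) (d+2≤k ∷ gaps) with ∏1-gap k ks gaps
... | K , f≥ = suc K , λ q s →
  let y = q ^ k
      1≤k = ℕ.≤-trans (s≤s z≤n) d+2≤k
      w = ∏1- ks q
  in ≤-by ((1ℚ - y) * ((1ℚ - q ^ 2) * w - (1ℚ - q ^ 2 - q ^ (2 ℕ.+ k)) - q ^ K)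
             + (q ^ (2 ℕ.+ d) - y) + q ^ (2 ℕ.+ k) * y + q ^ K * ((1ℚ - y) - q))
       (0≤+ (0≤+ (0≤+ (0≤* (0≤1-^ s k) (0≤q-p (f≥ q s)))
                      (0≤q-p (^-anti s d+2≤k)))
                 (0≤* (0≤^ (0<q s) (2 ℕ.+ k)) (0≤^ (0<q s) k)))
            (0≤* (0≤^ (0<q s) K) (0≤q-p (q≤1-q^a s 1≤k))))
       (solve 5 (λ q y w d K →
          let x = q :* (q :* con 1ℚ) ; z = q :* (q :* y) in
          (con 1ℚ :- x) :* ((con 1ℚ :- y) :* w) :- (con 1ℚ :- x :- d) :=
          q :* K :+ ((con 1ℚ :- y) :* ((con 1ℚ :- x) :* w :- (con 1ℚ :- x :- z) :- K) :+ (d :- y)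
             :+ z :* y :+ K :* ((con 1ℚ :- y) :- q))) refl q y w (q ^ (2 ℕ.+ d)) (q ^ K))

head-1≤ : ∀ {p ps} → Ascending (p ∷ ps) → 1 ℕ.≤ p
head-1≤ (1<p ∷ _) = ℕ.<⇒≤ 1<p

prefix : ∀ {d} xs {ys} → Linked ℕ._<_ (d ∷ xs ++ ys) → Linked ℕ._<_ (d ∷ xs)
prefix []       _            = [-]
prefix (x ∷ xs) (d<x ∷ rest) = d<x ∷ prefix xs rest

1≤* : ∀ {p a} → 1 ℕ.≤ p → 1 ℕ.≤ a → 1 ℕ.≤ p ℕ.* a
1≤* = ℕ.*-mono-≤

-- From `0 ≤ g ≤ w f` follows `0 ≤ f`, and then `w ≤ 1` gives `w f ≤ f`. So a common denominator can
-- be cleared and dropped again without losing the gap.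
pos-÷ : ∀ {f g} (w : ℚ → ℚ) → (∀ q → Small q → 0ℚ < w q × w q ≤ 1ℚ) → Pos g →
        (∀ q → Small q → g q ≤ w q * f q) → Pos f
pos-÷ {f} {g} w w-bd pos-g g≤wf = pos-≤ pos-g λ q s →
  let 0<w , w≤1 = w-bd q s
      0≤f = cancel-≤ (w q) 0<w (subst (_≤ w q * f q) (sym (*-zeroʳ (w q)))
              (≤-trans (pos⇒0≤ pos-g q s) (g≤wf q s)))
  in ≤-trans (g≤wf q s) (subst (w q * f q ≤_) (*-identityˡ (f q))
       (*-monoʳ-≤-nonNeg (f q) {{nonNegative 0≤f}} w≤1))

pos-N×M : ∀ ps → Ascending ps → ∀ {a} → 1 ℕ.≤ a → Pos ⟦ N ps a ⟧ × Pos ⟦ M ps a ⟧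
pos-N×M []       _   1≤a = pos-1-^ 1≤a , pos-1
pos-N×M (p ∷ ps) asc {a} 1≤a =
  let n , m   = pos-N×M ps (tail-asc asc) 1≤a
      n′ , m′ = pos-N×M ps (tail-asc asc) (1≤* (head-1≤ asc) 1≤a)
  in pos-* n m′ , pos-* m n′

module _ {ps} (asc : Ascending ps) {a} (1≤a : 1 ℕ.≤ a) where
  pos-N : Pos ⟦ N ps a ⟧
  pos-N = proj₁ (pos-N×M ps asc 1≤a)

  pos-M : Pos ⟦ M ps a ⟧
  pos-M = proj₂ (pos-N×M ps asc 1≤a)

  0<N : ∀ {q} → Small q → 0ℚ < ⟦ N ps a ⟧ q
  0<N {q} = pos⇒0< pos-N q

  0<M : ∀ {q} → Small q → 0ℚ < ⟦ M ps a ⟧ q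
  0<M {q} = pos⇒0< pos-M q

  0≤N : ∀ {q} → Small q → 0ℚ ≤ ⟦ N ps a ⟧ q
  0≤N s = <⇒≤ (0<N s)

  0≤M : ∀ {q} → Small q → 0ℚ ≤ ⟦ M ps a ⟧ q
  0≤M s = <⇒≤ (0<M s)

-- The bounds depend on each other because adding `p` divides by `B(y^p)`. That this is at most 1
-- preserves the lower bound; that it is at least `1 − y^p` costs the upper bound just this factor.
-- Strictness below 1 then comes from `∏ (1 − y^p) > 1 − y`.
N-lower : ∀ ps → Ascending ps → ∀ {a} → 1 ℕ.≤ a → ∀ {q} → Small q →
          (1ℚ - q ^ a) * ⟦ M ps a ⟧ q ≤ ⟦ N ps a ⟧ q
N-upper : ∀ ps → Ascending ps → ∀ {a} → 1 ℕ.≤ a → ∀ {q} → Small q →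
          ⟦ N ps a ⟧ q * ∏1- ps (q ^ a) ≤ (1ℚ - q ^ a) * ⟦ M ps a ⟧ q
N≺M : ∀ ps → Ascending ps → ∀ {a} → 1 ℕ.≤ a → ⟦ N ps a ⟧ ≺ ⟦ M ps a ⟧

N≤M : ∀ ps → Ascending ps → ∀ {a} → 1 ℕ.≤ a → ∀ {q} → Small q → ⟦ N ps a ⟧ q ≤ ⟦ M ps a ⟧ q
N≤M ps asc {a} 1≤a = ≺⇒≤ ⟦ N ps a ⟧ ⟦ M ps a ⟧ (N≺M ps asc 1≤a)

N-lower []       _   {a} _   {q} _ = ≤-reflexive (*-identityʳ (1ℚ - q ^ a))
N-lower (p ∷ ps) asc {a} 1≤a {q} s = subst (_≤ ⟦ N (p ∷ ps) a ⟧ q)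
  (*-assoc (1ℚ - q ^ a) (⟦ M ps a ⟧ q) (⟦ N ps (p ℕ.* a) ⟧ q))
  (*-mono-≤ (0≤* (0≤1-^ s a) (0≤M (tail-asc asc) 1≤a s)) (0≤N (tail-asc asc) 1≤pa s)
     (N-lower ps (tail-asc asc) 1≤a s) (N≤M ps (tail-asc asc) 1≤pa s))
  where 1≤pa = 1≤* (head-1≤ asc) 1≤a

N-upper []       _   _   _ = ≤-refl
N-upper (p ∷ ps) asc {a} 1≤a {q} s = begin
  n * m′ * ((1ℚ - (q ^ a) ^ p) * Π)  ≡⟨ cong (λ z → n * m′ * ((1ℚ - z) * Π)) eq ⟩
  n * m′ * ((1ℚ - q ^ (p ℕ.* a)) * Π)
    ≡⟨ solve 4 (λ n m z Π → n :* m :* (z :* Π) := n :* Π :* (z :* m)) refl n m′ (1ℚ - q ^ (p ℕ.* a)) Π ⟩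
  n * Π * ((1ℚ - q ^ (p ℕ.* a)) * m′)
    ≤⟨ *-mono-≤ (0≤* (0≤N (tail-asc asc) 1≤a s) (proj₁ (∏1-∈[0,1] ps (small-^ s 1≤a))))
         (0≤* (0≤1-^ s (p ℕ.* a)) (0≤M (tail-asc asc) 1≤pa s))
         (N-upper ps (tail-asc asc) 1≤a s) (N-lower ps (tail-asc asc) 1≤pa s) ⟩
  (1ℚ - q ^ a) * m * n′              ≡⟨ *-assoc (1ℚ - q ^ a) m n′ ⟩
  (1ℚ - q ^ a) * (m * n′)            ∎
  where
  open ≤-Reasoning
  1≤pa = 1≤* (head-1≤ asc) 1≤a
  n = ⟦ N ps a ⟧ q
  m = ⟦ M ps a ⟧ q
  n′ = ⟦ N ps (p ℕ.* a) ⟧ q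
  m′ = ⟦ M ps (p ℕ.* a) ⟧ q
  Π = ∏1- ps (q ^ a)
  eq : (q ^ a) ^ p ≡ q ^ (p ℕ.* a)
  eq = trans (^-* q a p) (cong (q ^_) (ℕ.*-comm a p))

N≺M ps asc {a} 1≤a = pos-÷ Π Π-bd (pos-* (pos-M asc 1≤a) Π≻) λ q s →
  ≤-by ((1ℚ - q ^ a) * ⟦ M ps a ⟧ q - ⟦ N ps a ⟧ q * Π q) (0≤q-p (N-upper ps asc 1≤a s))
    (solve 4 (λ n m y Π → Π :* (m :- n) :=
       m :* (Π :- (con 1ℚ :- y :* con 1ℚ)) :+ ((con 1ℚ :- y) :* m :- n :* Π)) refl
       (⟦ N ps a ⟧ q) (⟦ M ps a ⟧ q) (q ^ a) (Π q))
  where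
  Π : ℚ → ℚ
  Π q = ∏1- ps (q ^ a)

  Π≻ : (λ q → 1ℚ - (q ^ a) ^ 1) ≺ Π
  Π≻ = pos-∘^ {λ q → ∏1- ps q - (1ℚ - q ^ 1)} 1≤a (∏1-≻ 1 ps asc)

  Π-bd : ∀ q → Small q → 0ℚ < Π q × Π q ≤ 1ℚ
  Π-bd q s = <-≤-trans (pos⇒0< (pos-∘^ {λ q → 1ℚ - q ^ 1} 1≤a (pos-1-^ ℕ.≤-refl)) q s) (≺⇒≤ _ Π Π≻ s) ,
             proj₂ (∏1-∈[0,1] ps (small-^ s 1≤a))

-- Without primes `B` is `1 − y` itself; the gap is created by the first division by some `B(y^p)`
-- strictly below 1.
N-lower-strict : ∀ p ps → Ascending (p ∷ ps) → ∀ {a} → 1 ℕ.≤ a →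
                 (λ q → (1ℚ - q ^ a) * ⟦ M (p ∷ ps) a ⟧ q) ≺ ⟦ N (p ∷ ps) a ⟧
N-lower-strict p ps asc {a} 1≤a =
  pos-≤ (pos-* (pos-* (pos-1-^ 1≤a) (pos-M (tail-asc asc) 1≤a))
               (N≺M ps (tail-asc asc) (1≤* (head-1≤ asc) 1≤a))) λ q s →
  let n = ⟦ N ps a ⟧ q
      m = ⟦ M ps a ⟧ q
      n′ = ⟦ N ps (p ℕ.* a) ⟧ q
      m′ = ⟦ M ps (p ℕ.* a) ⟧ q
  in ≤-by ((n - (1ℚ - q ^ a) * m) * m′)
       (0≤* (0≤q-p (N-lower ps (tail-asc asc) 1≤a s))
            (0≤M (tail-asc asc) (1≤* (head-1≤ asc) 1≤a) s))
       (solve 5 (λ n m n′ m′ y → n :* m′ :- y :* (m :* n′) :=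
          y :* m :* (m′ :- n′) :+ (n :- y :* m) :* m′) refl n m n′ m′ (1ℚ - q ^ a))

-- The definition recurses at the head, but two sets of primes are compared behind a common prefix,
-- so primes have to be added at the end.
N-∷ʳ : ∀ ps r a q → ⟦ N (ps ++ r ∷ []) a ⟧ q ≡ ⟦ N ps a ⟧ q * ⟦ M ps (r ℕ.* a) ⟧ q
M-∷ʳ : ∀ ps r a q → ⟦ M (ps ++ r ∷ []) a ⟧ q ≡ ⟦ M ps a ⟧ q * ⟦ N ps (r ℕ.* a) ⟧ q

N-∷ʳ []       r a q = refl
N-∷ʳ (p ∷ ps) r a q rewrite N-∷ʳ ps r a q | M-∷ʳ ps r (p ℕ.* a) q | *-swap p r a =
  solve 4 (λ x y z w → (x :* y) :* (z :* w) := (x :* z) :* (y :* w)) refl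
    (⟦ N ps a ⟧ q) (⟦ M ps (r ℕ.* a) ⟧ q) (⟦ M ps (p ℕ.* a) ⟧ q) (⟦ N ps (r ℕ.* (p ℕ.* a)) ⟧ q)
M-∷ʳ []       r a q = refl
M-∷ʳ (p ∷ ps) r a q rewrite M-∷ʳ ps r a q | N-∷ʳ ps r (p ℕ.* a) q | *-swap p r a =
  solve 4 (λ x y z w → (x :* y) :* (z :* w) := (x :* z) :* (y :* w)) refl
    (⟦ M ps a ⟧ q) (⟦ N ps (r ℕ.* a) ⟧ q) (⟦ N ps (p ℕ.* a) ⟧ q) (⟦ M ps (r ℕ.* (p ℕ.* a)) ⟧ q)

-- Appending primes divides B(y) by factors B(y^r) in [1 − y^r , 1).
module _ {a} (1≤a : 1 ℕ.≤ a) {q} (s : Small q) where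

  private
    1≤r : ∀ cs {r qs} → Ascending (cs ++ r ∷ qs) → 1 ℕ.≤ r
    1≤r []       (1<r ∷ _)     = ℕ.<⇒≤ 1<r
    1≤r (c ∷ cs) (1<c ∷ c<rest) = 1≤r cs (lower-head (ℕ.<⇒≤ 1<c) c<rest)

  append-≥ : ∀ cs qs → Ascending (cs ++ qs) →
             ⟦ N cs a ⟧ q * ⟦ M (cs ++ qs) a ⟧ q ≤ ⟦ N (cs ++ qs) a ⟧ q * ⟦ M cs a ⟧ q
  append-≥ cs []       _   rewrite ++-identityʳ cs = ≤-refl
  append-≥ cs (r ∷ qs) asc = cancel-≤ m′ (0<M asc-cs 1≤ra s) (begin
    m′ * (n * x)   ≡⟨ solve 3 (λ m n x → m :* (n :* x) := n :* m :* x) refl m′ n x ⟩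
    n * m′ * x     ≤⟨ ih ⟩
    y * (m * n′)   ≤⟨ *-monoˡ y (0≤N asc 1≤a s) (*-monoˡ m (0≤M asc-cs 1≤a s)
                        (N≤M cs asc-cs 1≤ra s)) ⟩
    y * (m * m′)   ≡⟨ solve 3 (λ y m m′ → y :* (m :* m′) := m′ :* (y :* m)) refl y m m′ ⟩
    m′ * (y * m)   ∎)
    where
    open ≤-Reasoning
    asc-cs = prefix cs asc
    1≤ra = 1≤* (1≤r cs asc) 1≤a
    n = ⟦ N cs a ⟧ q
    m = ⟦ M cs a ⟧ q
    n′ = ⟦ N cs (r ℕ.* a) ⟧ q
    m′ = ⟦ M cs (r ℕ.* a) ⟧ q
    x = ⟦ M (cs ++ r ∷ qs) a ⟧ q
    y = ⟦ N (cs ++ r ∷ qs) a ⟧ q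
    assoc = ++-assoc cs (r ∷ []) qs
    ih : n * m′ * x ≤ y * (m * n′)
    ih = subst₂ _≤_
      (cong₂ _*_ (N-∷ʳ cs r a q) (cong (λ l → ⟦ M l a ⟧ q) assoc))
      (cong₂ _*_ (cong (λ l → ⟦ N l a ⟧ q) assoc) (M-∷ʳ cs r a q))
      (append-≥ (cs ++ r ∷ []) qs (subst Ascending (sym assoc) asc))

  append-≤ : ∀ cs qs → Ascending (cs ++ qs) →
             ⟦ N (cs ++ qs) a ⟧ q * ⟦ M cs a ⟧ q * ∏1- qs (q ^ a) ≤ ⟦ N cs a ⟧ q * ⟦ M (cs ++ qs) a ⟧ q
  append-≤ cs []       _   rewrite ++-identityʳ cs = ≤-reflexive (*-identityʳ _)
  append-≤ cs (r ∷ qs) asc = cancel-≤ m′ (0<M asc-cs 1≤ra s) (begin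
    m′ * (y * m * ((1ℚ - (q ^ a) ^ r) * Π))
      ≡⟨ cong (λ z → m′ * (y * m * ((1ℚ - z) * Π))) (trans (^-* q a r) (cong (q ^_) (ℕ.*-comm a r))) ⟩
    m′ * (y * m * ((1ℚ - q ^ (r ℕ.* a)) * Π))
      ≡⟨ solve 5 (λ y m m′ z Π → m′ :* (y :* m :* (z :* Π)) := y :* m :* Π :* (z :* m′)) refl y m m′ (1ℚ - q ^ (r ℕ.* a)) Π ⟩
    y * m * Π * ((1ℚ - q ^ (r ℕ.* a)) * m′)
      ≤⟨ *-monoˡ (y * m * Π) (0≤* (0≤* (0≤N asc 1≤a s) (0≤M asc-cs 1≤a s))
           (proj₁ (∏1-∈[0,1] qs (small-^ s 1≤a)))) (N-lower cs asc-cs 1≤ra s) ⟩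
    y * m * Π * n′     ≡⟨ solve 4 (λ y m n′ Π → y :* m :* Π :* n′ := y :* (m :* n′) :* Π) refl y m n′ Π ⟩
    y * (m * n′) * Π   ≤⟨ ih ⟩
    n * m′ * x         ≡⟨ solve 3 (λ m n x → n :* m :* x := m :* (n :* x)) refl m′ n x ⟩
    m′ * (n * x)       ∎)
    where
    open ≤-Reasoning
    asc-cs = prefix cs asc
    1≤ra = 1≤* (1≤r cs asc) 1≤a
    n = ⟦ N cs a ⟧ q
    m = ⟦ M cs a ⟧ q
    n′ = ⟦ N cs (r ℕ.* a) ⟧ q
    m′ = ⟦ M cs (r ℕ.* a) ⟧ q
    x = ⟦ M (cs ++ r ∷ qs) a ⟧ q
    y = ⟦ N (cs ++ r ∷ qs) a ⟧ q
    Π = ∏1- qs (q ^ a)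
    assoc = ++-assoc cs (r ∷ []) qs
    ih : y * (m * n′) * Π ≤ n * m′ * x
    ih = subst₂ _≤_
      (cong (_* Π) (cong₂ _*_ (cong (λ l → ⟦ N l a ⟧ q) assoc) (M-∷ʳ cs r a q)))
      (cong₂ _*_ (N-∷ʳ cs r a q) (cong (λ l → ⟦ M l a ⟧ q) assoc))
      (append-≤ (cs ++ r ∷ []) qs (subst Ascending (sym assoc) asc))

-- Comparing the products at 0 < q ≤ ½

-- The margin in `compare-primes`: the primes `qs` raise `B` by at most the factor `1 / ∏1- qs y`,
-- while `p` raises it by at least `∏1- cs (y^p) / (1 − y^p)`. A nonempty prefix weakens the second
-- factor; the gap after `p` makes up for it.
room : ∀ cs p qs → Ascending cs → 1 ℕ.≤ p → Linked ℕ._<_ (p ∷ qs) →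
       cs ≡ [] ⊎ (3 ℕ.≤ p × Linked ℕ._<_ (suc p ∷ qs)) →
       Pos (λ y → ∏1- qs y * ∏1- cs (y ^ p) - (1ℚ - y ^ p))
room cs p qs _ 1≤p p<qs (inj₁ refl) = pos-≤ (∏1-≻ p qs p<qs) λ y _ →
  ≤-reflexive (cong (_- (1ℚ - y ^ p)) (sym (*-identityʳ (∏1- qs y))))
room []       p qs _ 1≤p p<qs (inj₂ _) = pos-≤ (∏1-≻ p qs p<qs) λ y _ →
  ≤-reflexive (cong (_- (1ℚ - y ^ p)) (sym (*-identityʳ (∏1- qs y))))
room (c ∷ cs) p qs (1<c ∷ c<cs) 1≤p _ (inj₂ (3≤p , p+1<qs)) = 2 ℕ.+ p , λ y s →
  let x  = y ^ p
      sx = small-^ s 1≤p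
      w  = ∏1- qs y
      v  = ∏1- (c ∷ cs) x
      w≥ : 1ℚ - y ^ suc p ≤ w
      w≥ = ≺⇒≤ (λ y → 1ℚ - y ^ suc p) (∏1- qs) (∏1-≻ (suc p) qs p+1<qs) s
      u  = x ^ c
      t  = ∏1- cs x
      t≥ : 1ℚ - u ≤ t
      t≥ = ≺⇒≤ (λ y → 1ℚ - y ^ c) (∏1- cs) (∏1-≻ c cs c<cs) sx
      -- `c ≥ 2` and `p ≥ 3` give `y^(p c) ≤ y^(2 p) ≤ y^(p+3)`. The later prefix primes at most
      -- double this, so the whole prefix costs no more than `y^(p+2)`.
      u≤ : u ≤ y ^ (3 ℕ.+ p)
      u≤ = ≤-trans (^-anti sx 1<c) (subst (_≤ y ^ (3 ℕ.+ p)) (sym (^-* y p 2))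
             (^-anti s (subst (3 ℕ.+ p ℕ.≤_) (double p) (ℕ.+-monoˡ-≤ p 3≤p))))
      v≥ : 1ℚ - y ^ (2 ℕ.+ p) ≤ v
      v≥ = ≤-by ((1ℚ - u) * (t - (1ℚ - u)) + u * u + (y ^ (2 ℕ.+ p) - (u + u)))
             (0≤+ (0≤+ (0≤* (0≤1-^ sx c) (0≤q-p t≥)) (0≤* (0≤^ (0<q sx) c) (0≤^ (0<q sx) c)))
                  (0≤q-p (≤-trans (+-mono-≤ u≤ u≤) (^-double s (ℕ.≤-refl {3 ℕ.+ p})))))
             (solve 3 (λ u t r → (con 1ℚ :- u) :* t := con 1ℚ :- r :+
                ((con 1ℚ :- u) :* (t :- (con 1ℚ :- u)) :+ u :* u :+ (r :- (u :+ u)))) refl u t (y ^ (2 ℕ.+ p)))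
  -- The losses `y^(p+1)` and `y^(p+2)` fit below `y^p` because `1 − y − y² = y² + (1 − 2y)(1 + y)`;
  -- the term `y²` is the gap.
  in ≤-by ((w * v - (1ℚ - y ^ suc p) * (1ℚ - y ^ (2 ℕ.+ p)))
             + (x * ((1ℚ - (y + y)) * (1ℚ + y)) + (y * x) * (y * (y * x))))
       (0≤+ (0≤q-p (*-mono-≤ (0≤1-^ s (suc p)) (0≤1-^ s (2 ℕ.+ p)) w≥ v≥))
            (0≤+ (0≤* (0≤^ (0<q s) p) (0≤* (2q≤1 s) (0≤+ 0≤1 (0≤q s))))
                 (0≤* (0≤^ (0<q s) (suc p)) (0≤^ (0<q s) (2 ℕ.+ p)))))
       (solve 4 (λ y x w v → w :* v :- (con 1ℚ :- x) := y :* (y :* x) :+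
          ((w :* v :- (con 1ℚ :- y :* x) :* (con 1ℚ :- y :* (y :* x)))
           :+ (x :* ((con 1ℚ :- (y :+ y)) :* (con 1ℚ :+ y)) :+ (y :* x) :* (y :* (y :* x))))) refl y x w v)
  where
  double : ∀ p → p ℕ.+ p ≡ p ℕ.* 2
  double p = trans (cong (p ℕ.+_) (sym (ℕ.+-identityʳ p))) (ℕ.*-comm 2 p)

compare-primes : ∀ cs p ps qs → Ascending (cs ++ p ∷ ps) → Ascending (cs ++ qs) → 1 ℕ.≤ p →
  Linked ℕ._<_ (p ∷ qs) → cs ≡ [] ⊎ (3 ℕ.≤ p × Linked ℕ._<_ (suc p ∷ qs)) → ∀ {a} → 1 ℕ.≤ a →
  (λ q → ⟦ M (cs ++ p ∷ ps) a ⟧ q * ⟦ N (cs ++ qs) a ⟧ q) ≺ (λ q → ⟦ N (cs ++ p ∷ ps) a ⟧ q * ⟦ M (cs ++ qs) a ⟧ q)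
compare-primes cs p ps qs ascP ascQ 1≤p p<qs gap {a} 1≤a =
  pos-÷ (λ q → 1ℚ - q ^ (p ℕ.* a)) (λ q s → pos⇒0< (pos-1-^ 1≤pa) q s , 1-^≤1 s (p ℕ.* a))
    (pos-* (pos-∘^ {λ y → ∏1- qs y * ∏1- cs (y ^ p) - (1ℚ - y ^ p)} 1≤a
             (room cs p qs asc-cs 1≤p p<qs gap))
           (pos-* (pos-M ascP 1≤a) (pos-N ascQ 1≤a)))
    (λ q s → bound s)
  where
  asc-cs = prefix cs ascQ
  1≤pa = 1≤* 1≤p 1≤a

  module _ {q} (s : Small q) where
    open ≤-Reasoning
    nP = ⟦ N (cs ++ p ∷ ps) a ⟧ q
    mP = ⟦ M (cs ++ p ∷ ps) a ⟧ q
    nQ = ⟦ N (cs ++ qs) a ⟧ q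
    mQ = ⟦ M (cs ++ qs) a ⟧ q
    n = ⟦ N cs a ⟧ q
    m = ⟦ M cs a ⟧ q
    n′ = ⟦ N cs (p ℕ.* a) ⟧ q
    m′ = ⟦ M cs (p ℕ.* a) ⟧ q
    z = q ^ (p ℕ.* a)
    Πq = ∏1- qs (q ^ a)
    Πc = ∏1- cs z
    assoc = ++-assoc cs (p ∷ []) ps

    0≤Πc : 0ℚ ≤ Πc
    0≤Πc = proj₁ (∏1-∈[0,1] cs (small-^ s 1≤pa))

    adding-p : n * m′ * mP ≤ nP * (m * n′)
    adding-p = subst₂ _≤_
      (cong₂ _*_ (N-∷ʳ cs p a q) (cong (λ l → ⟦ M l a ⟧ q) assoc))
      (cong₂ _*_ (cong (λ l → ⟦ N l a ⟧ q) assoc) (M-∷ʳ cs p a q))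
      (append-≥ 1≤a s (cs ++ p ∷ []) ps (subst Ascending (sym assoc) ascP))

    -- In terms of quotients, `B_Q ∏1- qs ≤ B_cs ≤ B_P B_cs(z)` with `z = y^p`, where `B_P` and
    -- `B_Q` belong to the two lists; the upper bound on `B_cs(z)` finishes.
    cross : Πq * Πc * (mP * nQ) ≤ (1ℚ - z) * (nP * mQ)
    cross = cancel-≤ (m * m′) (0<* (0<M asc-cs 1≤a s) (0<M asc-cs 1≤pa s)) (begin
      m * m′ * (Πq * Πc * (mP * nQ))
        ≡⟨ solve 6 (λ m m′ Πq Πc mP nQ → m :* m′ :* (Πq :* Πc :* (mP :* nQ)) :=
             m′ :* mP :* Πc :* (nQ :* m :* Πq)) refl m m′ Πq Πc mP nQ ⟩
      m′ * mP * Πc * (nQ * m * Πq)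
        ≤⟨ *-monoˡ (m′ * mP * Πc) (0≤* (0≤* (0≤M asc-cs 1≤pa s) (0≤M ascP 1≤a s)) 0≤Πc)
             (append-≤ 1≤a s cs qs ascQ) ⟩
      m′ * mP * Πc * (n * mQ)
        ≡⟨ solve 5 (λ n m′ Πc mP mQ → m′ :* mP :* Πc :* (n :* mQ) :=
             mQ :* Πc :* (n :* m′ :* mP)) refl n m′ Πc mP mQ ⟩
      mQ * Πc * (n * m′ * mP)
        ≤⟨ *-monoˡ (mQ * Πc) (0≤* (0≤M ascQ 1≤a s) 0≤Πc) adding-p ⟩
      mQ * Πc * (nP * (m * n′))
        ≡⟨ solve 5 (λ m n′ Πc nP mQ → mQ :* Πc :* (nP :* (m :* n′)) :=
             nP :* m :* mQ :* (n′ :* Πc)) refl m n′ Πc nP mQ ⟩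
      nP * m * mQ * (n′ * Πc)
        ≤⟨ *-monoˡ (nP * m * mQ) (0≤* (0≤* (0≤N ascP 1≤a s) (0≤M asc-cs 1≤a s)) (0≤M ascQ 1≤a s))
             (N-upper cs asc-cs 1≤pa s) ⟩
      nP * m * mQ * ((1ℚ - z) * m′)
        ≡⟨ solve 5 (λ m m′ z nP mQ → nP :* m :* mQ :* ((con 1ℚ :- z) :* m′) :=
             m :* m′ :* ((con 1ℚ :- z) :* (nP :* mQ))) refl m m′ z nP mQ ⟩
      m * m′ * ((1ℚ - z) * (nP * mQ))  ∎)

    bound : (Πq * ∏1- cs ((q ^ a) ^ p) - (1ℚ - (q ^ a) ^ p)) * (mP * nQ) ≤
            (1ℚ - z) * (nP * mQ - mP * nQ)
    bound rewrite trans (^-* q a p) (cong (q ^_) (ℕ.*-comm a p)) =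
      ≤-by ((1ℚ - z) * (nP * mQ) - Πq * Πc * (mP * nQ)) (0≤q-p cross)
        (solve 4 (λ z Π x y → z :* (x :- y) := (Π :- z) :* y :+ (z :* x :- Π :* y)) refl
          (1ℚ - z) (Πq * Πc) (nP * mQ) (mP * nQ))

-- w(y) = 1 − y² − y³ is what is left of ∏ (1 − y^p) over 2 and the odd p ≥ 3.
w : ℚ → ℚ
w y = 1ℚ - y ^ 2 - y ^ 3

w-bd : ∀ y → Small y → 0ℚ < w y × w y ≤ 1ℚ
w-bd y s = <-≤-trans (0<q s)
    (≤-by ((1ℚ - (y + y)) * (1ℚ + y * ½) + y * (½ - y * y))
      (0≤+ (0≤* (2q≤1 s) (0≤+ 0≤1 (0≤* (0≤q s) 0≤½)))
           (0≤* (0≤q s) (0≤q-p (≤-trans (*-mono-≤ (0≤q s) (0≤q s) (q≤½ s) (q≤1 s)) (≤-reflexive (*-identityʳ ½))))))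
      (solve 1 (λ y → con 1ℚ :- y :* (y :* con 1ℚ) :- y :* (y :* (y :* con 1ℚ)) :=
         y :+ ((con 1ℚ :- (y :+ y)) :* (con 1ℚ :+ y :* con ½) :+ y :* (con ½ :- y :* y)))
         refl y)) ,
  ≤-by (y ^ 2 + y ^ 3) (0≤+ (0≤^ (0<q s) 2) (0≤^ (0<q s) 3))
    (solve 2 (λ x z → con 1ℚ := con 1ℚ :- x :- z :+ (x :+ z)) refl (y ^ 2) (y ^ 3))

∏1-≻w : ∀ ps → OddAfter2 ps → w ≺ ∏1- ps
∏1-≻w ps (inj₁ gap) = pos-≤ (∏1-gap 1 ps gap) λ y s →
  ≤-by (y ^ 2 * ∏1- ps y) (0≤* (0≤^ (0<q s) 2) (proj₁ (∏1-∈[0,1] ps s)))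
    (solve 3 (λ x w Π → Π :- w := (con 1ℚ :- x) :* Π :- w :+ x :* Π) refl (y ^ 2) (w y) (∏1- ps y))
∏1-≻w _ (inj₂ (ps , refl , gap)) = ∏1-gap 1 ps gap

N-upper-w : ∀ ps → Ascending ps → OddAfter2 ps → ∀ {a} → 1 ℕ.≤ a →
            (λ q → ⟦ N ps a ⟧ q * w (q ^ a)) ≺ (λ q → (1ℚ - q ^ a) * ⟦ M ps a ⟧ q)
N-upper-w ps asc odd {a} 1≤a =
  pos-≤ (pos-* (pos-N asc 1≤a) (pos-∘^ {λ y → ∏1- ps y - w y} 1≤a (∏1-≻w ps odd))) λ q s →
  ≤-by ((1ℚ - q ^ a) * ⟦ M ps a ⟧ q - ⟦ N ps a ⟧ q * ∏1- ps (q ^ a)) (0≤q-p (N-upper ps asc 1≤a s))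
    (solve 4 (λ n Π w x → x :- n :* w := n :* (Π :- w) :+ (x :- n :* Π)) refl
      (⟦ N ps a ⟧ q) (∏1- ps (q ^ a)) (w (q ^ a)) ((1ℚ - q ^ a) * ⟦ M ps a ⟧ q))

-- What remains when `B(q^a) < (1 − q^a) / w(q^a)` is confronted with `1 − q^b ≤ B(q^b)`. For
-- exponents 1 and 2 it fails at `q = ½`, where it would say `½ ≤ 15/32`.
separate : ∀ {a b q} → 1 ℕ.≤ a → a ℕ.< b → 2 ℕ.≤ a ⊎ 3 ℕ.≤ b → Small q →
           1ℚ - q ^ a ≤ w (q ^ a) * (1ℚ - q ^ b)
separate {a} {b} {q} 1≤a a<b (inj₁ 2≤a) s =
  ≤-by (w y * (y * ½ - q ^ b) + y * (½ - (y + y)) + y * y * (1ℚ - y) + y * y * (y * ½) + y * y * (y * (y * ½)))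
    (0≤+ (0≤+ (0≤+ (0≤+ (0≤* (<⇒≤ (proj₁ (w-bd y sy))) (0≤q-p qb≤))
         (0≤* 0≤y (0≤q-p 2y≤½)))
         (0≤* (0≤* 0≤y 0≤y) (0≤q-p (q≤1 sy))))
         (0≤* (0≤* 0≤y 0≤y) (0≤* 0≤y 0≤½)))
         (0≤* (0≤* 0≤y 0≤y) (0≤* 0≤y (0≤* 0≤y 0≤½))))
    (solve 2 (λ y z → let w = con 1ℚ :- y :* (y :* con 1ℚ) :- y :* (y :* (y :* con 1ℚ)) in
       w :* (con 1ℚ :- z) := con 1ℚ :- y :+ (w :* (y :* con ½ :- z) :+ y :* (con ½ :- (y :+ y))
         :+ y :* y :* (con 1ℚ :- y) :+ y :* y :* (y :* con ½) :+ y :* y :* (y :* (y :* con ½)))) refl y (q ^ b))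
  where
  y = q ^ a
  sy = small-^ s 1≤a
  0≤y = 0≤q sy
  qb≤ : q ^ b ≤ y * ½
  qb≤ = ≤-trans (^-anti s a<b) (subst (q * y ≤_) (*-comm ½ y)
          (*-monoʳ-≤-nonNeg y {{nonNegative 0≤y}} (q≤½ s)))
  2y≤½ : y + y ≤ ½
  2y≤½ = ≤-trans (^-double s 2≤a) (q≤½ (small-^ s ℕ.≤-refl))
separate {suc (suc a)} 1≤a a<b (inj₂ _) s = separate 1≤a a<b (inj₁ (s≤s (s≤s z≤n))) s
separate {suc zero} {b} {q} _ _ (inj₂ 3≤b) s rewrite *-identityʳ q =
  ≤-by (w q * (q ^ 3 - q ^ b) + (q * ((1ℚ - (q + q)) * (1ℚ + q)) + (q ^ 5 + q ^ 6)))
    (0≤+ (0≤* (<⇒≤ (proj₁ (w-bd q s))) (0≤q-p (^-anti s 3≤b)))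
         (0≤+ (0≤* (0≤q s) (0≤* (2q≤1 s) (0≤+ 0≤1 (0≤q s)))) (0≤+ (0≤^ (0<q s) 5) (0≤^ (0<q s) 6))))
    (solve 2 (λ y z →
       let y³ = y :* (y :* (y :* con 1ℚ))
           y⁵ = y :* (y :* y³)
           w  = con 1ℚ :- y :* (y :* con 1ℚ) :- y³ in
       w :* (con 1ℚ :- z) := con 1ℚ :- y :+ (w :* (y³ :- z) :+
         (y :* ((con 1ℚ :- (y :+ y)) :* (con 1ℚ :+ y)) :+ (y⁵ :+ y :* y⁵)))) refl q (q ^ b))

N-lower-w : ∀ {a b} qs → Ascending qs → 1 ℕ.≤ a → a ℕ.< b →
            (2 ℕ.≤ a ⊎ 3 ℕ.≤ b) ⊎ (a ≡ 1 × b ≡ 2 × ∃ λ qs′ → qs ≡ 2 ∷ qs′) → ∀ {q} → Small q →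
            (1ℚ - q ^ a) * ⟦ M qs b ⟧ q ≤ w (q ^ a) * ⟦ N qs b ⟧ q
N-lower-w {a} {b} qs asc 1≤a a<b (inj₁ sep) {q} s = ≤-trans
  (*-monoʳ-≤-nonNeg (⟦ M qs b ⟧ q) {{nonNegative (0≤M asc 1≤b s)}} (separate 1≤a a<b sep s))
  (subst (_≤ w (q ^ a) * ⟦ N qs b ⟧ q) (sym (*-assoc (w (q ^ a)) (1ℚ - q ^ b) (⟦ M qs b ⟧ q)))
    (*-monoˡ (w (q ^ a)) (<⇒≤ (proj₁ (w-bd (q ^ a) (small-^ s 1≤a)))) (N-lower qs asc 1≤b s)))
  where 1≤b = ℕ.<⇒≤ (ℕ.≤-<-trans 1≤a a<b)
-- Since 2 is in the list, `B(q²) ≥ (1 − q²)/(1 − q⁴) = 1/(1 + q²)`, and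
-- `w(q) − (1 − q)(1 + q²) = q (1 − 2q)`. This is 0 at ½, so strictness has to come from
-- `N-upper-w`.
N-lower-w {a} {b} qs asc 1≤a a<b (inj₂ (refl , refl , qs′ , refl)) {q} s rewrite *-identityʳ q =
  cancel-≤ (1ℚ - q ^ 2) (pos⇒0< (pos-1-^ {2} (s≤s z≤n)) q s) (begin
    (1ℚ - q ^ 2) * ((1ℚ - q) * m)
      ≡⟨ solve 3 (λ x y m → x :* (y :* m) := y :* (x :* con 1ℚ :* m)) refl (1ℚ - q ^ 2) (1ℚ - q) m ⟩
    (1ℚ - q) * ((1ℚ - q ^ 2) * 1ℚ * m)
      ≤⟨ *-monoˡ (1ℚ - q) (0≤q-p (q≤1 s)) (append-≥ {2} (s≤s z≤n) s (2 ∷ []) qs′ asc) ⟩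
    (1ℚ - q) * (n * (1ℚ * (1ℚ - q ^ 4)))
      ≤⟨ ≤-by ((1ℚ - q ^ 2) * n * (q * (1ℚ - (q + q))))
           (0≤* (0≤* (0≤1-^ s 2) (0≤N asc (s≤s z≤n) s)) (0≤* (0≤q s) (2q≤1 s)))
           (solve 2 (λ y n → let y² = y :* (y :* con 1ℚ) in
              (con 1ℚ :- y²) :* ((con 1ℚ :- y² :- y :* y²) :* n) :=
              (con 1ℚ :- y) :* (n :* (con 1ℚ :* (con 1ℚ :- y :* (y :* y²))))
                :+ (con 1ℚ :- y²) :* n :* (y :* (con 1ℚ :- (y :+ y)))) refl q n) ⟩
    (1ℚ - q ^ 2) * (w q * n)  ∎)
  where
  open ≤-Reasoning
  n = ⟦ N (2 ∷ qs′) 2 ⟧ q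
  m = ⟦ M (2 ∷ qs′) 2 ⟧ q

compare-exponents : ∀ {a b} ps qs → Ascending ps → OddAfter2 ps → Ascending qs → 1 ℕ.≤ a → a ℕ.< b →
  (2 ℕ.≤ a ⊎ 3 ℕ.≤ b) ⊎ (a ≡ 1 × b ≡ 2 × ∃ λ qs′ → qs ≡ 2 ∷ qs′) →
  (λ q → ⟦ N ps a ⟧ q * ⟦ M qs b ⟧ q) ≺ (λ q → ⟦ M ps a ⟧ q * ⟦ N qs b ⟧ q)
compare-exponents {a} {b} ps qs ascP oddP ascQ 1≤a a<b sep =
  pos-÷ (λ q → w (q ^ a)) (λ q s → w-bd (q ^ a) (small-^ s 1≤a))
    (pos-* (pos-M ascQ 1≤b) (N-upper-w ps ascP oddP 1≤a)) λ q s →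
    let m = ⟦ M ps a ⟧ q
        n = ⟦ N ps a ⟧ q
        m′ = ⟦ M qs b ⟧ q
        n′ = ⟦ N qs b ⟧ q
    in ≤-by (m * (w (q ^ a) * n′ - (1ℚ - q ^ a) * m′))
         (0≤* (0≤M ascP 1≤a s) (0≤q-p (N-lower-w qs ascQ 1≤a a<b sep s)))
         (solve 6 (λ m n m′ n′ w y → w :* (m :* n′ :- n :* m′) :=
            m′ :* (y :* m :- n :* w) :+ m :* (w :* n′ :- y :* m′)) refl m n m′ n′ (w (q ^ a)) (1ℚ - q ^ a))
  where 1≤b = ℕ.<⇒≤ (ℕ.≤-<-trans 1≤a a<b)

open Shape

≺-cong : ∀ {f g f′ g′} → (∀ q → f q ≡ f′ q) → (∀ q → g q ≡ g′ q) → f ≺ g → f′ ≺ g′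
≺-cong f≡ g≡ f≺g = pos-≤ f≺g λ q _ → ≤-reflexive (cong₂ (λ x y → y - x) (f≡ q) (g≡ q))

exponent-cases : ∀ {a b qs} → 1 ℕ.≤ a → a ℕ.< b → Shape b qs →
                 (2 ℕ.≤ a ⊎ 3 ℕ.≤ b) ⊎ (a ≡ 1 × b ≡ 2 × ∃ λ qs′ → qs ≡ 2 ∷ qs′)
exponent-cases {suc (suc a)} _ _ _ = inj₁ (inj₁ (s≤s (s≤s z≤n)))
exponent-cases {suc zero} {suc (suc zero)} _ _ sh = inj₂ (refl , refl , 2∈⇒head (asc sh) (support sh prime[2] ∣-refl))
exponent-cases {suc zero} {suc (suc (suc b))} _ _ _ = inj₁ (inj₂ (s≤s (s≤s (s≤s z≤n))))
exponent-cases {suc zero} {suc zero} _ (s≤s ()) _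

B-mono : ∀ {a b ps qs} → Shape a ps → Shape b qs → a ℕ.< b →
  (λ q → ⟦ N ps a ⟧ q * ⟦ M qs b ⟧ q) ≺ (λ q → ⟦ M ps a ⟧ q * ⟦ N qs b ⟧ q)
B-mono {ps = ps} {qs} shP shQ a<b = compare-exponents ps qs (asc shP) (odd-after-2 (asc shP) (primes shP))
  (asc shQ) (1≤a shP) a<b (exponent-cases (1≤a shP) a<b shQ)

B-separated : ∀ {a b ps qs} → Shape a ps → Shape b qs → ¬ (a ≡ b × ps ≡ qs) →
  (λ q → ⟦ N ps a ⟧ q * ⟦ M qs b ⟧ q) ≺ (λ q → ⟦ M ps a ⟧ q * ⟦ N qs b ⟧ q) ⊎
  (λ q → ⟦ M ps a ⟧ q * ⟦ N qs b ⟧ q) ≺ (λ q → ⟦ N ps a ⟧ q * ⟦ M qs b ⟧ q)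
B-separated {a} {b} {ps} {qs} shP shQ ne with ℕ.<-cmp a b
... | tri< a<b _ _ = inj₁ (B-mono shP shQ a<b)
... | tri> _ _ b<a = inj₂ (≺-cong
        (λ q → *-comm (⟦ N qs b ⟧ q) (⟦ M ps a ⟧ q)) (λ q → *-comm (⟦ M qs b ⟧ q) (⟦ N ps a ⟧ q))
        (B-mono shQ shP b<a))
... | tri≈ _ refl _ with first-difference (asc shP) (asc shQ) (primes shP) (primes shQ) (λ eq → ne (refl , eq))
...   | inj₁ (differ cs p ps′ qs′ pp p<qs gap) = inj₂
        (compare-primes cs p ps′ qs′ (asc shP) (asc shQ) (ℕ.<⇒≤ (1<prime pp)) p<qs gap (1≤a shP))
...   | inj₂ (differ cs p ps′ qs′ pp p<qs gap) = inj₁ (≺-cong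
        (λ q → *-comm (⟦ M qs a ⟧ q) (⟦ N ps a ⟧ q)) (λ q → *-comm (⟦ N qs a ⟧ q) (⟦ M ps a ⟧ q))
        (compare-primes cs p ps′ qs′ (asc shQ) (asc shP) (ℕ.<⇒≤ (1<prime pp)) p<qs gap (1≤a shP)))

-- Comparing the quotients `U / V`

data Orientation (ps : List ℕ) : Set where
  even : (∀ a → U ps a ≡ N ps a) → (∀ a → V ps a ≡ M ps a) → Orientation ps
  odd  : ps ≢ [] → (∀ a → U ps a ≡ M ps a) → (∀ a → V ps a ≡ N ps a) → Orientation ps

orientation : ∀ ps → Orientation ps
orientation []       = even (λ _ → refl) (λ _ → refl)
orientation (p ∷ ps) with orientation ps
... | even u v  = odd (λ ()) (λ a → cong₂ _⊗_ (v a) (u (p ℕ.* a))) (λ a → cong₂ _⊗_ (u a) (v (p ℕ.* a)))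
... | odd _ u v = even (λ a → cong₂ _⊗_ (v a) (u (p ℕ.* a))) (λ a → cong₂ _⊗_ (u a) (v (p ℕ.* a)))

-- Stated with k because a factor x^{φ(m) − φ(n)} appears at x = 1/q.
Above : (σ : ℚ → ℚ) (k a : ℕ) (ps : List ℕ) (b : ℕ) (qs : List ℕ) → Set
Above σ k a ps b qs = (λ q → q ^ k * (⟦ U qs b ⟧ (σ q) * ⟦ V ps a ⟧ (σ q))) ≺
                      (λ q → ⟦ U ps a ⟧ (σ q) * ⟦ V qs b ⟧ (σ q))

id⁺ : ℚ → ℚ
id⁺ q = q

-- Sets of different parity lie on opposite sides of 1: the quotient is `B < 1` for the even one and
-- `1 / B > 1` for the odd one.
NN≺MM : ∀ {a b ps qs} → Shape a ps → Shape b qs →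
        (λ q → 1ℚ * (⟦ N ps a ⟧ q * ⟦ N qs b ⟧ q)) ≺ (λ q → ⟦ M qs b ⟧ q * ⟦ M ps a ⟧ q)
NN≺MM {a} {b} {ps} {qs} shP shQ =
  pos-≤ (pos-* (pos-M (asc shQ) (1≤a shQ)) (N≺M ps (asc shP) (1≤a shP))) λ q s →
  let n = ⟦ N ps a ⟧ q
      m = ⟦ M ps a ⟧ q
      n′ = ⟦ N qs b ⟧ q
      m′ = ⟦ M qs b ⟧ q
  in ≤-by (n * (m′ - n′)) (0≤* (0≤N (asc shP) (1≤a shP) s) (0≤q-p (N≤M qs (asc shQ) (1≤a shQ) s)))
       (solve 4 (λ n m n′ m′ → m′ :* m :- con 1ℚ :* (n :* n′) := m′ :* (m :- n) :+ n :* (m′ :- n′)) refl n m n′ m′)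

A-separated : ∀ {a b ps qs} → Shape a ps → Shape b qs → ¬ (a ≡ b × ps ≡ qs) →
              Above id⁺ 0 a ps b qs ⊎ Above id⁺ 0 b qs a ps
A-separated {a} {b} {ps} {qs} shP shQ ne with orientation ps | orientation qs | B-separated shP shQ ne
... | even u v  | even u′ v′  | inj₁ lt rewrite u a | v a | u′ b | v′ b =
  inj₂ (≺-cong (λ q → sym (*-identityˡ (⟦ N ps a ⟧ q * ⟦ M qs b ⟧ q))) (λ q → *-comm (⟦ M ps a ⟧ q) (⟦ N qs b ⟧ q)) lt)
... | even u v  | even u′ v′  | inj₂ lt rewrite u a | v a | u′ b | v′ b =
  inj₁ (≺-cong {g = λ q → ⟦ N ps a ⟧ q * ⟦ M qs b ⟧ q} (λ q → trans (*-comm (⟦ M ps a ⟧ q) (⟦ N qs b ⟧ q)) (sym (*-identityˡ (⟦ N qs b ⟧ q * ⟦ M ps a ⟧ q)))) (λ q → refl) lt)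
... | odd _ u v | odd _ u′ v′ | inj₁ lt rewrite u a | v a | u′ b | v′ b =
  inj₁ (≺-cong {g = λ q → ⟦ M ps a ⟧ q * ⟦ N qs b ⟧ q} (λ q → trans (*-comm (⟦ N ps a ⟧ q) (⟦ M qs b ⟧ q)) (sym (*-identityˡ (⟦ M qs b ⟧ q * ⟦ N ps a ⟧ q)))) (λ q → refl) lt)
... | odd _ u v | odd _ u′ v′ | inj₂ lt rewrite u a | v a | u′ b | v′ b =
  inj₂ (≺-cong (λ q → sym (*-identityˡ (⟦ M ps a ⟧ q * ⟦ N qs b ⟧ q))) (λ q → *-comm (⟦ N ps a ⟧ q) (⟦ M qs b ⟧ q)) lt)
... | even u v  | odd _ u′ v′ | _ rewrite u a | v a | u′ b | v′ b = inj₂ (NN≺MM shP shQ)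
... | odd _ u v | even u′ v′  | _ rewrite u a | v a | u′ b | v′ b = inj₁ (NN≺MM shQ shP)

-- `1 − q ≤ u / v < 1 / (1 − q)` with denominators cleared, uniformly in the exponent and the
-- primes.
record ABounds (u v : ℚ → ℚ) : Set where
  field
    pos-u : Pos u
    pos-v : Pos v
    lower : ∀ {q} → Small q → (1ℚ - q) * v q ≤ u q
    upper : (λ q → (1ℚ - q) * u q) ≺ v

1-q≤1-q^ : ∀ {a q} → 1 ℕ.≤ a → Small q → 1ℚ - q ≤ 1ℚ - q ^ a
1-q≤1-q^ {a} {q} 1≤a s = +-monoʳ-≤ 1ℚ (neg-antimono-≤ (subst (q ^ a ≤_) (*-identityʳ q) (^-anti s 1≤a)))

A-bounds : ∀ {a ps} → Shape a ps → ABounds ⟦ U ps a ⟧ ⟦ V ps a ⟧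
A-bounds {a} {ps} sh with orientation ps
... | even u v rewrite u a | v a = record
  { pos-u = pos-N (asc sh) (1≤a sh)
  ; pos-v = pos-M (asc sh) (1≤a sh)
  ; lower = λ {q} s → ≤-trans (*-monoʳ-≤-nonNeg (⟦ M ps a ⟧ q) {{nonNegative (0≤M (asc sh) (1≤a sh) s)}}
                               (1-q≤1-q^ (1≤a sh) s)) (N-lower ps (asc sh) (1≤a sh) s)
  ; upper = pos-≤ (N≺M ps (asc sh) (1≤a sh)) λ q s →
      ≤-by (q * ⟦ N ps a ⟧ q) (0≤* (0≤q s) (0≤N (asc sh) (1≤a sh) s))
        (solve 3 (λ q n m → m :- (con 1ℚ :- q) :* n := m :- n :+ q :* n) refl q (⟦ N ps a ⟧ q) (⟦ M ps a ⟧ q))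
  }
... | odd ≢[] u v rewrite u a | v a = record
  { pos-u = pos-M (asc sh) (1≤a sh)
  ; pos-v = pos-N (asc sh) (1≤a sh)
  ; lower = λ {q} s → ≤-trans (≤-by (q * ⟦ N ps a ⟧ q) (0≤* (0≤q s) (0≤N (asc sh) (1≤a sh) s))
                        (solve 2 (λ q n → n := (con 1ℚ :- q) :* n :+ q :* n) refl q (⟦ N ps a ⟧ q)))
                      (N≤M ps (asc sh) (1≤a sh) s)
  ; upper = strict ps ≢[] (asc sh)
  }
  where
  strict : ∀ ps → ps ≢ [] → Ascending ps → (λ q → (1ℚ - q) * ⟦ M ps a ⟧ q) ≺ ⟦ N ps a ⟧
  strict []       ≢[] _   = ⊥-elim (≢[] refl)
  strict (p ∷ ps) _   asc = pos-≤ (N-lower-strict p ps asc (1≤a sh)) λ q s →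
    +-monoʳ-≤ (⟦ N (p ∷ ps) a ⟧ q) (neg-antimono-≤
      (*-monoʳ-≤-nonNeg (⟦ M (p ∷ ps) a ⟧ q) {{nonNegative (0≤M asc (1≤a sh) s)}} (1-q≤1-q^ (1≤a sh) s)))

open ABounds

-- The two sides are separated by `q² / (1 − q) ≤ 1 − q`, which amounts to `2q ≤ 1`.
above-2 : ∀ {a b ps qs} k → 2 ℕ.≤ k → Shape a ps → Shape b qs → Above id⁺ k a ps b qs
above-2 {a} {b} {ps} {qs} k 2≤k shP shQ =
  pos-÷ (λ q → 1ℚ - q ^ 1) (λ q s → pos⇒0< (pos-1-^ {1} (s≤s z≤n)) q s , 1-^≤1 s 1)
    (pos-* (pos-^ 2) (pos-* (pos-v P) (upper Q))) λ q s →
  let u = ⟦ U ps a ⟧ q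
      v = ⟦ V ps a ⟧ q
      u′ = ⟦ U qs b ⟧ q
      v′ = ⟦ V qs b ⟧ q
      0≤1-q = 0≤q-p (q≤1 s)
      0≤v = pos⇒0≤ (pos-v P) q s
      0≤u′ = pos⇒0≤ (pos-u Q) q s
      0≤v′ = pos⇒0≤ (pos-v Q) q s
  in ≤-by ((1ℚ - q) * v′ * (u - (1ℚ - q) * v) + v * v′ * (1ℚ - (q + q)) + (1ℚ - q) * u′ * v * (q ^ 2 - q ^ k))
       (0≤+ (0≤+ (0≤* (0≤* 0≤1-q 0≤v′) (0≤q-p (lower P s))) (0≤* (0≤* 0≤v 0≤v′) (2q≤1 s)))
            (0≤* (0≤* (0≤* 0≤1-q 0≤u′) 0≤v) (0≤q-p (^-anti s 2≤k))))
       (solve 6 (λ q u v u′ v′ y → let q² = q :* (q :* con 1ℚ) in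
          (con 1ℚ :- q :* con 1ℚ) :* (u :* v′ :- y :* (u′ :* v)) :=
          q² :* (v :* (v′ :- (con 1ℚ :- q) :* u′)) :+
            ((con 1ℚ :- q) :* v′ :* (u :- (con 1ℚ :- q) :* v) :+ v :* v′ :* (con 1ℚ :- (q :+ q))
             :+ (con 1ℚ :- q) :* u′ :* v :* (q² :- y))) refl q u v u′ v′ (q ^ k))
  where
  P = A-bounds shP
  Q = A-bounds shQ

-- Against `Φ₁` the smaller quotient is `1 − q`, which bounds every quotient from below. Against
-- `Φ₂` it is `1 + q`, and `q + q² ≤ ¾` is less than `(1 − q^(p a)) / (1 − q^a) ≥ 1`. With two
-- primes only `1 − q + q²` from `Φ₆` is left, which equals `q + q²` at ½.
above-1 : ∀ {a b ps qs} → Shape a ps → Shape b qs → degree a ps ≡ 2 → b ≡ 1 → qs ≡ [] ⊎ qs ≡ 2 ∷ [] →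
          Above id⁺ 1 a ps b qs ⊎ (a ≡ 1 × ps ≡ 2 ∷ 3 ∷ [] × qs ≡ 2 ∷ [])
above-1 {a} {ps = ps} shP shQ deg refl (inj₁ refl) = inj₁ (pos-≤
    (pos-* (pos-1-^ {1} (s≤s z≤n)) (pos-* (pos-1-^ {1} (s≤s z≤n)) (pos-v P))) λ q s →
    ≤-by (⟦ U ps a ⟧ q - (1ℚ - q) * ⟦ V ps a ⟧ q) (0≤q-p (lower P s))
      (solve 3 (λ q u v → u :* con 1ℚ :- q :* con 1ℚ :* ((con 1ℚ :- q :* con 1ℚ) :* v) :=
         (con 1ℚ :- q :* con 1ℚ) :* ((con 1ℚ :- q :* con 1ℚ) :* v) :+ (u :- (con 1ℚ :- q) :* v))
         refl q (⟦ U ps a ⟧ q) (⟦ V ps a ⟧ q)))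
  where P = A-bounds shP
above-1 {a} {ps = []} shP shQ deg refl (inj₂ refl) with shape-[]⇒≡1 shP | deg
... | refl | ()
above-1 {a} {ps = p ∷ []} shP shQ deg refl (inj₂ refl) = inj₁ (pos-≤
    (pos-* (pos-1-^ {1} (s≤s z≤n)) (pos-* (pos-1-^ {a} (1≤a shP)) (pos-^ 2))) λ q s →
    let y = q ^ a
        z = q ^ (p ℕ.* a)
    in ≤-by ((1ℚ - q) * (y - z) + (1ℚ - q) * (1ℚ - y) * ((1ℚ - (q + q)) * (1ℚ + q)))
         (0≤+ (0≤* (0≤q-p (q≤1 s)) (0≤q-p (^-anti s (ℕ.m≤n*m a p {{ℕ.>-nonZero (head-1≤ (asc shP))}}))))
              (0≤* (0≤* (0≤q-p (q≤1 s)) (0≤1-^ s a)) (0≤* (2q≤1 s) (0≤+ 0≤1 (0≤q s)))))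
         (solve 3 (λ q y z → let q² = q :* (q :* con 1ℚ) ; 1-q = con 1ℚ :- q :* con 1ℚ in
            con 1ℚ :* (con 1ℚ :- z) :* (1-q :* con 1ℚ) :-
              q :* con 1ℚ :* (con 1ℚ :* (con 1ℚ :- q²) :* ((con 1ℚ :- y) :* con 1ℚ)) :=
            1-q :* ((con 1ℚ :- y) :* q²) :+ ((con 1ℚ :- q) :* (y :- z) :+
              (con 1ℚ :- q) :* (con 1ℚ :- y) :* ((con 1ℚ :- (q :+ q)) :* (con 1ℚ :+ q)))) refl q y z))
above-1 {a} {ps = p ∷ p′ ∷ ps} shP shQ deg refl (inj₂ refl) with degree≡2 {a} (asc shP) deg
... | refl , refl , refl , refl = inj₂ (refl , refl , refl)

-- Negative arguments

neg-^-even : ∀ q k → (- q) ^ (k ℕ.* 2) ≡ q ^ (k ℕ.* 2)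
neg-^-even q zero    = refl
neg-^-even q (suc k) = trans (cong (λ x → - q * (- q * x)) (neg-^-even q k))
  (solve 2 (λ q x → :- q :* (:- q :* x) := q :* (q :* x)) refl q (q ^ (k ℕ.* 2)))

neg-^-2∣ : ∀ {a} q → 2 ∣ a → (- q) ^ a ≡ q ^ a
neg-^-2∣ q (divides-refl k) = neg-^-even q k

neg-^-2∤ : ∀ {a} q → ¬ 2 ∣ a → (- q) ^ a ≡ - (q ^ a)
neg-^-2∤ {zero}  q 2∤ = ⊥-elim (2∤ (divides 0 refl))
neg-^-2∤ {suc a} q 2∤ with 2∣⊎2∣suc a
... | inj₂ 2∣sa = ⊥-elim (2∤ 2∣sa)
... | inj₁ 2∣a  = trans (cong (- q *_) (neg-^-2∣ q 2∣a))
  (solve 2 (λ q x → :- q :* x := :- (q :* x)) refl q (q ^ a))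

neg-^≤ : ∀ {q} a → Small q → (- q) ^ a ≤ q ^ a
neg-^≤ {q} a s with 2 ∣? a
... | yes 2∣a = ≤-reflexive (neg-^-2∣ q 2∣a)
... | no 2∤a  = subst (_≤ q ^ a) (sym (neg-^-2∤ q 2∤a))
                  (≤-trans (neg-antimono-≤ (0≤^ (0<q s) a)) (0≤^ (0<q s) a))

UV-reflect-even : ∀ {a} ps q → 2 ∣ a → ⟦ U ps a ⟧ (- q) ≡ ⟦ U ps a ⟧ q × ⟦ V ps a ⟧ (- q) ≡ ⟦ V ps a ⟧ q
UV-reflect-even []       q 2∣a = cong (λ x → 1ℚ - x) (neg-^-2∣ q 2∣a) , refl
UV-reflect-even (p ∷ ps) q 2∣a with UV-reflect-even ps q 2∣a | UV-reflect-even ps q (∣n⇒∣m*n p 2∣a)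
... | u , v | u′ , v′ = cong₂ _*_ v u′ , cong₂ _*_ u v′

-- 1 − y² = (1 − y)(1 + y) factor by factor.
UV-reflect-odd : ∀ {a} ps q → ¬ 2 ∣ a → OddPrimes ps →
                 ⟦ U ps a ⟧ (- q) * ⟦ U ps a ⟧ q ≡ ⟦ U ps (2 ℕ.* a) ⟧ q ×
                 ⟦ V ps a ⟧ (- q) * ⟦ V ps a ⟧ q ≡ ⟦ V ps (2 ℕ.* a) ⟧ q
UV-reflect-odd {a} [] q 2∤a [] = (begin
    (1ℚ - (- q) ^ a) * (1ℚ - q ^ a)     ≡⟨ cong (λ x → (1ℚ - x) * (1ℚ - q ^ a)) (neg-^-2∤ q 2∤a) ⟩
    (1ℚ - - (q ^ a)) * (1ℚ - q ^ a)
      ≡⟨ solve 1 (λ y → (con 1ℚ :- (:- y)) :* (con 1ℚ :- y) := con 1ℚ :- y :* (y :* con 1ℚ)) refl (q ^ a) ⟩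
    1ℚ - (q ^ a) ^ 2                    ≡⟨ cong (λ x → 1ℚ - x) (trans (^-* q a 2) (cong (q ^_) (ℕ.*-comm a 2))) ⟩
    1ℚ - q ^ (2 ℕ.* a)                  ∎) , refl
  where open ≡-Reasoning
UV-reflect-odd {a} (p ∷ ps) q 2∤a (2∤p ∷ ods)
  with UV-reflect-odd ps q 2∤a ods | UV-reflect-odd ps q 2∤pa ods
  where
  2∤pa : ¬ 2 ∣ p ℕ.* a
  2∤pa 2∣pa = [ 2∤p , 2∤a ]′ (euclidsLemma p a prime[2] 2∣pa)
... | u , v | u′ , v′ rewrite sym (*-swap p 2 a) =
  trans (interchange (⟦ V ps a ⟧ (- q)) (⟦ U ps (p ℕ.* a) ⟧ (- q)) (⟦ V ps a ⟧ q) (⟦ U ps (p ℕ.* a) ⟧ q)) (cong₂ _*_ v u′) ,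
  trans (interchange (⟦ U ps a ⟧ (- q)) (⟦ V ps (p ℕ.* a) ⟧ (- q)) (⟦ U ps a ⟧ q) (⟦ V ps (p ℕ.* a) ⟧ q)) (cong₂ _*_ u v′)
  where
  interchange : ∀ x y z w → x * y * (z * w) ≡ x * z * (y * w)
  interchange = solve 4 (λ x y z w → x :* y :* (z :* w) := x :* z :* (y :* w)) refl

-- For odd `a` each quotient at `−q` is the quotient for `2 a` over the one at `q`. This is exactly
-- what adjoining the prime 2 does, and if 2 was already present the two effects cancel.
star-reflect : ∀ {a ps qs} → Star a ps qs → ∀ q →
               ⟦ U ps a ⟧ (- q) * ⟦ V qs a ⟧ q ≡ ⟦ U qs a ⟧ q * ⟦ V ps a ⟧ (- q)
star-reflect {a} {ps} (keep 2∣a) q = cong₂ _*_ (proj₁ reflect) (sym (proj₂ reflect))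
  where reflect = UV-reflect-even {a} ps q 2∣a
star-reflect {a} (drop {ps} 2∤a ods) q
  with UV-reflect-odd ps q 2∤a ods | UV-reflect-even ps q (m∣m*n {2} a)
... | u , v | u₂ , v₂ rewrite u₂ | v₂ | sym u | sym v =
  solve 4 (λ u u⁻ v v⁻ → v⁻ :* (u⁻ :* u) :* v := u :* (u⁻ :* (v⁻ :* v))) refl
    (⟦ U ps a ⟧ q) (⟦ U ps a ⟧ (- q)) (⟦ V ps a ⟧ q) (⟦ V ps a ⟧ (- q))
star-reflect {a} (add {ps} 2∤a ods) q with UV-reflect-odd ps q 2∤a ods
... | u , v rewrite sym u | sym v =
  solve 4 (λ u u⁻ v v⁻ → u⁻ :* (u :* (v⁻ :* v)) := v :* (u⁻ :* u) :* v⁻) refl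
    (⟦ U ps a ⟧ q) (⟦ U ps a ⟧ (- q)) (⟦ V ps a ⟧ q) (⟦ V ps a ⟧ (- q))

-- `(−q)^a ≤ q^a` for either parity of `a`, so a factor at `−q` is at least the factor at `q`.
UV-reflect-pos : ∀ ps {a} → 1 ℕ.≤ a → Ascending ps → Pos (λ q → ⟦ U ps a ⟧ (- q)) × Pos (λ q → ⟦ V ps a ⟧ (- q))
UV-reflect-pos [] {a} 1≤a _ = pos-≤ (pos-1-^ 1≤a)
  (λ q s → +-monoʳ-≤ 1ℚ (neg-antimono-≤ (neg-^≤ a s))) , pos-1
UV-reflect-pos (p ∷ ps) 1≤a asc with UV-reflect-pos ps 1≤a (tail-asc asc)
                                   | UV-reflect-pos ps (1≤* (head-1≤ asc) 1≤a) (tail-asc asc)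
... | u , v | u′ , v′ = pos-* v u′ , pos-* u v′

UV-∈[0,1] : ∀ ps a {q} → Small q → (0ℚ ≤ ⟦ U ps a ⟧ q × ⟦ U ps a ⟧ q ≤ 1ℚ) × (0ℚ ≤ ⟦ V ps a ⟧ q × ⟦ V ps a ⟧ q ≤ 1ℚ)
UV-∈[0,1] []       a s = (0≤1-^ s a , 1-^≤1 s a) , (0≤1 , ≤-refl)
UV-∈[0,1] (p ∷ ps) a s with UV-∈[0,1] ps a s | UV-∈[0,1] ps (p ℕ.* a) s
... | (0≤u , u≤1) , (0≤v , v≤1) | (0≤u′ , u′≤1) , (0≤v′ , v′≤1) =
  (0≤* 0≤v 0≤u′ , *-mono-≤ 0≤v 0≤u′ v≤1 u′≤1) , (0≤* 0≤u 0≤v′ , *-mono-≤ 0≤u 0≤v′ u≤1 v′≤1)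

-- Cross-multiplication brings in the starred denominators at `q`; they lie in `(0, 1]`, so `pos-÷`
-- removes them.
above-reflect : ∀ {a b ps qs ps* qs*} k → Shape a ps → Shape b qs → Star a ps ps* → Star b qs qs* →
                Above id⁺ k a ps* b qs* → Above -_ k a ps b qs
above-reflect {a} {b} {ps} {qs} {ps*} {qs*} k shP shQ starP starQ above =
  pos-÷ (λ q → ⟦ V ps* a ⟧ q * ⟦ V qs* b ⟧ q)
    (λ q s → 0<* (pos⇒0< (pos-v (A-bounds (star-shape shP starP))) q s)
                 (pos⇒0< (pos-v (A-bounds (star-shape shQ starQ))) q s) ,
             *-mono-≤ (proj₁ (proj₂ (UV-∈[0,1] ps* a s))) (proj₁ (proj₂ (UV-∈[0,1] qs* b s)))
                      (proj₂ (proj₂ (UV-∈[0,1] ps* a s))) (proj₂ (proj₂ (UV-∈[0,1] qs* b s))))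
    (pos-* (pos-* (proj₂ (UV-reflect-pos ps (1≤a shP) (asc shP))) (proj₂ (UV-reflect-pos qs (1≤a shQ) (asc shQ)))) above)
    λ q s → ≤-reflexive (transfer
      (⟦ U ps a ⟧ (- q)) (⟦ V ps a ⟧ (- q)) (⟦ U qs b ⟧ (- q)) (⟦ V qs b ⟧ (- q))
      (⟦ U ps* a ⟧ q) (⟦ V ps* a ⟧ q) (⟦ U qs* b ⟧ q) (⟦ V qs* b ⟧ q) (q ^ k)
      (star-reflect starP q) (star-reflect starQ q))
  where
  transfer : ∀ u v u′ v′ u* v* u′* v′* y → u * v* ≡ u* * v → u′ * v′* ≡ u′* * v′ →
             v * v′ * (u* * v′* - y * (u′* * v*)) ≡ v* * v′* * (u * v′ - y * (u′ * v))
  transfer u v u′ v′ u* v* u′* v′* y e e′ = begin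
    v * v′ * (u* * v′* - y * (u′* * v*))
      ≡⟨ solve 7 (λ v v′ u* v* u′* v′* y → v :* v′ :* (u* :* v′* :- y :* (u′* :* v*)) :=
           (u* :* v) :* (v′ :* v′*) :- y :* ((u′* :* v′) :* (v :* v*))) refl v v′ u* v* u′* v′* y ⟩
    (u* * v) * (v′ * v′*) - y * ((u′* * v′) * (v * v*))
      ≡⟨ cong₂ (λ x z → x * (v′ * v′*) - y * (z * (v * v*))) (sym e) (sym e′) ⟩
    (u * v*) * (v′ * v′*) - y * ((u′ * v′*) * (v * v*))
      ≡⟨ solve 7 (λ u v u′ v′ v* v′* y → (u :* v*) :* (v′ :* v′*) :- y :* ((u′ :* v′*) :* (v :* v*)) :=
           v* :* v′* :* (u :* v′ :- y :* (u′ :* v))) refl u v u′ v′ v* v′* y ⟩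
    v* * v′* * (u * v′ - y * (u′ * v))  ∎
    where open ≡-Reasoning

A-separated⁻ : ∀ {a b ps qs} → Shape a ps → Shape b qs → ¬ (a ≡ b × ps ≡ qs) →
               Above -_ 0 a ps b qs ⊎ Above -_ 0 b qs a ps
A-separated⁻ {a} {b} {ps} {qs} shP shQ ne with star shP | star shQ
... | ps* , starP | qs* , starQ
  with A-separated (star-shape shP starP) (star-shape shQ starQ) (λ { (refl , refl) → ne (refl , star-injective starP starQ) })
...   | inj₁ above = inj₁ (above-reflect 0 shP shQ starP starQ above)
...   | inj₂ above = inj₂ (above-reflect 0 shQ shP starQ starP above)

above-2⁻ : ∀ {a b ps qs} k → 2 ℕ.≤ k → Shape a ps → Shape b qs → Above -_ k a ps b qs
above-2⁻ k 2≤k shP shQ with star shP | star shQ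
... | ps* , starP | qs* , starQ = above-reflect k shP shQ starP starQ
  (above-2 k 2≤k (star-shape shP starP) (star-shape shQ starQ))

-- Large arguments

∣p-q∣≡∣q-p∣ : ∀ p q → ∣ p - q ∣ ≡ ∣ q - p ∣
∣p-q∣≡∣q-p∣ p q = trans (cong ∣_∣ (solve 2 (λ p q → p :- q := :- (q :- p)) refl p q)) (∣-p∣≡∣p∣ (q - p))

p≤∣p∣ : ∀ p → p ≤ ∣ p ∣
p≤∣p∣ p with ≤-total 0ℚ p
... | inj₁ 0≤p = ≤-reflexive (sym (0≤p⇒∣p∣≡p 0≤p))
... | inj₂ p≤0 = ≤-trans p≤0 (0≤∣p∣ p)

pos-∣∣ : ∀ {f} → Pos f → Pos (λ q → ∣ f q ∣)
pos-∣∣ {f} pf = pos-≤ pf λ q _ → p≤∣p∣ (f q)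

∣^∣ : ∀ x n → ∣ x ^ n ∣ ≡ ∣ x ∣ ^ n
∣^∣ x zero    = refl
∣^∣ x (suc n) = trans (∣p*q∣≡∣p∣*∣q∣ x (x ^ n)) (cong (∣ x ∣ *_) (∣^∣ x n))

1≤^ : ∀ {x} → 1ℚ ≤ x → ∀ n → 1ℚ ≤ x ^ n
1≤^ 1≤x zero    = ≤-refl
1≤^ 1≤x (suc n) = *-mono-≤ 0≤1 0≤1 1≤x (1≤^ 1≤x n)

1≤ℚ* : ∀ {x y} → 1ℚ ≤ x → 1ℚ ≤ y → 1ℚ ≤ x * y
1≤ℚ* = *-mono-≤ 0≤1 0≤1

sign : List ℕ → ℚ
sign []      = - 1ℚ
sign (_ ∷ _) = 1ℚ

sign² : ∀ ps → sign ps * sign ps ≡ 1ℚ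
sign² []      = refl
sign² (_ ∷ _) = refl

*-inv-^ : ∀ {x w} → x * w ≡ 1ℚ → ∀ n → x ^ n * w ^ n ≡ 1ℚ
*-inv-^         xw≡1 zero    = refl
*-inv-^ {x} {w} xw≡1 (suc n) = trans
  (solve 4 (λ x w y z → x :* y :* (w :* z) := x :* w :* (y :* z)) refl x w (x ^ n) (w ^ n))
  (cong₂ _*_ xw≡1 (*-inv-^ xw≡1 n))

-- Φ is reciprocal up to sign. A single factor obeys `1 − x^a = − x^a (1 − w^a)`. A new prime takes
-- the quotient of two such equations, whence the signs cancel and the degrees subtract to
-- `p a φ − a φ = a (p − 1) φ`.
functional-equation : ∀ ps a → Ascending ps → ∀ {x w} → x * w ≡ 1ℚ →
  ⟦ U ps a ⟧ x * ⟦ V ps a ⟧ w ≡ sign ps * x ^ degree a ps * (⟦ U ps a ⟧ w * ⟦ V ps a ⟧ x)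
functional-equation [] a _ {x} {w} xw≡1 rewrite ℕ.*-identityʳ a = begin
  (1ℚ - x ^ a) * 1ℚ                       ≡⟨ cong (λ y → (y - x ^ a) * 1ℚ) (sym (*-inv-^ xw≡1 a)) ⟩
  (x ^ a * w ^ a - x ^ a) * 1ℚ
    ≡⟨ solve 2 (λ x w → (x :* w :- x) :* con 1ℚ := con (- 1ℚ) :* x :* ((con 1ℚ :- w) :* con 1ℚ)) refl (x ^ a) (w ^ a) ⟩
  - 1ℚ * x ^ a * ((1ℚ - w ^ a) * 1ℚ)      ∎
  where open ≡-Reasoning
functional-equation (p ∷ ps) a asc {x} {w} xw≡1 = begin
  v * u′ * (uw * v′w)                     ≡⟨ solve 4 (λ v u′ uw v′w → v :* u′ :* (uw :* v′w) := v :* uw :* (u′ :* v′w)) refl v u′ uw v′w ⟩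
  v * uw * (u′ * v′w)                     ≡⟨ cong (v * uw *_) (functional-equation ps (p ℕ.* a) (tail-asc asc) xw≡1) ⟩
  v * uw * (s * x ^ degree (p ℕ.* a) ps * (u′w * v′))
    ≡⟨ cong (λ y → v * uw * (s * y * (u′w * v′))) (trans (cong (x ^_) degrees) (^-+ x D (degree a ps))) ⟩
  v * uw * (s * (x ^ D * x ^ degree a ps) * (u′w * v′))
    ≡⟨ solve 7 (λ v uw s X y u′w v′ → v :* uw :* (s :* (X :* y) :* (u′w :* v′)) :=
         X :* (u′w :* v′) :* (s :* y :* (uw :* v))) refl v uw s (x ^ D) (x ^ degree a ps) u′w v′ ⟩
  x ^ D * (u′w * v′) * (s * x ^ degree a ps * (uw * v))
    ≡⟨ cong (x ^ D * (u′w * v′) *_) (sym (functional-equation ps a (tail-asc asc) xw≡1)) ⟩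
  x ^ D * (u′w * v′) * (u * vw)
    ≡⟨ solve 5 (λ X u′w v′ u vw → X :* (u′w :* v′) :* (u :* vw) := con 1ℚ :* X :* (vw :* u′w :* (u :* v′))) refl (x ^ D) u′w v′ u vw ⟩
  1ℚ * x ^ D * (vw * u′w * (u * v′))      ∎
  where
  open ≡-Reasoning
  s = sign ps
  D = degree a (p ∷ ps)
  u = ⟦ U ps a ⟧ x
  v = ⟦ V ps a ⟧ x
  u′ = ⟦ U ps (p ℕ.* a) ⟧ x
  v′ = ⟦ V ps (p ℕ.* a) ⟧ x
  uw = ⟦ U ps a ⟧ w
  vw = ⟦ V ps a ⟧ w
  u′w = ⟦ U ps (p ℕ.* a) ⟧ w
  v′w = ⟦ V ps (p ℕ.* a) ⟧ w
  arith : ∀ p a f → 1 ℕ.≤ p → p ℕ.* a ℕ.* f ≡ a ℕ.* ((p ℕ.∸ 1) ℕ.* f) ℕ.+ a ℕ.* f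
  arith (suc p) a f _ = trans (cong (ℕ._* f) (ℕ.*-comm (suc p) a)) (trans (ℕ.*-assoc a (suc p) f)
    (trans (cong (a ℕ.*_) (ℕ.+-comm f (p ℕ.* f))) (ℕ.*-distribˡ-+ a (p ℕ.* f) f)))
  degrees : degree (p ℕ.* a) ps ≡ D ℕ.+ degree a ps
  degrees = arith p a (φ ps) (head-1≤ asc)

W≡ : ∀ ps a x → ⟦ W ps a ⟧ x ≡ sign ps * ⟦ U ps a ⟧ x
W≡ []       a x = solve 1 (λ y → y :- con 1ℚ := con (- 1ℚ) :* (con 1ℚ :- y)) refl (x ^ a)
W≡ (p ∷ ps) a x = sym (*-identityˡ (⟦ U (p ∷ ps) a ⟧ x))

data Sign : Set where
  plus minus : Sign

_·_ : Sign → ℚ → ℚ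
plus  · q = q
minus · q = - q

∣·∣ : ∀ σ q → ∣ σ · q ∣ ≡ ∣ q ∣
∣·∣ plus  q = refl
∣·∣ minus q = ∣-p∣≡∣p∣ q

·-inverse : ∀ σ {s q} → s * q ≡ 1ℚ → (σ · s) * (σ · q) ≡ 1ℚ
·-inverse plus  sq≡1 = sq≡1
·-inverse minus {s} {q} sq≡1 = trans (solve 2 (λ s q → :- s :* (:- q) := s :* q) refl s q) sq≡1

module _ {a ps} (sh : Shape a ps) where

  UV-pos : ∀ σ → Pos (λ q → ⟦ U ps a ⟧ (σ · q)) × Pos (λ q → ⟦ V ps a ⟧ (σ · q))
  UV-pos plus  = pos-u (A-bounds sh) , pos-v (A-bounds sh)
  UV-pos minus = UV-reflect-pos ps (1≤a sh) (asc sh)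

-- Each factor is at most 2 in absolute value, and `2q ≤ 1`, so powers of `q` absorb them all.
UV-bounded : ∀ σ ps a → ∃ λ J → ∀ {q} → Small q →
             q ^ J * ∣ ⟦ U ps a ⟧ (σ · q) ∣ ≤ 1ℚ × q ^ J * ∣ ⟦ V ps a ⟧ (σ · q) ∣ ≤ 1ℚ
UV-bounded σ [] a = 1 , λ {q} s → bound s , subst (_≤ 1ℚ) (sym (trans (*-identityʳ (q ^ 1)) (*-identityʳ q))) (q≤1 s)
  where
  bound : ∀ {q} → Small q → q ^ 1 * ∣ 1ℚ - (σ · q) ^ a ∣ ≤ 1ℚ
  bound {q} s = ≤-trans (*-monoˡ (q ^ 1) (0≤^ (0<q s) 1)
      (≤-trans (∣p-q∣≤∣p∣+∣q∣ 1ℚ ((σ · q) ^ a))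
        (+-monoʳ-≤ 1ℚ (subst (_≤ 1ℚ) (sym (trans (∣^∣ (σ · q) a) (cong (_^ a) (trans (∣·∣ σ q) (0≤p⇒∣p∣≡p (0≤q s))))))
          (proj₂ (^-≤1 (0≤q s) (q≤1 s) a))))))
    (≤-by (1ℚ - (q + q)) (2q≤1 s) (solve 1 (λ q → con 1ℚ := q :* con 1ℚ :* (con 1ℚ :+ con 1ℚ) :+ (con 1ℚ :- (q :+ q))) refl q))
UV-bounded σ (p ∷ ps) a with UV-bounded σ ps a | UV-bounded σ ps (p ℕ.* a)
... | J , bd | J′ , bd′ = J ℕ.+ J′ , λ s → product s (proj₂ (bd s)) (proj₁ (bd′ s)) , product s (proj₁ (bd s)) (proj₂ (bd′ s))
  where
  product : ∀ {q x y} → Small q → q ^ J * ∣ x ∣ ≤ 1ℚ → q ^ J′ * ∣ y ∣ ≤ 1ℚ → q ^ (J ℕ.+ J′) * ∣ x * y ∣ ≤ 1ℚ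
  product {q} {x} {y} s bx by = subst (_≤ 1ℚ) (sym (trans (cong₂ _*_ (^-+ q J J′) (∣p*q∣≡∣p∣*∣q∣ x y))
      (solve 4 (λ a b x y → a :* b :* (x :* y) := a :* x :* (b :* y)) refl (q ^ J) (q ^ J′) ∣ x ∣ ∣ y ∣)))
    (*-mono-≤ (0≤* (0≤^ (0<q s) J) (0≤∣p∣ x)) (0≤* (0≤^ (0<q s) J′) (0≤∣p∣ y)) bx by)

2≤⇒1≤ : ∀ {x} → 1ℚ + 1ℚ ≤ x → 1ℚ ≤ x
2≤⇒1≤ = ≤-trans (≤ᵇ⇒≤ _)

UV-large : ∀ ps a → 1 ℕ.≤ a → Ascending ps → ∀ {x} → 1ℚ + 1ℚ ≤ ∣ x ∣ →
           1ℚ ≤ ∣ ⟦ U ps a ⟧ x ∣ × 1ℚ ≤ ∣ ⟦ V ps a ⟧ x ∣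
UV-large [] (suc a) _ _ {x} 2≤x = subst (1ℚ ≤_) (∣p-q∣≡∣q-p∣ (x ^ suc a) 1ℚ) (begin
    1ℚ                        ≤⟨ ≤-by (∣ x ∣ * ∣ x ∣ ^ a - (1ℚ + 1ℚ) * 1ℚ) (0≤q-p 2≤x^)
                                   (solve 1 (λ y → y :- con 1ℚ := con 1ℚ :+ (y :- (con 1ℚ :+ con 1ℚ) :* con 1ℚ)) refl (∣ x ∣ * ∣ x ∣ ^ a)) ⟩
    ∣ x ∣ ^ suc a - 1ℚ        ≡⟨ cong (_- 1ℚ) (sym (∣^∣ x (suc a))) ⟩
    ∣ x ^ suc a ∣ - 1ℚ        ≤⟨ ≤-by (∣ x ^ suc a - 1ℚ ∣ + ∣ 1ℚ ∣ - ∣ x ^ suc a ∣) (0≤q-p triangle)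
                                   (solve 2 (λ y d → d := y :- con 1ℚ :+ (d :+ con 1ℚ :- y)) refl ∣ x ^ suc a ∣ ∣ x ^ suc a - 1ℚ ∣) ⟩
    ∣ x ^ suc a - 1ℚ ∣        ∎) , ≤-refl
  where
  open ≤-Reasoning
  2≤x^ : (1ℚ + 1ℚ) * 1ℚ ≤ ∣ x ∣ * ∣ x ∣ ^ a
  2≤x^ = *-mono-≤ (nonNegative⁻¹ (1ℚ + 1ℚ)) 0≤1 2≤x (1≤^ (2≤⇒1≤ 2≤x) a)
  triangle : ∣ x ^ suc a ∣ ≤ ∣ x ^ suc a - 1ℚ ∣ + ∣ 1ℚ ∣
  triangle = subst (_≤ ∣ x ^ suc a - 1ℚ ∣ + ∣ 1ℚ ∣)
    (cong ∣_∣ (solve 1 (λ y → y :- con 1ℚ :+ con 1ℚ := y) refl (x ^ suc a)))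
    (∣p+q∣≤∣p∣+∣q∣ (x ^ suc a - 1ℚ) 1ℚ)
UV-large (p ∷ ps) a 1≤a asc {x} 2≤x with UV-large ps a 1≤a (tail-asc asc) 2≤x
                                       | UV-large ps (p ℕ.* a) (1≤* (head-1≤ asc) 1≤a) (tail-asc asc) 2≤x
... | u , v | u′ , v′ = product v u′ , product u v′
  where
  product : ∀ {y z} → 1ℚ ≤ ∣ y ∣ → 1ℚ ≤ ∣ z ∣ → 1ℚ ≤ ∣ y * z ∣
  product {y} {z} 1≤y 1≤z = subst (1ℚ ≤_) (sym (∣p*q∣≡∣p∣*∣q∣ y z)) (1≤ℚ* 1≤y 1≤z)

Distinct : ℕ → List ℕ → ℕ → List ℕ → Set
Distinct a ps b qs = ¬ (a ≡ b × ps ≡ qs)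

A-separated± : ∀ σ {a b ps qs} → Shape a ps → Shape b qs → Distinct a ps b qs →
               Above (σ ·_) 0 a ps b qs ⊎ Above (σ ·_) 0 b qs a ps
A-separated± plus  = A-separated
A-separated± minus = A-separated⁻

T-eval : ∀ a ps b qs x → ⟦ T a ps b qs ⟧ x ≡
  sign ps * (⟦ U ps a ⟧ x * ⟦ V qs b ⟧ x) - sign qs * (⟦ U qs b ⟧ x * ⟦ V ps a ⟧ x)
T-eval a ps b qs x rewrite W≡ ps a x | W≡ qs b x =
  cong₂ _-_ (*-assoc (sign ps) (⟦ U ps a ⟧ x) (⟦ V qs b ⟧ x)) (*-assoc (sign qs) (⟦ U qs b ⟧ x) (⟦ V ps a ⟧ x))

T-swap : ∀ a ps b qs x → ∣ ⟦ T a ps b qs ⟧ x ∣ ≡ ∣ ⟦ T b qs a ps ⟧ x ∣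
T-swap a ps b qs x = ∣p-q∣≡∣q-p∣ (⟦ W ps a ⟧ x * ⟦ V qs b ⟧ x) (⟦ W qs b ⟧ x * ⟦ V ps a ⟧ x)

T-small-∷ : ∀ σ {a b p ps r qs} → Above (σ ·_) 0 a (p ∷ ps) b (r ∷ qs) → Pos (λ q → ∣ ⟦ T a (p ∷ ps) b (r ∷ qs) ⟧ (σ · q) ∣)
T-small-∷ σ {a} {b} {p} {ps} {r} {qs} above = pos-≤ (pos-∣∣ above) λ q _ → ≤-reflexive (cong ∣_∣
  (cong (λ y → ⟦ U (p ∷ ps) a ⟧ (σ · q) * ⟦ V (r ∷ qs) b ⟧ (σ · q) - y)
    (*-identityˡ (⟦ U (r ∷ qs) b ⟧ (σ · q) * ⟦ V (p ∷ ps) a ⟧ (σ · q)))))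

-- `Φ₁` is negative here and the other polynomial positive: the sign in `W` turns the difference
-- into minus a sum of positive terms.
T-small-[] : ∀ σ {a b r qs} → Shape a [] → Shape b (r ∷ qs) → Pos (λ q → ∣ ⟦ T a [] b (r ∷ qs) ⟧ (σ · q) ∣)
T-small-[] σ {a} {b} {r} {qs} shP shQ = pos-≤ (pos-* (proj₁ (UV-pos shP σ)) (proj₂ (UV-pos shQ σ))) λ q s →
  let u = ⟦ U [] a ⟧ (σ · q)
      v = ⟦ V (r ∷ qs) b ⟧ (σ · q)
      u′ = ⟦ U (r ∷ qs) b ⟧ (σ · q)
  in begin
    u * v                      ≤⟨ ≤-by (u′ * 1ℚ) (0≤* (pos⇒0≤ (proj₁ (UV-pos shQ σ)) q s) 0≤1) refl ⟩
    u * v + u′ * 1ℚ            ≤⟨ p≤∣p∣ (u * v + u′ * 1ℚ) ⟩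
    ∣ u * v + u′ * 1ℚ ∣        ≡⟨ sym (∣-p∣≡∣p∣ (u * v + u′ * 1ℚ)) ⟩
    ∣ - (u * v + u′ * 1ℚ) ∣    ≡⟨ cong ∣_∣ (solve 3 (λ y v u′ → :- ((con 1ℚ :- y) :* v :+ u′ :* con 1ℚ) :=
                                    (y :- con 1ℚ) :* v :- u′ :* con 1ℚ) refl ((σ · q) ^ a) v u′) ⟩
    ∣ ⟦ T a [] b (r ∷ qs) ⟧ (σ · q) ∣  ∎
  where open ≤-Reasoning

T-small : ∀ σ {a b ps qs} → Shape a ps → Shape b qs → Distinct a ps b qs → Pos (λ q → ∣ ⟦ T a ps b qs ⟧ (σ · q) ∣)
T-small σ {a} {b} {[]} {[]} shP shQ ne =
  ⊥-elim (ne (trans (shape-[]⇒≡1 shP) (sym (shape-[]⇒≡1 shQ)) , refl))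
T-small σ {a} {b} {[]} {r ∷ qs} shP shQ ne = T-small-[] σ shP shQ
T-small σ {a} {b} {p ∷ ps} {[]} shP shQ ne = pos-≤ (T-small-[] σ shQ shP) λ q _ →
  ≤-reflexive (T-swap b [] a (p ∷ ps) (σ · q))
T-small σ {a} {b} {p ∷ ps} {r ∷ qs} shP shQ ne with A-separated± σ shP shQ ne
... | inj₁ above = T-small-∷ σ {a} {b} {p} {ps} {r} {qs} above
... | inj₂ above = pos-≤ (T-small-∷ σ {b} {a} {r} {qs} {p} {ps} above) λ q _ → ≤-reflexive (T-swap b (r ∷ qs) a (p ∷ ps) (σ · q))

-- The cross-multiplied difference at `x = ± s` once the functional equation has moved both
-- quotients to `± q = 1 / x`, where the estimates for small arguments apply.
scaled : Sign → ℕ → List ℕ → ℕ → List ℕ → ℚ → ℚ → ℚ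
scaled σ a ps b qs s q = (σ · s) ^ degree a ps * (⟦ U ps a ⟧ (σ · q) * ⟦ V qs b ⟧ (σ · q)) -
                         (σ · s) ^ degree b qs * (⟦ U qs b ⟧ (σ · q) * ⟦ V ps a ⟧ (σ · q))

Gap : Sign → ℕ → List ℕ → ℕ → List ℕ → Set
Gap σ a ps b qs = ∃ λ K → ∀ {q s} → Small q → s * q ≡ 1ℚ → q ^ K ≤ ∣ scaled σ a ps b qs s q ∣

gap-swap : ∀ σ {a ps b qs} → Gap σ a ps b qs → Gap σ b qs a ps
gap-swap σ {a} {ps} {b} {qs} (K , g) = K , λ {q} {s} sm sq≡1 → subst (q ^ K ≤_)
  (∣p-q∣≡∣q-p∣ ((σ · s) ^ degree a ps * (⟦ U ps a ⟧ (σ · q) * ⟦ V qs b ⟧ (σ · q)))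
               ((σ · s) ^ degree b qs * (⟦ U qs b ⟧ (σ · q) * ⟦ V ps a ⟧ (σ · q)))) (g sm sq≡1)

2≤inverse : ∀ {q s} → Small q → s * q ≡ 1ℚ → 1ℚ + 1ℚ ≤ s
2≤inverse {q} {s} sm sq≡1 = cancel-≤ q (0<q sm) (begin
  q * (1ℚ + 1ℚ)  ≤⟨ *-monoʳ-≤-nonNeg (1ℚ + 1ℚ) (q≤½ sm) ⟩
  1ℚ             ≡⟨ sym sq≡1 ⟩
  s * q          ≡⟨ *-comm s q ⟩
  q * s          ∎)
  where open ≤-Reasoning

∣σ·s∣ : ∀ σ {q s} → Small q → s * q ≡ 1ℚ → ∣ σ · s ∣ ≡ s
∣σ·s∣ σ {q} {s} sm sq≡1 = trans (∣·∣ σ s)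
  (0≤p⇒∣p∣≡p (≤-trans (nonNegative⁻¹ (1ℚ + 1ℚ)) (2≤inverse sm sq≡1)))

-- The common power of `x` has absolute value at least 1 and is taken out. What remains is
-- `s^k = 1 / q^k` times the difference in `Above`; the hypothesis on `σ` keeps the sign of `x` out
-- of this power.
gap-above : ∀ σ {a ps b qs} k → degree a ps ≡ k ℕ.+ degree b qs → (∀ s → (σ · s) ^ k ≡ s ^ k) →
            Above (σ ·_) k a ps b qs → Gap σ a ps b qs
gap-above σ {a} {ps} {b} {qs} k degrees σ^k (K , above) = K , λ {q} {s} sm sq≡1 →
  let x = ⟦ U ps a ⟧ (σ · q) * ⟦ V qs b ⟧ (σ · q)
      y = ⟦ U qs b ⟧ (σ · q) * ⟦ V ps a ⟧ (σ · q)
      X = (σ · s) ^ degree b qs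
      1≤s = 2≤⇒1≤ (2≤inverse sm sq≡1)
      1≤∣X∣ : 1ℚ ≤ ∣ X ∣
      1≤∣X∣ = subst (1ℚ ≤_) (sym (trans (∣^∣ (σ · s) (degree b qs)) (cong (_^ degree b qs) (∣σ·s∣ σ sm sq≡1))))
               (1≤^ 1≤s (degree b qs))
      factored : X * (s ^ k * x - y) ≡ scaled σ a ps b qs s q
      factored = trans (solve 4 (λ X Y x y → X :* (Y :* x :- y) := Y :* X :* x :- X :* y) refl X (s ^ k) x y)
        (cong (λ z → z * x - X * y) (trans (cong (_* X) (sym (σ^k s))) (sym (trans (cong ((σ · s) ^_) degrees) (^-+ (σ · s) k (degree b qs))))))
      pulled : s ^ k * (x - q ^ k * y) ≡ s ^ k * x - y
      pulled = trans (solve 4 (λ Y x y z → Y :* (x :- z :* y) := Y :* x :- Y :* z :* y) refl (s ^ k) x y (q ^ k))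
        (cong (λ w → s ^ k * x - w) (trans (cong (_* y) (*-inv-^ sq≡1 k)) (*-identityˡ y)))
  in begin
    q ^ K                        ≡⟨ sym (*-identityˡ (q ^ K)) ⟩
    1ℚ * q ^ K                   ≤⟨ *-mono-≤ 0≤1 (0≤^ (0<q sm) K) (1≤^ 1≤s k) (above q sm) ⟩
    s ^ k * (x - q ^ k * y)      ≡⟨ pulled ⟩
    s ^ k * x - y                ≤⟨ p≤∣p∣ (s ^ k * x - y) ⟩
    ∣ s ^ k * x - y ∣            ≡⟨ sym (*-identityˡ ∣ s ^ k * x - y ∣) ⟩
    1ℚ * ∣ s ^ k * x - y ∣       ≤⟨ *-monoʳ-≤-nonNeg ∣ s ^ k * x - y ∣ {{∣-∣-nonNeg (s ^ k * x - y)}} 1≤∣X∣ ⟩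
    ∣ X ∣ * ∣ s ^ k * x - y ∣    ≡⟨ sym (∣p*q∣≡∣p∣*∣q∣ X (s ^ k * x - y)) ⟩
    ∣ X * (s ^ k * x - y) ∣      ≡⟨ cong ∣_∣ factored ⟩
    ∣ scaled σ a ps b qs s q ∣   ∎
  where open ≤-Reasoning

-- At a negative argument an even and an odd degree give opposite signs.
gap-opposite : ∀ {a ps b qs} → Shape a ps → Shape b qs → 2 ∣ degree a ps → ¬ 2 ∣ degree b qs → Gap minus a ps b qs
gap-opposite {a} {ps} {b} {qs} shP shQ 2∣m 2∤n with pos-* (proj₁ (UV-pos shP minus)) (proj₂ (UV-pos shQ minus))
... | K , x≥ = K , λ {q} {s} sm sq≡1 →
  let x = ⟦ U ps a ⟧ (- q) * ⟦ V qs b ⟧ (- q)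
      y = ⟦ U qs b ⟧ (- q) * ⟦ V ps a ⟧ (- q)
      X = s ^ degree a ps
      Y = s ^ degree b qs
      1≤s = 2≤⇒1≤ (2≤inverse sm sq≡1)
      0≤Y = ≤-trans 0≤1 (1≤^ 1≤s (degree b qs))
      0≤x = ≤-trans (0≤^ (0<q sm) K) (x≥ q sm)
      0≤y = 0≤* (pos⇒0≤ (proj₁ (UV-pos shQ minus)) q sm) (pos⇒0≤ (proj₂ (UV-pos shP minus)) q sm)
  in begin
    q ^ K                  ≤⟨ x≥ q sm ⟩
    x                      ≤⟨ ≤-by ((X - 1ℚ) * x + Y * y) (0≤+ (0≤* (0≤q-p (1≤^ 1≤s (degree a ps))) 0≤x) (0≤* 0≤Y 0≤y))
                                (solve 4 (λ X Y x y → X :* x :- (:- Y) :* y := x :+ ((X :- con 1ℚ) :* x :+ Y :* y)) refl X Y x y) ⟩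
    X * x - (- Y) * y      ≡⟨ cong₂ (λ X Y → X * x - Y * y) (sym (neg-^-2∣ s 2∣m)) (sym (neg-^-2∤ s 2∤n)) ⟩
    scaled minus a ps b qs s q        ≤⟨ p≤∣p∣ (scaled minus a ps b qs s q) ⟩
    ∣ scaled minus a ps b qs s q ∣    ∎
  where open ≤-Reasoning

Exceptional : ℕ → List ℕ → ℕ → List ℕ → Set
Exceptional a ps b qs = a ≡ 1 × ps ≡ 2 ∷ 3 ∷ [] × b ≡ 1 × qs ≡ 2 ∷ []

degree-1 : ∀ {b qs} → b ≡ 1 × (qs ≡ [] ⊎ qs ≡ 2 ∷ []) → degree b qs ≡ 1
degree-1 (refl , inj₁ refl) = refl
degree-1 (refl , inj₂ refl) = refl

2∤degree-1 : ∀ {b qs} → b ≡ 1 × (qs ≡ [] ⊎ qs ≡ 2 ∷ []) → ¬ 2 ∣ degree b qs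
2∤degree-1 c 2∣d rewrite degree-1 c = 2∤1 2∣d

1≤φ : ∀ ps → Ascending ps → 1 ℕ.≤ φ ps
1≤φ []       _   = s≤s z≤n
1≤φ (suc p ∷ ps) asc@(s≤s 1≤p ∷ _) = 1≤* 1≤p (1≤φ ps (tail-asc asc))

1≤degree : ∀ {a ps} → Shape a ps → 1 ℕ.≤ degree a ps
1≤degree {a} {ps} sh = 1≤* (1≤a sh) (1≤φ ps (asc sh))

-- An odd degree is 1 and degrees are positive, so an odd `k` means smaller degree 1 and larger
-- degree even. At a negative argument the values then differ in sign; hence the exception occurs
-- only for `plus`, with `k = 1`.
gap-from-above : ∀ σ {a ps b qs} k → Shape a ps → Shape b qs → Distinct a ps b qs →
                 degree a ps ≡ k ℕ.+ degree b qs → Gap σ a ps b qs ⊎ (σ ≡ plus × Exceptional a ps b qs)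
gap-from-above σ {a} {ps} {b} {qs} zero shP shQ ne degrees with A-separated± σ shP shQ ne
... | inj₁ above = inj₁ (gap-above σ {a} {ps} {b} {qs} 0 degrees (λ _ → refl) above)
... | inj₂ above = inj₁ (gap-swap σ {b} {qs} {a} {ps} (gap-above σ {b} {qs} {a} {ps} 0 (sym degrees) (λ _ → refl) above))
gap-from-above plus {a} {ps} {b} {qs} 1 shP shQ ne degrees with degree-parity shQ
... | inj₁ (b≡1 , qs≡) with above-1 shP shQ (trans degrees (cong suc (degree-1 (b≡1 , qs≡)))) b≡1 qs≡
...   | inj₁ above = inj₁ (gap-above plus {a} {ps} {b} {qs} 1 degrees (λ _ → refl) above)
...   | inj₂ (a≡1 , ps≡ , qs≡′) = inj₂ (refl , a≡1 , ps≡ , b≡1 , qs≡′)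
gap-from-above plus {a} {ps} {b} {qs} 1 shP shQ ne degrees | inj₂ 2∣n with degree-parity shP
...   | inj₁ c with degree b qs | 1≤degree shQ | trans (sym (degree-1 c)) degrees
...     | suc _ | _ | ()
gap-from-above plus {a} {ps} {b} {qs} 1 shP shQ ne degrees | inj₂ 2∣n | inj₂ 2∣m =
  ⊥-elim (2∤1 (∣m+n∣m⇒∣n (subst (2 ∣_) (trans degrees (ℕ.+-comm 1 (degree b qs))) 2∣m) 2∣n))
gap-from-above plus {a} {ps} {b} {qs} k@(suc (suc _)) shP shQ ne degrees =
  inj₁ (gap-above plus {a} {ps} {b} {qs} k degrees (λ _ → refl) (above-2 k (s≤s (s≤s z≤n)) shP shQ))
gap-from-above minus {a} {ps} {b} {qs} k@(suc k′) shP shQ ne degrees with degree-parity shP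
... | inj₁ c = ⊥-elim (impossible (1≤degree shQ) (trans (sym (degree-1 c)) degrees))
  where
  impossible : ∀ {n} → 1 ℕ.≤ n → ¬ (1 ≡ suc k′ ℕ.+ n)
  impossible {suc n} _ eq rewrite ℕ.+-suc k′ n with eq
  ... | ()
... | inj₂ 2∣m with degree-parity shQ
...   | inj₁ c   = inj₁ (gap-opposite shP shQ 2∣m (2∤degree-1 c))
...   | inj₂ 2∣n = inj₁ (gap-above minus {a} {ps} {b} {qs} k degrees (λ s → neg-^-2∣ s 2∣k) (above-2⁻ k 2≤k shP shQ))
  where
  2∣k : 2 ∣ k
  2∣k = ∣m+n∣m⇒∣n (subst (2 ∣_) (trans degrees (ℕ.+-comm k (degree b qs))) 2∣m) 2∣n
  2≤k : 2 ℕ.≤ k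
  2≤k = ∣⇒≤ 2∣k

gap : ∀ σ {a ps b qs} → Shape a ps → Shape b qs → Distinct a ps b qs →
      Gap σ a ps b qs ⊎ (σ ≡ plus × (Exceptional a ps b qs ⊎ Exceptional b qs a ps))
gap σ {a} {ps} {b} {qs} shP shQ ne with ℕ.≤-total (degree b qs) (degree a ps)
... | inj₁ n≤m with gap-from-above σ (degree a ps ℕ.∸ degree b qs) shP shQ ne (sym (ℕ.m∸n+n≡m n≤m))
...   | inj₁ g         = inj₁ g
...   | inj₂ (eq , ex) = inj₂ (eq , inj₁ ex)
gap σ {a} {ps} {b} {qs} shP shQ ne | inj₂ m≤n
  with gap-from-above σ (degree b qs ℕ.∸ degree a ps) shQ shP (λ (eq , eq′) → ne (sym eq , sym eq′)) (sym (ℕ.m∸n+n≡m m≤n))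
...   | inj₁ g         = inj₁ (gap-swap σ {b} {qs} {a} {ps} g)
...   | inj₂ (eq , ex) = inj₂ (eq , inj₂ ex)

-- Multiplied by both denominators at `1 / x`, `T` at `x` becomes `scaled` times both denominators
-- at `x`. The latter have absolute value at least 1, and the former are at most a power of `1 / q`,
-- so the gap survives.
T-large : ∀ σ {a ps b qs} → Shape a ps → Shape b qs → Gap σ a ps b qs →
          ∃ λ K → ∀ {q s} → Small q → s * q ≡ 1ℚ → q ^ K ≤ ∣ ⟦ T a ps b qs ⟧ (σ · s) ∣
T-large σ {a} {ps} {b} {qs} shP shQ (K , g) with UV-bounded σ ps a | UV-bounded σ qs b
... | J , bd | J′ , bd′ = (J ℕ.+ J′) ℕ.+ K , λ {q} {s} sm sq≡1 →
  let t = ⟦ T a ps b qs ⟧ (σ · s)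
      x = σ · s
      w = σ · q
      v = ⟦ V ps a ⟧ x
      v′ = ⟦ V qs b ⟧ x
      vw = ⟦ V ps a ⟧ w
      v′w = ⟦ V qs b ⟧ w
      G = scaled σ a ps b qs s q
      1≤vv′ : 1ℚ ≤ ∣ v * v′ ∣
      1≤vv′ = subst (1ℚ ≤_) (sym (∣p*q∣≡∣p∣*∣q∣ v v′))
        (1≤ℚ* (proj₂ (UV-large ps a (1≤a shP) (asc shP) (2≤∣x∣ sm sq≡1)))
              (proj₂ (UV-large qs b (1≤a shQ) (asc shQ) (2≤∣x∣ sm sq≡1))))
      bounded : q ^ (J ℕ.+ J′) * ∣ vw * v′w ∣ ≤ 1ℚ
      bounded = subst (_≤ 1ℚ) (sym (trans (cong₂ _*_ (^-+ q J J′) (∣p*q∣≡∣p∣*∣q∣ vw v′w))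
          (solve 4 (λ a b x y → a :* b :* (x :* y) := a :* x :* (b :* y)) refl (q ^ J) (q ^ J′) ∣ vw ∣ ∣ v′w ∣)))
        (*-mono-≤ (0≤* (0≤^ (0<q sm) J) (0≤∣p∣ vw)) (0≤* (0≤^ (0<q sm) J′) (0≤∣p∣ v′w)) (proj₂ (bd sm)) (proj₂ (bd′ sm)))
  in begin
    q ^ ((J ℕ.+ J′) ℕ.+ K)                          ≡⟨ ^-+ q (J ℕ.+ J′) K ⟩
    q ^ (J ℕ.+ J′) * q ^ K                          ≤⟨ *-monoˡ (q ^ (J ℕ.+ J′)) (0≤^ (0<q sm) (J ℕ.+ J′)) (begin
        q ^ K                  ≡⟨ sym (*-identityˡ (q ^ K)) ⟩
        1ℚ * q ^ K             ≤⟨ *-mono-≤ 0≤1 (0≤^ (0<q sm) K) 1≤vv′ (g sm sq≡1) ⟩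
        ∣ v * v′ ∣ * ∣ G ∣     ≡⟨ sym (∣p*q∣≡∣p∣*∣q∣ (v * v′) G) ⟩
        ∣ v * v′ * G ∣         ≡⟨ cong ∣_∣ (sym (reflected (·-inverse σ sq≡1))) ⟩
        ∣ t * (vw * v′w) ∣     ≡⟨ ∣p*q∣≡∣p∣*∣q∣ t (vw * v′w) ⟩
        ∣ t ∣ * ∣ vw * v′w ∣   ∎) ⟩
    q ^ (J ℕ.+ J′) * (∣ t ∣ * ∣ vw * v′w ∣)         ≡⟨ solve 3 (λ a b c → a :* (b :* c) := b :* (a :* c)) refl (q ^ (J ℕ.+ J′)) ∣ t ∣ ∣ vw * v′w ∣ ⟩
    ∣ t ∣ * (q ^ (J ℕ.+ J′) * ∣ vw * v′w ∣)         ≤⟨ *-monoˡ ∣ t ∣ (0≤∣p∣ t) bounded ⟩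
    ∣ t ∣ * 1ℚ                                      ≡⟨ *-identityʳ ∣ t ∣ ⟩
    ∣ t ∣                                           ∎
  where
  open ≤-Reasoning
  2≤∣x∣ : ∀ {q s} → Small q → s * q ≡ 1ℚ → 1ℚ + 1ℚ ≤ ∣ σ · s ∣
  2≤∣x∣ sm sq≡1 = subst (1ℚ + 1ℚ ≤_) (sym (∣σ·s∣ σ sm sq≡1)) (2≤inverse sm sq≡1)

  -- The sign in `W` is the sign of the functional equation, so only the squares of signs are left.
  combine : ∀ e e′ u v u′ v′ uw vw u′w v′w X Y → e * e ≡ 1ℚ → e′ * e′ ≡ 1ℚ →
            u * vw ≡ e * X * (uw * v) → u′ * v′w ≡ e′ * Y * (u′w * v′) →
            (e * (u * v′) - e′ * (u′ * v)) * (vw * v′w) ≡ v * v′ * (X * (uw * v′w) - Y * (u′w * vw))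
  combine e e′ u v u′ v′ uw vw u′w v′w X Y e² e′² eq eq′ = trans
    (solve 8 (λ e e′ u v u′ v′ vw v′w → (e :* (u :* v′) :- e′ :* (u′ :* v)) :* (vw :* v′w) :=
       e :* (u :* vw) :* (v′ :* v′w) :- e′ :* (u′ :* v′w) :* (v :* vw)) refl e e′ u v u′ v′ vw v′w)
    (trans (cong₂ (λ y z → e * y * (v′ * v′w) - e′ * z * (v * vw)) eq eq′)
    (trans (solve 10 (λ e e′ v v′ uw vw u′w v′w X Y →
              e :* (e :* X :* (uw :* v)) :* (v′ :* v′w) :- e′ :* (e′ :* Y :* (u′w :* v′)) :* (v :* vw) :=
              e :* e :* (v :* v′ :* (X :* (uw :* v′w))) :- e′ :* e′ :* (v :* v′ :* (Y :* (u′w :* vw))))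
             refl e e′ v v′ uw vw u′w v′w X Y)
    (trans (cong₂ (λ y z → y * (v * v′ * (X * (uw * v′w))) - z * (v * v′ * (Y * (u′w * vw)))) e² e′²)
      (solve 3 (λ z x y → con 1ℚ :* (z :* x) :- con 1ℚ :* (z :* y) := z :* (x :- y)) refl (v * v′) (X * (uw * v′w)) (Y * (u′w * vw))))))

  reflected : ∀ {x w} → x * w ≡ 1ℚ → ⟦ T a ps b qs ⟧ x * (⟦ V ps a ⟧ w * ⟦ V qs b ⟧ w) ≡
    ⟦ V ps a ⟧ x * ⟦ V qs b ⟧ x * (x ^ degree a ps * (⟦ U ps a ⟧ w * ⟦ V qs b ⟧ w) - x ^ degree b qs * (⟦ U qs b ⟧ w * ⟦ V ps a ⟧ w))
  reflected {x} {w} xw≡1 rewrite T-eval a ps b qs x =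
    combine (sign ps) (sign qs) (⟦ U ps a ⟧ x) (⟦ V ps a ⟧ x) (⟦ U qs b ⟧ x) (⟦ V qs b ⟧ x)
      (⟦ U ps a ⟧ w) (⟦ V ps a ⟧ w) (⟦ U qs b ⟧ w) (⟦ V qs b ⟧ w) (x ^ degree a ps) (x ^ degree b qs)
      (sign² ps) (sign² qs)
      (functional-equation ps a (asc shP) {x} {w} xw≡1) (functional-equation qs b (asc shQ) {x} {w} xw≡1)

-- From rational estimates to real roots

2ℚ : ℚ
2ℚ = 1ℚ + 1ℚ

½≤1 : ½ ≤ 1ℚ
½≤1 = ≤ᵇ⇒≤ _

½≤2 : ½ ≤ 2ℚ
½≤2 = ≤ᵇ⇒≤ _

2≤3 : 2ℚ ≤ 1ℚ + 2ℚ
2≤3 = ≤ᵇ⇒≤ _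

0<2 : 0ℚ < 2ℚ
0<2 = positive⁻¹ 2ℚ

-- The radius 3 leaves distance 1 around all points up to 2 in absolute value. `sup` is carried
-- along for the product rule.
record Lipschitz (f : ℚ → ℚ) : Set where
  field
    {sup rate} : ℚ
    0≤sup : 0ℚ ≤ sup
    0≤rate : 0ℚ ≤ rate
    ∣f∣≤sup   : ∀ p → ∣ p ∣ ≤ 1ℚ + 2ℚ → ∣ f p ∣ ≤ sup
    ∣Δf∣≤rate : ∀ p q → ∣ p ∣ ≤ 1ℚ + 2ℚ → ∣ q ∣ ≤ 1ℚ + 2ℚ → ∣ f p - f q ∣ ≤ rate * ∣ p - q ∣

open Lipschitz

lip-1 : Lipschitz (λ _ → 1ℚ)
lip-1 = record
  { sup = 1ℚ ; rate = 0ℚ ; 0≤sup = 0≤1 ; 0≤rate = ≤-refl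
  ; ∣f∣≤sup = λ _ _ → ≤-refl ; ∣Δf∣≤rate = λ p q _ _ → ≤-reflexive (sym (*-zeroˡ ∣ p - q ∣)) }

lip-id : Lipschitz (λ q → q)
lip-id = record
  { sup = 1ℚ + 2ℚ ; rate = 1ℚ ; 0≤sup = nonNegative⁻¹ (1ℚ + 2ℚ) ; 0≤rate = 0≤1
  ; ∣f∣≤sup = λ _ b → b ; ∣Δf∣≤rate = λ p q _ _ → ≤-reflexive (sym (*-identityˡ ∣ p - q ∣)) }

lip-+ : ∀ {f g} → Lipschitz f → Lipschitz g → Lipschitz (λ q → f q + g q)
lip-+ {f} {g} F G = record
  { sup = sup F + sup G ; rate = rate F + rate G
  ; 0≤sup = 0≤+ (0≤sup F) (0≤sup G) ; 0≤rate = 0≤+ (0≤rate F) (0≤rate G)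
  ; ∣f∣≤sup = λ p b → ≤-trans (∣p+q∣≤∣p∣+∣q∣ (f p) (g p)) (+-mono-≤ (∣f∣≤sup F p b) (∣f∣≤sup G p b))
  ; ∣Δf∣≤rate = λ p q bp bq → subst₂ _≤_
      (cong ∣_∣ (solve 4 (λ a b c d → (a :- b) :+ (c :- d) := (a :+ c) :- (b :+ d)) refl (f p) (f q) (g p) (g q)))
      (sym (*-distribʳ-+ ∣ p - q ∣ (rate F) (rate G)))
      (≤-trans (∣p+q∣≤∣p∣+∣q∣ (f p - f q) (g p - g q)) (+-mono-≤ (∣Δf∣≤rate F p q bp bq) (∣Δf∣≤rate G p q bp bq)))
  }

lip-neg : ∀ {f} → Lipschitz f → Lipschitz (λ q → - f q)
lip-neg {f} F = record
  { 0≤sup = 0≤sup F ; 0≤rate = 0≤rate F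
  ; ∣f∣≤sup = λ p b → subst (_≤ sup F) (sym (∣-p∣≡∣p∣ (f p))) (∣f∣≤sup F p b)
  ; ∣Δf∣≤rate = λ p q bp bq → subst (_≤ rate F * ∣ p - q ∣)
      (trans (∣p-q∣≡∣q-p∣ (f p) (f q)) (cong ∣_∣ (solve 2 (λ a b → b :- a := :- a :- (:- b)) refl (f p) (f q))))
      (∣Δf∣≤rate F p q bp bq)
  }

lip-* : ∀ {f g} → Lipschitz f → Lipschitz g → Lipschitz (λ q → f q * g q)
lip-* {f} {g} F G = record
  { sup = sup F * sup G ; rate = sup F * rate G + sup G * rate F
  ; 0≤sup = 0≤* (0≤sup F) (0≤sup G)
  ; 0≤rate = 0≤+ (0≤* (0≤sup F) (0≤rate G)) (0≤* (0≤sup G) (0≤rate F))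
  ; ∣f∣≤sup = λ p b → subst (_≤ sup F * sup G) (sym (∣p*q∣≡∣p∣*∣q∣ (f p) (g p)))
      (*-mono-≤ (0≤∣p∣ (f p)) (0≤∣p∣ (g p)) (∣f∣≤sup F p b) (∣f∣≤sup G p b))
  ; ∣Δf∣≤rate = λ p q bp bq → begin
      ∣ f p * g p - f q * g q ∣
        ≡⟨ cong ∣_∣ (solve 4 (λ a b c d → a :* c :- b :* d := a :* (c :- d) :+ d :* (a :- b)) refl (f p) (f q) (g p) (g q)) ⟩
      ∣ f p * (g p - g q) + g q * (f p - f q) ∣
        ≤⟨ ∣p+q∣≤∣p∣+∣q∣ (f p * (g p - g q)) (g q * (f p - f q)) ⟩
      ∣ f p * (g p - g q) ∣ + ∣ g q * (f p - f q) ∣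
        ≡⟨ cong₂ _+_ (∣p*q∣≡∣p∣*∣q∣ (f p) (g p - g q)) (∣p*q∣≡∣p∣*∣q∣ (g q) (f p - f q)) ⟩
      ∣ f p ∣ * ∣ g p - g q ∣ + ∣ g q ∣ * ∣ f p - f q ∣
        ≤⟨ +-mono-≤ (*-mono-≤ (0≤∣p∣ (f p)) (0≤∣p∣ (g p - g q)) (∣f∣≤sup F p bp) (∣Δf∣≤rate G p q bp bq))
                    (*-mono-≤ (0≤∣p∣ (g q)) (0≤∣p∣ (f p - f q)) (∣f∣≤sup G q bq) (∣Δf∣≤rate F p q bp bq)) ⟩
      sup F * (rate G * ∣ p - q ∣) + sup G * (rate F * ∣ p - q ∣)
        ≡⟨ solve 5 (λ a b c d e → a :* (b :* e) :+ c :* (d :* e) := (a :* b :+ c :* d) :* e) refl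
             (sup F) (rate G) (sup G) (rate F) ∣ p - q ∣ ⟩
      (sup F * rate G + sup G * rate F) * ∣ p - q ∣  ∎
  }
  where open ≤-Reasoning

lip-poly : ∀ e → Lipschitz ⟦ e ⟧
lip-poly (X^ zero)  = lip-1
lip-poly (X^ suc n) = lip-* lip-id (lip-poly (X^ n))
lip-poly (e ⊕ f)    = lip-+ (lip-poly e) (lip-poly f)
lip-poly (e ⊖ f)    = lip-+ (lip-poly e) (lip-neg (lip-poly f))
lip-poly (e ⊗ f)    = lip-* (lip-poly e) (lip-poly f)

p≤p+q : ∀ p {q} → 0ℚ ≤ q → p ≤ p + q
p≤p+q p {q} 0≤q = ≤-by q 0≤q refl

p≤q+p : ∀ p {q} → 0ℚ ≤ q → p ≤ q + p
p≤q+p p {q} 0≤q = ≤-by q 0≤q (+-comm q p)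

inverse : ∀ {p} → 0ℚ < p → ∃ λ r → 0ℚ < r × p * r ≡ 1ℚ
inverse {p} 0<p = 1/ p , positive⁻¹ (1/ p) {{1/pos⇒pos p}} , *-inverseʳ p
  where instance
    _ = positive 0<p
    _ = pos⇒nonZero p

0<½ : 0ℚ < ½
0<½ = positive⁻¹ ½

halves : ∀ c → c * ½ + c * ½ ≡ c
halves c = trans (sym (*-distribˡ-+ c ½ ½)) (*-identityʳ c)

stays-away : ∀ e ρ {c} → 0ℚ < c → ∣ ρ ∣ ≤ 2ℚ → c ≤ ∣ ⟦ e ⟧ ρ ∣ →
             ∃ λ δ → 0ℚ < δ × δ ≤ ½ × (∀ q → ∣ q - ρ ∣ ≤ δ → c * ½ ≤ ∣ ⟦ e ⟧ q ∣)
stays-away e ρ {c} 0<c ρ≤2 c≤ with inverse {rate (lip-poly e) + c} (+-mono-≤-< (0≤rate (lip-poly e)) 0<c)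
... | r , 0<r , Lr≡1 = δ , 0<* (0<* 0<c 0<½) 0<r , δ≤½ , away
  where
  F = lip-poly e
  -- Adding `c` makes the divisor positive even for rate 0 and gives `δ = c / (2 L) ≤ ½`.
  L = rate F + c
  δ = c * ½ * r
  Lδ : L * δ ≡ c * ½
  Lδ = trans (solve 3 (λ L c r → L :* (c :* r) := L :* r :* c) refl L (c * ½) r)
         (trans (cong (_* (c * ½)) Lr≡1) (*-identityˡ (c * ½)))
  δ≤½ : δ ≤ ½
  δ≤½ = cancel-≤ L (+-mono-≤-< (0≤rate F) 0<c) (subst (_≤ L * ½) (sym Lδ)
    (*-monoʳ-≤-nonNeg ½ (p≤q+p c (0≤rate F))))
  away : ∀ q → ∣ q - ρ ∣ ≤ δ → c * ½ ≤ ∣ ⟦ e ⟧ q ∣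
  away q near = begin
    c * ½                        ≡⟨ solve 2 (λ c h → h := c :- (c :- h)) refl c (c * ½) ⟩
    c - (c - c * ½)              ≡⟨ cong (λ y → c - y) (trans (cong (_- c * ½) (sym (halves c))) (solve 1 (λ h → h :+ h :- h := h) refl (c * ½))) ⟩
    c - c * ½                    ≤⟨ +-mono-≤ c≤ (neg-antimono-≤ close) ⟩
    ∣ ⟦ e ⟧ ρ ∣ - ∣ ⟦ e ⟧ q - ⟦ e ⟧ ρ ∣
      ≤⟨ ≤-by (∣ ⟦ e ⟧ q ∣ + ∣ ⟦ e ⟧ q - ⟦ e ⟧ ρ ∣ - ∣ ⟦ e ⟧ ρ ∣) (0≤q-p triangle)
           (solve 3 (λ a b d → b := a :- d :+ (b :+ d :- a)) refl (∣ ⟦ e ⟧ ρ ∣) (∣ ⟦ e ⟧ q ∣) (∣ ⟦ e ⟧ q - ⟦ e ⟧ ρ ∣)) ⟩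
    ∣ ⟦ e ⟧ q ∣                  ∎
    where
    open ≤-Reasoning
    q≤3 : ∣ q ∣ ≤ 1ℚ + 2ℚ
    q≤3 = begin
      ∣ q ∣                  ≡⟨ cong ∣_∣ (solve 2 (λ q ρ → q := q :- ρ :+ ρ) refl q ρ) ⟩
      ∣ q - ρ + ρ ∣          ≤⟨ ∣p+q∣≤∣p∣+∣q∣ (q - ρ) ρ ⟩
      ∣ q - ρ ∣ + ∣ ρ ∣      ≤⟨ +-mono-≤ {∣ q - ρ ∣} {1ℚ} {∣ ρ ∣} {2ℚ} (≤-trans near (≤-trans δ≤½ ½≤1)) ρ≤2 ⟩
      1ℚ + 2ℚ                ∎
    close : ∣ ⟦ e ⟧ q - ⟦ e ⟧ ρ ∣ ≤ c * ½
    close = begin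
      ∣ ⟦ e ⟧ q - ⟦ e ⟧ ρ ∣  ≤⟨ ∣Δf∣≤rate F q ρ q≤3 (≤-trans ρ≤2 2≤3) ⟩
      rate F * ∣ q - ρ ∣    ≤⟨ *-monoˡ (rate F) (0≤rate F) near ⟩
      rate F * δ            ≤⟨ *-monoʳ-≤-nonNeg δ {{nonNegative (<⇒≤ (0<* (0<* 0<c 0<½) 0<r))}}
                                  (p≤p+q (rate F) (<⇒≤ 0<c)) ⟩
      L * δ                  ≡⟨ Lδ ⟩
      c * ½                  ∎
    triangle : ∣ ⟦ e ⟧ ρ ∣ ≤ ∣ ⟦ e ⟧ q ∣ + ∣ ⟦ e ⟧ q - ⟦ e ⟧ ρ ∣
    triangle = subst (_≤ ∣ ⟦ e ⟧ q ∣ + ∣ ⟦ e ⟧ q - ⟦ e ⟧ ρ ∣)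
      (cong ∣_∣ (solve 2 (λ q ρ → q :- (q :- ρ) := ρ) refl (⟦ e ⟧ q) (⟦ e ⟧ ρ)))
      (∣p-q∣≤∣p∣+∣q∣ (⟦ e ⟧ q) (⟦ e ⟧ q - ⟦ e ⟧ ρ))

NonzeroSmall NonzeroLarge : Sign → Poly → Set
NonzeroSmall σ e = Pos (λ q → ∣ ⟦ e ⟧ (σ · q) ∣)
NonzeroLarge σ e = ∃ λ K → ∀ {q s} → Small q → s * q ≡ 1ℚ → q ^ K ≤ ∣ ⟦ e ⟧ (σ · s) ∣

∣σ·p-σ·q∣ : ∀ σ p q → ∣ σ · p - σ · q ∣ ≡ ∣ p - q ∣
∣σ·p-σ·q∣ plus  p q = refl
∣σ·p-σ·q∣ minus p q = trans (cong ∣_∣ (solve 2 (λ p q → :- p :- (:- q) := :- (p :- q)) refl p q)) (∣-p∣≡∣p∣ (p - q))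

∣-∣≤ : ∀ {p q δ} → p ≤ q + δ → q ≤ p + δ → ∣ p - q ∣ ≤ δ
∣-∣≤ {p} {q} {δ} p≤ q≤ with ∣p∣≡p∨∣p∣≡-p (p - q)
... | inj₁ eq = subst (_≤ δ) (sym eq) (≤-by (q + δ - p) (0≤q-p p≤) (solve 3 (λ p q δ → δ := p :- q :+ (q :+ δ :- p)) refl p q δ))
... | inj₂ eq = subst (_≤ δ) (sym eq) (≤-by (p + δ - q) (0≤q-p q≤) (solve 3 (λ p q δ → δ := :- (p :- q) :+ (p :+ δ :- q)) refl p q δ))

small-½ : Small ½
small-½ = small 0<½ ≤-refl

½^K*½-bd : ∀ K → 0ℚ < ½ ^ K * ½ × ½ ^ K * ½ ≤ 1ℚ
½^K*½-bd K = 0<* (0<^ 0<½ K) 0<½ , *-mono-≤ {½ ^ K} {1ℚ} {½} {1ℚ} (0≤^ 0<½ K) 0≤½ (proj₂ (^-≤1 0≤½ ½≤1 K)) ½≤1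

-- Just beyond ½ the value at `± ½` persists by continuity. The factor `t^K` has to stay because `T`
-- may vanish at 0.
past-½ : ∀ σ e → NonzeroSmall σ e → ∃ λ K → ∃ λ c → ∃ λ δ → 0ℚ < c × 0ℚ < δ ×
         (∀ t → 0ℚ < t → t ≤ ½ + δ → c * t ^ K ≤ ∣ ⟦ e ⟧ (σ · t) ∣)
past-½ σ e (K , e≥) = extend (stays-away e (σ · ½) {½ ^ K} (0<^ 0<½ K) (subst (_≤ 2ℚ) (sym (∣·∣ σ ½)) ½≤2) (e≥ ½ small-½))
  where
  c = ½ ^ K * ½
  0<c = proj₁ (½^K*½-bd K)
  c≤1 = proj₂ (½^K*½-bd K)
  extend : (∃ λ δ → 0ℚ < δ × δ ≤ ½ × (∀ q → ∣ q - σ · ½ ∣ ≤ δ → c ≤ ∣ ⟦ e ⟧ q ∣)) →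
           ∃ λ K → ∃ λ c → ∃ λ δ → 0ℚ < c × 0ℚ < δ ×
             (∀ t → 0ℚ < t → t ≤ ½ + δ → c * t ^ K ≤ ∣ ⟦ e ⟧ (σ · t) ∣)
  extend (δ , 0<δ , δ≤½ , away) = K , c , δ , 0<c , 0<δ , extended
    where
    extended : ∀ t → 0ℚ < t → t ≤ ½ + δ → c * t ^ K ≤ ∣ ⟦ e ⟧ (σ · t) ∣
    extended t 0<t t≤ with ≤-total t ½
    ... | inj₁ t≤½ = ≤-trans (subst (c * t ^ K ≤_) (*-identityˡ (t ^ K))
            (*-monoʳ-≤-nonNeg (t ^ K) {{nonNegative (0≤^ 0<t K)}} c≤1)) (e≥ t (small 0<t t≤½))
    ... | inj₂ ½≤t = ≤-trans (subst (c * t ^ K ≤_) (*-identityʳ c) (*-monoˡ c (<⇒≤ 0<c)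
              (proj₂ (^-≤1 (<⇒≤ 0<t) (≤-trans t≤ (+-monoʳ-≤ ½ δ≤½)) K))))
            (away (σ · t) (subst (_≤ δ) (sym (∣σ·p-σ·q∣ σ t ½))
              (∣-∣≤ t≤ (≤-trans ½≤t (p≤p+q t (<⇒≤ 0<δ))))))

^-mono-≤ : ∀ {x y} → 0ℚ ≤ x → x ≤ y → ∀ n → x ^ n ≤ y ^ n
^-mono-≤         0≤x x≤y zero    = ≤-refl
^-mono-≤ {x} {y} 0≤x x≤y (suc n) = *-mono-≤ 0≤x (nonneg n) x≤y (^-mono-≤ 0≤x x≤y n)
  where
  nonneg : ∀ n → 0ℚ ≤ x ^ n
  nonneg zero    = 0≤1
  nonneg (suc n) = 0≤* 0≤x (nonneg n)

-- The gap at `t = 1 / q` decays like `1 / t^K`, so a uniform `c` requires the bound `B`; `c` is the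
-- product of `1 / B^K` and half the gap at 2.
past-2 : ∀ σ e B → 2ℚ ≤ B → NonzeroLarge σ e → ∃ λ c → ∃ λ δ → 0ℚ < c × 0ℚ < δ ×
         (∀ t → 2ℚ - δ ≤ t → t ≤ B → c ≤ ∣ ⟦ e ⟧ (σ · t) ∣)
past-2 σ e B 2≤B (K , e≥) = extend (stays-away e (σ · 2ℚ) {½ ^ K} (0<^ 0<½ K)
    (subst (_≤ 2ℚ) (sym (∣·∣ σ 2ℚ)) ≤-refl) (e≥ {½} {2ℚ} small-½ refl)) (inverse {B} 0<B)
  where
  0<B = <-≤-trans 0<2 2≤B
  c₁ = ½ ^ K * ½
  0<c₁ = proj₁ (½^K*½-bd K)
  c₁≤1 = proj₂ (½^K*½-bd K)
  extend : (∃ λ δ → 0ℚ < δ × δ ≤ ½ × (∀ q → ∣ q - σ · 2ℚ ∣ ≤ δ → c₁ ≤ ∣ ⟦ e ⟧ q ∣)) →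
           (∃ λ b → 0ℚ < b × B * b ≡ 1ℚ) →
           ∃ λ c → ∃ λ δ → 0ℚ < c × 0ℚ < δ × (∀ t → 2ℚ - δ ≤ t → t ≤ B → c ≤ ∣ ⟦ e ⟧ (σ · t) ∣)
  extend (δ , 0<δ , _ , away) (b , 0<b , Bb≡1) = c , δ , 0<* 0<c₁ (0<^ 0<b K) , 0<δ , extended
    where
    c = c₁ * b ^ K
    b≤1 : b ≤ 1ℚ
    b≤1 = cancel-≤ B 0<B (subst₂ _≤_ (sym Bb≡1) (sym (*-identityʳ B)) (2≤⇒1≤ 2≤B))

    beyond : ∀ t q → 2ℚ ≤ t → t ≤ B → 0ℚ < q → t * q ≡ 1ℚ → b ^ K ≤ ∣ ⟦ e ⟧ (σ · t) ∣
    beyond t q 2≤t t≤B 0<q tq≡1 = ≤-trans (^-mono-≤ (<⇒≤ 0<b) b≤q K) (e≥ (small 0<q q≤half) tq≡1)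
      where
      q≤half : q ≤ ½
      q≤half = cancel-≤ {q} {½} 2ℚ 0<2 (subst (2ℚ * q ≤_) tq≡1 (*-monoʳ-≤-nonNeg q {{nonNegative (<⇒≤ 0<q)}} 2≤t))
      b≤q : b ≤ q
      b≤q = cancel-≤ t (<-≤-trans 0<2 2≤t) (subst (t * b ≤_) (trans Bb≡1 (sym tq≡1))
              (*-monoʳ-≤-nonNeg b {{nonNegative (<⇒≤ 0<b)}} t≤B))

    add-back : ∀ z t → z - δ ≤ t → z ≤ t + δ
    add-back z t z-δ≤t = ≤-by (t - (z - δ)) (0≤q-p z-δ≤t) (solve 3 (λ t δ z → t :+ δ := z :+ (t :- (z :- δ))) refl t δ z)

    extended : ∀ t → 2ℚ - δ ≤ t → t ≤ B → c ≤ ∣ ⟦ e ⟧ (σ · t) ∣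
    extended t 2-δ≤t t≤B with ≤-total t 2ℚ
    ... | inj₁ t≤2 = ≤-trans (subst (c ≤_) (*-identityʳ c₁) (*-monoˡ c₁ (<⇒≤ 0<c₁) (proj₂ (^-≤1 (<⇒≤ 0<b) b≤1 K))))
            (away (σ · t) (subst (_≤ δ) (sym (∣σ·p-σ·q∣ σ t 2ℚ))
              (∣-∣≤ {t} {2ℚ} (≤-trans t≤2 (p≤p+q 2ℚ (<⇒≤ 0<δ))) (add-back 2ℚ t 2-δ≤t))))
    ... | inj₂ 2≤t = ≤-trans (subst (c ≤_) (*-identityˡ (b ^ K)) (*-monoʳ-≤-nonNeg (b ^ K) {{nonNegative (0≤^ 0<b K)}} c₁≤1))
            (let q , 0<q , tq≡1 = inverse {t} (<-≤-trans 0<2 2≤t) in beyond t q 2≤t t≤B 0<q tq≡1)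

signed : ∀ q → ∃ λ σ → q ≡ σ · ∣ q ∣
signed q with ∣p∣≡p∨∣p∣≡-p q
... | inj₁ eq = plus , sym eq
... | inj₂ eq = minus , sym (trans (cong -_ eq) (solve 1 (λ q → :- (:- q) := q) refl q))

Null : (ℕ → ℚ) → Set
Null s = ∀ ε → 0ℚ < ε → ∃ λ N → ∀ i → N ℕ.≤ i → ∣ s i ∣ < ε

Eventually : (ℕ → Set) → Set
Eventually P = ∃ λ N → ∀ i → N ℕ.≤ i → P i

private
  quarter : ∀ {δ} → 0ℚ < δ → ∃ λ η → 0ℚ < η × (η + η) + (η + η) ≡ δ
  quarter {δ} 0<δ = δ * ½ * ½ , 0<* (0<* 0<δ 0<½) 0<½ , trans (cong₂ _+_ (halves (δ * ½)) (halves (δ * ½))) (halves δ)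

module _ (y : ℝ) (r η : ℚ) (0<η : 0ℚ < η) where
  open ≤-Reasoning

  -- Replaces the undecidable `r < y`. Late terms are within `η` of `seq y N`, so comparing this one
  -- rational with `r + 2η` leaves either the strict gap `η` or the bound `r + 4η`.
  above-or-near′ : (fromℚ r <ᴿ y) ⊎ Eventually (λ i → seq y i ≤ r + ((η + η) + (η + η)))
  above-or-near′ = decide (cauchy y η 0<η)
    where
    decide : (∃ λ N → ∀ i j → N ℕ.≤ i → N ℕ.≤ j → ∣ seq y i - seq y j ∣ < η) → _
    decide (N , close) with ≤-total (seq y N) (r + (η + η))
    ... | inj₁ ≤r+ = inj₂ (N , λ i i≥ → begin
      seq y i                           ≡⟨ solve 2 (λ a b → a := b :+ (a :- b)) refl (seq y i) (seq y N) ⟩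
      seq y N + (seq y i - seq y N)     ≤⟨ +-mono-≤ ≤r+ (≤-trans (p≤∣p∣ (seq y i - seq y N)) (<⇒≤ (close i N i≥ ℕ.≤-refl))) ⟩
      r + (η + η) + η                   ≤⟨ p≤p+q (r + (η + η) + η) (<⇒≤ 0<η) ⟩
      r + (η + η) + η + η               ≡⟨ solve 2 (λ r η → r :+ (η :+ η) :+ η :+ η := r :+ ((η :+ η) :+ (η :+ η))) refl r η ⟩
      r + ((η + η) + (η + η))           ∎)
    ... | inj₂ ≥r+ = inj₁ (η , 0<η , N , λ i i≥ → begin-strict
      r + η                             ≡⟨ solve 2 (λ r η → r :+ η := r :+ (η :+ η) :- η) refl r η ⟩
      r + (η + η) - η                   <⟨ +-mono-≤-< ≥r+ (neg-antimono-< (close N i ℕ.≤-refl i≥)) ⟩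
      seq y N - ∣ seq y N - seq y i ∣   ≤⟨ +-monoʳ-≤ (seq y N) (neg-antimono-≤ (p≤∣p∣ (seq y N - seq y i))) ⟩
      seq y N - (seq y N - seq y i)     ≡⟨ solve 2 (λ a b → a :- (a :- b) := b) refl (seq y N) (seq y i) ⟩
      seq y i                           ∎)

  below-or-near′ : (y <ᴿ fromℚ r) ⊎ Eventually (λ i → r - ((η + η) + (η + η)) ≤ seq y i)
  below-or-near′ = decide (cauchy y η 0<η)
    where
    decide : (∃ λ N → ∀ i j → N ℕ.≤ i → N ℕ.≤ j → ∣ seq y i - seq y j ∣ < η) → _
    decide (N , close) with ≤-total (r - (η + η)) (seq y N)
    ... | inj₁ ≥r- = inj₂ (N , λ i i≥ → begin
      r - ((η + η) + (η + η))           ≤⟨ p≤p+q (r - ((η + η) + (η + η))) (<⇒≤ 0<η) ⟩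
      r - ((η + η) + (η + η)) + η       ≡⟨ solve 2 (λ r η → r :- ((η :+ η) :+ (η :+ η)) :+ η := r :- (η :+ η) :- η) refl r η ⟩
      r - (η + η) - η                   ≤⟨ +-mono-≤ ≥r- (neg-antimono-≤ (<⇒≤ (close N i ℕ.≤-refl i≥))) ⟩
      seq y N - ∣ seq y N - seq y i ∣   ≤⟨ +-monoʳ-≤ (seq y N) (neg-antimono-≤ (p≤∣p∣ (seq y N - seq y i))) ⟩
      seq y N - (seq y N - seq y i)     ≡⟨ solve 2 (λ a b → a :- (a :- b) := b) refl (seq y N) (seq y i) ⟩
      seq y i                           ∎)
    ... | inj₂ ≤r- = inj₁ (η , 0<η , N , λ i i≥ → begin-strict
      seq y i + η                           ≡⟨ solve 3 (λ a b η → a :+ η := b :+ (a :- b) :+ η) refl (seq y i) (seq y N) η ⟩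
      seq y N + (seq y i - seq y N) + η
        <⟨ +-monoˡ-< η (+-mono-≤-< ≤r- (≤-<-trans (p≤∣p∣ (seq y i - seq y N)) (close i N i≥ ℕ.≤-refl))) ⟩
      r - (η + η) + η + η                   ≡⟨ solve 2 (λ r η → r :- (η :+ η) :+ η :+ η := r) refl r η ⟩
      r                                     ∎)

above-or-near : ∀ y r {δ} → 0ℚ < δ → (fromℚ r <ᴿ y) ⊎ Eventually (λ i → seq y i ≤ r + δ)
above-or-near y r 0<δ with quarter 0<δ
... | η , 0<η , refl = above-or-near′ y r η 0<η

below-or-near : ∀ y r {δ} → 0ℚ < δ → (y <ᴿ fromℚ r) ⊎ Eventually (λ i → r - δ ≤ seq y i)
below-or-near y r 0<δ with quarter 0<δ
... | η , 0<η , refl = below-or-near′ y r η 0<η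

eventually-bounded : ∀ x → ∃ λ B → 0ℚ < B × Eventually (λ i → ∣ seq x i ∣ ≤ B)
eventually-bounded x with cauchy x 1ℚ (positive⁻¹ 1ℚ)
... | N , close = ∣ seq x N ∣ + 1ℚ , +-mono-≤-< (0≤∣p∣ (seq x N)) (positive⁻¹ 1ℚ) , N , λ i i≥ → begin
    ∣ seq x i ∣                                 ≡⟨ cong ∣_∣ (solve 2 (λ a b → a := b :+ (a :- b)) refl (seq x i) (seq x N)) ⟩
    ∣ seq x N + (seq x i - seq x N) ∣           ≤⟨ ∣p+q∣≤∣p∣+∣q∣ (seq x N) (seq x i - seq x N) ⟩
    ∣ seq x N ∣ + ∣ seq x i - seq x N ∣         ≤⟨ +-monoʳ-≤ ∣ seq x N ∣ (<⇒≤ (close i N i≥ ℕ.≤-refl)) ⟩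
    ∣ seq x N ∣ + 1ℚ                            ∎
  where open ≤-Reasoning

module _ (e : Poly) (x : ℝ) (null : Null (λ i → ⟦ e ⟧ (seq x i))) where

  module _ {σ K c δ r} (0<c : 0ℚ < c) (e≥ : ∀ t → 0ℚ < t → t ≤ r + δ → c * t ^ K ≤ ∣ ⟦ e ⟧ (σ · t) ∣) where

    forced-small : Eventually (λ i → ∣ seq x i ∣ ≤ r + δ) → ∀ ε → 0ℚ < ε →
                   Eventually (λ i → seq x i ≡ σ · ∣ seq x i ∣ → ∣ seq x i ∣ < ε)
    forced-small (N , near) ε 0<ε with null (c * ε ^ K) (0<* 0<c (0<^ 0<ε K))
    ... | M , small-e = N ℕ.⊔ M , λ i i≥ → bounded-by i (ℕ.m⊔n≤o⇒m≤o N M i≥) (ℕ.m⊔n≤o⇒n≤o N M i≥)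
      where
      bounded-by : ∀ i → N ℕ.≤ i → M ℕ.≤ i → seq x i ≡ σ · ∣ seq x i ∣ → ∣ seq x i ∣ < ε
      bounded-by i n m eq with ∣ seq x i ∣ <? ε
      ... | yes <ε = <ε
      ... | no ≮ε = ⊥-elim (<-irrefl refl (<-≤-trans (small-e i m) (≤-trans
              (*-monoˡ c (<⇒≤ 0<c) (^-mono-≤ (<⇒≤ 0<ε) (≮⇒≥ ≮ε) K))
              (subst (λ y → c * ∣ seq x i ∣ ^ K ≤ ∣ ⟦ e ⟧ y ∣) (sym eq)
                (e≥ ∣ seq x i ∣ (<-≤-trans 0<ε (≮⇒≥ ≮ε)) (near i n))))))

  -- The sign is a condition on each index separately, because a sequence close to 0 need not settle
  -- on a sign.
  SmallWhen : Sign → Set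
  SmallWhen σ = ∀ ε → 0ℚ < ε → Eventually (λ i → seq x i ≡ σ · ∣ seq x i ∣ → ∣ seq x i ∣ < ε)

  both-small : SmallWhen plus → SmallWhen minus → x ≃ᴿ 0ᴿ
  both-small s⁺ s⁻ ε 0<ε with s⁺ ε 0<ε | s⁻ ε 0<ε
  ... | N , plus-small | N′ , minus-small = N ℕ.⊔ N′ , λ i i≥ →
    subst (λ y → ∣ y ∣ < ε) (sym (+-identityʳ (seq x i)))
      (by-sign i (ℕ.m⊔n≤o⇒m≤o N N′ i≥) (ℕ.m⊔n≤o⇒n≤o N N′ i≥))
    where
    by-sign : ∀ i → N ℕ.≤ i → N′ ℕ.≤ i → ∣ seq x i ∣ < ε
    by-sign i n n′ with signed (seq x i)
    ... | plus  , eq = plus-small i n eq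
    ... | minus , eq = minus-small i n′ eq

  beyond-½-or-small : ∀ σ → NonzeroSmall σ e → (½ᴿ <ᴿ ∣ x ∣ᴿ) ⊎ SmallWhen σ
  beyond-½-or-small σ nz =
    let K , c , δ , 0<c , 0<δ , e≥ = past-½ σ e nz
    in [ inj₁ , (λ near → inj₂ (forced-small {σ} {K} {c} {δ} {½} 0<c e≥ near)) ]′ (above-or-near ∣ x ∣ᴿ ½ 0<δ)

  beyond-½ : (∀ σ → NonzeroSmall σ e) → ¬ (x ≃ᴿ 0ᴿ) → ½ᴿ <ᴿ ∣ x ∣ᴿ
  beyond-½ nz x≄0 = [ (λ ½<x → ½<x) , (λ s⁺ → [ (λ ½<x → ½<x) , (λ s⁻ → ⊥-elim (x≄0 (both-small s⁺ s⁻))) ]′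
    (beyond-½-or-small minus (nz minus))) ]′ (beyond-½-or-small plus (nz plus))

  Excluded : Sign → Set
  Excluded σ = Eventually (λ i → ¬ (seq x i ≡ σ · ∣ seq x i ∣))

  exclude : ∀ {σ B c δ r} → 0ℚ < c → (∀ t → r - δ ≤ t → t ≤ B → c ≤ ∣ ⟦ e ⟧ (σ · t) ∣) →
            Eventually (λ i → ∣ seq x i ∣ ≤ B) → Eventually (λ i → r - δ ≤ ∣ seq x i ∣) → Excluded σ
  exclude {c = c} 0<c e≥ (N , ≤B) (N′ , near) with null c 0<c
  ... | M , small-e = N ℕ.⊔ N′ ℕ.⊔ M , λ i i≥ eq → <-irrefl refl (<-≤-trans
          (small-e i (ℕ.m⊔n≤o⇒n≤o (N ℕ.⊔ N′) M i≥))
          (subst (λ y → c ≤ ∣ ⟦ e ⟧ y ∣) (sym eq) (e≥ ∣ seq x i ∣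
            (near i (ℕ.m⊔n≤o⇒n≤o N N′ (ℕ.m⊔n≤o⇒m≤o (N ℕ.⊔ N′) M i≥)))
            (≤B i (ℕ.m⊔n≤o⇒m≤o N N′ (ℕ.m⊔n≤o⇒m≤o (N ℕ.⊔ N′) M i≥))))))

  excluded : ∀ σ → NonzeroLarge σ e → (∣ x ∣ᴿ <ᴿ 2ᴿ) ⊎ Excluded σ
  excluded σ nz =
    let B , 0<B , N , bounded = eventually-bounded x
        c , δ , 0<c , 0<δ , e≥ = past-2 σ e (B + 2ℚ) (p≤q+p 2ℚ (<⇒≤ 0<B)) nz
        bounded′ = N , λ i i≥ → ≤-trans (bounded i i≥) (p≤p+q B (<⇒≤ 0<2))
    in [ inj₁ , (λ near → inj₂ (exclude {σ} {B + 2ℚ} {c} {δ} {2ℚ} 0<c e≥ bounded′ near)) ]′ (below-or-near ∣ x ∣ᴿ 2ℚ 0<δ)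

  not-both : Excluded plus → ¬ Excluded minus
  not-both (N , no⁺) (N′ , no⁻) with signed (seq x (N ℕ.⊔ N′))
  ... | plus  , eq = no⁺ (N ℕ.⊔ N′) (ℕ.m≤m⊔n N N′) eq
  ... | minus , eq = no⁻ (N ℕ.⊔ N′) (ℕ.m≤n⊔m N N′) eq

  below-2 : (∀ σ → NonzeroLarge σ e) → ∣ x ∣ᴿ <ᴿ 2ᴿ
  below-2 nz = [ (λ x<2 → x<2) , (λ no⁺ → [ (λ x<2 → x<2) , (λ no⁻ → ⊥-elim (not-both no⁺ no⁻)) ]′ (excluded minus (nz minus))) ]′
    (excluded plus (nz plus))

  module _ {r δ η} (0<η : 0ℚ < η) (e≥ : ∀ t → r - δ ≤ t → ∣ t - r ∣ * η ≤ ∣ ⟦ e ⟧ t ∣) where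

    -- A zero at which the polynomial dominates the distance to `r` attracts the sequence; this
    -- treats the one pair whose `T` has a zero at 2.
    converges : Excluded minus → Eventually (λ i → r - δ ≤ ∣ seq x i ∣) → x ≃ᴿ fromℚ r
    converges (N , no⁻) (N′ , near) ε 0<ε with null (ε * η) (0<* 0<ε 0<η)
    ... | M , small-e = N ℕ.⊔ N′ ℕ.⊔ M , λ i i≥ → close i
          (ℕ.m⊔n≤o⇒m≤o N N′ (ℕ.m⊔n≤o⇒m≤o (N ℕ.⊔ N′) M i≥)) (ℕ.m⊔n≤o⇒n≤o N N′ (ℕ.m⊔n≤o⇒m≤o (N ℕ.⊔ N′) M i≥))
          (ℕ.m⊔n≤o⇒n≤o (N ℕ.⊔ N′) M i≥)
      where
      close : ∀ i → N ℕ.≤ i → N′ ℕ.≤ i → M ℕ.≤ i → ∣ seq x i - r ∣ < ε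
      close i n n′ m with signed (seq x i)
      ... | minus , eq = ⊥-elim (no⁻ i n eq)
      ... | plus  , eq = *-cancelʳ-<-nonNeg η {{nonNegative (<⇒≤ 0<η)}} (≤-<-trans
              (e≥ (seq x i) (subst (r - δ ≤_) (sym eq) (near i n′))) (small-e i m))

  below-or-2 : NonzeroLarge minus e → (∀ t → 2ℚ - ½ ≤ t → ∣ t - 2ℚ ∣ * (½ * ½) ≤ ∣ ⟦ e ⟧ t ∣) →
               ∣ x ∣ᴿ <ᴿ 2ᴿ ⊎ x ≃ᴿ 2ᴿ
  below-or-2 nz e≥ = [ inj₁ , (λ no⁻ → [ inj₁ , (λ near → inj₂ (converges {2ℚ} {½} {½ * ½} (0<* 0<½ 0<½) e≥ no⁻ near)) ]′
      (below-or-near ∣ x ∣ᴿ 2ℚ 0<½)) ]′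
    (excluded minus nz)

-- The complex numbers as an integral domain

null-cong : ∀ {s t} → (∀ i → s i ≡ t i) → Null s → Null t
null-cong s≡t null ε 0<ε with null ε 0<ε
... | N , small-s = N , λ i i≥ → subst (λ y → ∣ y ∣ < ε) (s≡t i) (small-s i i≥)

null-0 : Null (λ _ → 0ℚ)
null-0 ε 0<ε = 0 , λ _ _ → 0<ε

null-neg : ∀ {s} → Null s → Null (λ i → - s i)
null-neg {s} null ε 0<ε with null ε 0<ε
... | N , small-s = N , λ i i≥ → subst (_< ε) (sym (∣-p∣≡∣p∣ (s i))) (small-s i i≥)

null-+ : ∀ {s t} → Null s → Null t → Null (λ i → s i + t i)
null-+ {s} {t} null-s null-t ε 0<ε with null-s (ε * ½) (0<* 0<ε 0<½) | null-t (ε * ½) (0<* 0<ε 0<½)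
... | M , small-s | N , small-t = M ℕ.⊔ N , λ i i≥ → subst (∣ s i + t i ∣ <_) (halves ε)
  (≤-<-trans (∣p+q∣≤∣p∣+∣q∣ (s i) (t i))
    (+-mono-< (small-s i (ℕ.m⊔n≤o⇒m≤o M N i≥)) (small-t i (ℕ.m⊔n≤o⇒n≤o M N i≥))))

null-*-bounded : ∀ {s t : ℕ → ℚ} {B} → Null s → 0ℚ < B → Eventually (λ i → ∣ t i ∣ ≤ B) → Null (λ i → s i * t i)
null-*-bounded {s} {t} {B} null 0<B (M , bounded) ε 0<ε with inverse {B} 0<B
... | r , 0<r , Br≡1 with null (ε * r) (0<* 0<ε 0<r)
... | N , small-s = M ℕ.⊔ N , λ i i≥ → begin-strict
    ∣ s i * t i ∣              ≡⟨ ∣p*q∣≡∣p∣*∣q∣ (s i) (t i) ⟩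
    ∣ s i ∣ * ∣ t i ∣          ≤⟨ *-monoˡ ∣ s i ∣ (0≤∣p∣ (s i)) (bounded i (ℕ.m⊔n≤o⇒m≤o M N i≥)) ⟩
    ∣ s i ∣ * B                <⟨ *-monoˡ-<-pos B {{positive 0<B}} (small-s i (ℕ.m⊔n≤o⇒n≤o M N i≥)) ⟩
    ε * r * B                  ≡⟨ solve 3 (λ ε r B → ε :* r :* B := ε :* (B :* r)) refl ε r B ⟩
    ε * (B * r)                ≡⟨ trans (cong (ε *_) Br≡1) (*-identityʳ ε) ⟩
    ε                          ∎
  where open ≤-Reasoning

null-*-cauchy : ∀ {s} → Null s → ∀ x → Null (λ i → s i * seq x i)
null-*-cauchy {s} null x = let B , 0<B , bounded = eventually-bounded x in null-*-bounded {s} {seq x} {B} null 0<B bounded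

≃ᴿ-pointwise : ∀ {x y} → (∀ i → seq x i ≡ seq y i) → x ≃ᴿ y
≃ᴿ-pointwise {x} {y} x≡y = null-cong (λ i → sym (trans (cong (_- seq y i) (x≡y i)) (+-inverseʳ (seq y i)))) null-0

≃ᴿ-sym : ∀ {x y} → x ≃ᴿ y → y ≃ᴿ x
≃ᴿ-sym {x} {y} x≃y = null-cong (λ i → solve 2 (λ a b → :- (a :- b) := b :- a) refl (seq x i) (seq y i)) (null-neg x≃y)

≃ᴿ-trans : ∀ {x y z} → x ≃ᴿ y → y ≃ᴿ z → x ≃ᴿ z
≃ᴿ-trans {x} {y} {z} x≃y y≃z = null-cong
  (λ i → solve 3 (λ a b c → (a :- b) :+ (b :- c) := a :- c) refl (seq x i) (seq y i) (seq z i)) (null-+ x≃y y≃z)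

+ᴿ-cong : ∀ {x x′ y y′} → x ≃ᴿ x′ → y ≃ᴿ y′ → x +ᴿ y ≃ᴿ x′ +ᴿ y′
+ᴿ-cong {x} {x′} {y} {y′} x≃ y≃ = null-cong
  (λ i → solve 4 (λ a b c d → (a :- b) :+ (c :- d) := a :+ c :- (b :+ d)) refl (seq x i) (seq x′ i) (seq y i) (seq y′ i)) (null-+ x≃ y≃)

-ᴿ-cong : ∀ {x y} → x ≃ᴿ y → -ᴿ x ≃ᴿ -ᴿ y
-ᴿ-cong {x} {y} x≃y = null-cong (λ i → solve 2 (λ a b → :- (a :- b) := :- a :- (:- b)) refl (seq x i) (seq y i)) (null-neg x≃y)

*ᴿ-cong : ∀ {x x′ y y′} → x ≃ᴿ x′ → y ≃ᴿ y′ → x *ᴿ y ≃ᴿ x′ *ᴿ y′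
*ᴿ-cong {x} {x′} {y} {y′} x≃ y≃ = null-cong
  (λ i → solve 4 (λ a b c d → (a :- b) :* c :+ (c :- d) :* b := a :* c :- b :* d) refl (seq x i) (seq x′ i) (seq y i) (seq y′ i))
  (null-+ (null-*-cauchy x≃ y) (null-*-cauchy y≃ x′))

≃ᶜ-pointwise : ∀ {z w} → (∀ i → seq (re z) i ≡ seq (re w) i) → (∀ i → seq (im z) i ≡ seq (im w) i) → z ≃ᶜ w
≃ᶜ-pointwise {z} {w} re≡ im≡ = ≃ᴿ-pointwise {re z} {re w} re≡ , ≃ᴿ-pointwise {im z} {im w} im≡

≃ᶜ-refl : ∀ {z} → z ≃ᶜ z
≃ᶜ-refl {z} = ≃ᶜ-pointwise {z} {z} (λ _ → refl) (λ _ → refl)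

≃ᶜ-sym : ∀ {z w} → z ≃ᶜ w → w ≃ᶜ z
≃ᶜ-sym {z} {w} (r , i) = ≃ᴿ-sym {re z} {re w} r , ≃ᴿ-sym {im z} {im w} i

≃ᶜ-trans : ∀ {u z w} → u ≃ᶜ z → z ≃ᶜ w → u ≃ᶜ w
≃ᶜ-trans {u} {z} {w} (r , i) (r′ , i′) = ≃ᴿ-trans {re u} {re z} {re w} r r′ , ≃ᴿ-trans {im u} {im z} {im w} i i′

+ᶜ-cong : ∀ {z z′ w w′} → z ≃ᶜ z′ → w ≃ᶜ w′ → z +ᶜ w ≃ᶜ z′ +ᶜ w′
+ᶜ-cong {z} {z′} {w} {w′} (r , i) (r′ , i′) =
  +ᴿ-cong {re z} {re z′} {re w} {re w′} r r′ , +ᴿ-cong {im z} {im z′} {im w} {im w′} i i′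

-ᶜ-cong : ∀ {z w} → z ≃ᶜ w → -ᶜ z ≃ᶜ -ᶜ w
-ᶜ-cong {z} {w} (r , i) = -ᴿ-cong {re z} {re w} r , -ᴿ-cong {im z} {im w} i

*ᶜ-cong : ∀ {z z′ w w′} → z ≃ᶜ z′ → w ≃ᶜ w′ → z *ᶜ w ≃ᶜ z′ *ᶜ w′
*ᶜ-cong {a +i b} {a′ +i b′} {c +i d} {c′ +i d′} (r , i) (r′ , i′) =
  +ᴿ-cong {a *ᴿ c} {a′ *ᴿ c′} { -ᴿ (b *ᴿ d)} { -ᴿ (b′ *ᴿ d′)} (*ᴿ-cong {a} {a′} {c} {c′} r r′)
    (-ᴿ-cong {b *ᴿ d} {b′ *ᴿ d′} (*ᴿ-cong {b} {b′} {d} {d′} i i′)) ,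
  +ᴿ-cong {a *ᴿ d} {a′ *ᴿ d′} {b *ᴿ c} {b′ *ᴿ c′} (*ᴿ-cong {a} {a′} {d} {d′} r i′) (*ᴿ-cong {b} {b′} {c} {c′} i r′)

ℂ-commutativeRing : CommutativeRing 0ℓ 0ℓ
ℂ-commutativeRing = record
  { Carrier = ℂ ; _≈_ = _≃ᶜ_ ; _+_ = _+ᶜ_ ; _*_ = _*ᶜ_ ; -_ = -ᶜ_ ; 0# = 0ᶜ ; 1# = 1ᶜ
  ; isCommutativeRing = record
    { isRing = record
      { +-isAbelianGroup = record
        { isGroup = record
          { isMonoid = record
            { isSemigroup = record
              { isMagma = record
                { isEquivalence = record
                  { refl  = λ {z} → ≃ᶜ-refl {z}
                  ; sym   = λ {z} {w} → ≃ᶜ-sym {z} {w}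
                  ; trans = λ {u} {z} {w} → ≃ᶜ-trans {u} {z} {w} }
                ; ∙-cong = λ {z} {z′} {w} {w′} → +ᶜ-cong {z} {z′} {w} {w′} }
              ; assoc = λ u z w → pointwise ((u +ᶜ z) +ᶜ w) (u +ᶜ (z +ᶜ w)) (λ i → +-assoc (seq (re u) i) (seq (re z) i) (seq (re w) i))
                                            (λ i → +-assoc (seq (im u) i) (seq (im z) i) (seq (im w) i)) }
            ; identity = (λ z → pointwise (0ᶜ +ᶜ z) z (λ i → +-identityˡ (seq (re z) i)) (λ i → +-identityˡ (seq (im z) i)))
                       , (λ z → pointwise (z +ᶜ 0ᶜ) z (λ i → +-identityʳ (seq (re z) i)) (λ i → +-identityʳ (seq (im z) i))) }
          ; inverse = (λ z → pointwise ((-ᶜ z) +ᶜ z) 0ᶜ (λ i → +-inverseˡ (seq (re z) i)) (λ i → +-inverseˡ (seq (im z) i)))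
                    , (λ z → pointwise (z +ᶜ (-ᶜ z)) 0ᶜ (λ i → +-inverseʳ (seq (re z) i)) (λ i → +-inverseʳ (seq (im z) i)))
          ; ⁻¹-cong = λ {z} {w} → -ᶜ-cong {z} {w} }
        ; comm = λ z w → pointwise (z +ᶜ w) (w +ᶜ z) (λ i → +-comm (seq (re z) i) (seq (re w) i)) (λ i → +-comm (seq (im z) i) (seq (im w) i)) }
      ; *-cong = λ {z} {z′} {w} {w′} → *ᶜ-cong {z} {z′} {w} {w′}
      ; *-assoc = λ { u@(a +i b) z@(c +i d) w@(e +i f) → pointwise ((u *ᶜ z) *ᶜ w) (u *ᶜ (z *ᶜ w))
          (λ i → solve 6 (λ a b c d e f → (a :* c :- b :* d) :* e :- (a :* d :+ b :* c) :* f :=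
             a :* (c :* e :- d :* f) :- b :* (c :* f :+ d :* e)) refl (seq a i) (seq b i) (seq c i) (seq d i) (seq e i) (seq f i))
          (λ i → solve 6 (λ a b c d e f → (a :* c :- b :* d) :* f :+ (a :* d :+ b :* c) :* e :=
             a :* (c :* f :+ d :* e) :+ b :* (c :* e :- d :* f)) refl (seq a i) (seq b i) (seq c i) (seq d i) (seq e i) (seq f i)) }
      ; *-identity =
          (λ { z@(a +i b) → pointwise (1ᶜ *ᶜ z) z
            (λ i → solve 2 (λ a b → con 1ℚ :* a :- con 0ℚ :* b := a) refl (seq a i) (seq b i))
            (λ i → solve 2 (λ a b → con 1ℚ :* b :+ con 0ℚ :* a := b) refl (seq a i) (seq b i)) })
        , (λ { z@(a +i b) → pointwise (z *ᶜ 1ᶜ) z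
            (λ i → solve 2 (λ a b → a :* con 1ℚ :- b :* con 0ℚ := a) refl (seq a i) (seq b i))
            (λ i → solve 2 (λ a b → a :* con 0ℚ :+ b :* con 1ℚ := b) refl (seq a i) (seq b i)) })
      ; distrib =
          (λ { u@(a +i b) z@(c +i d) w@(e +i f) → pointwise (u *ᶜ (z +ᶜ w)) ((u *ᶜ z) +ᶜ (u *ᶜ w))
            (λ i → solve 6 (λ a b c d e f → a :* (c :+ e) :- b :* (d :+ f) := (a :* c :- b :* d) :+ (a :* e :- b :* f))
                     refl (seq a i) (seq b i) (seq c i) (seq d i) (seq e i) (seq f i))
            (λ i → solve 6 (λ a b c d e f → a :* (d :+ f) :+ b :* (c :+ e) := (a :* d :+ b :* c) :+ (a :* f :+ b :* e))
                     refl (seq a i) (seq b i) (seq c i) (seq d i) (seq e i) (seq f i)) })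
        , (λ { u@(a +i b) z@(c +i d) w@(e +i f) → pointwise ((z +ᶜ w) *ᶜ u) ((z *ᶜ u) +ᶜ (w *ᶜ u))
            (λ i → solve 6 (λ a b c d e f → (c :+ e) :* a :- (d :+ f) :* b := (c :* a :- d :* b) :+ (e :* a :- f :* b))
                     refl (seq a i) (seq b i) (seq c i) (seq d i) (seq e i) (seq f i))
            (λ i → solve 6 (λ a b c d e f → (c :+ e) :* b :+ (d :+ f) :* a := (c :* b :+ d :* a) :+ (e :* b :+ f :* a))
                     refl (seq a i) (seq b i) (seq c i) (seq d i) (seq e i) (seq f i)) })
      }
    ; *-comm = λ { z@(a +i b) w@(c +i d) → pointwise (z *ᶜ w) (w *ᶜ z)
        (λ i → solve 4 (λ a b c d → a :* c :- b :* d := c :* a :- d :* b) refl (seq a i) (seq b i) (seq c i) (seq d i))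
        (λ i → solve 4 (λ a b c d → a :* d :+ b :* c := c :* b :+ d :* a) refl (seq a i) (seq b i) (seq c i) (seq d i)) }
    }
  }
  where
  pointwise : ∀ z w → (∀ i → seq (re z) i ≡ seq (re w) i) → (∀ i → seq (im z) i ≡ seq (im w) i) → z ≃ᶜ w
  pointwise z w = ≃ᶜ-pointwise {z} {w}

-- If y stays away from 0, then x = (xy)/y tends to 0.
ℝ-cancel : ∀ x y → Null (seq (x *ᴿ y)) → ¬ Null (seq x) → Null (seq y)
ℝ-cancel x y null-xy ¬null-x ε 0<ε with cauchy y (ε * ½ * ½) (0<* (0<* 0<ε 0<½) 0<½)
... | N , close with ∣ seq y N ∣ <? ε * ½
...   | yes y<ε/2 = N , λ i i≥ → begin-strict
    ∣ seq y i ∣                             ≡⟨ cong ∣_∣ (solve 2 (λ a b → a := b :+ (a :- b)) refl (seq y i) (seq y N)) ⟩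
    ∣ seq y N + (seq y i - seq y N) ∣       ≤⟨ ∣p+q∣≤∣p∣+∣q∣ (seq y N) (seq y i - seq y N) ⟩
    ∣ seq y N ∣ + ∣ seq y i - seq y N ∣     <⟨ +-mono-< y<ε/2 (close i N i≥ ℕ.≤-refl) ⟩
    ε * ½ + ε * ½ * ½                       ≤⟨ ≤-by (ε * ½ * ½) (<⇒≤ (0<* (0<* 0<ε 0<½) 0<½))
                                                 (solve 1 (λ ε → ε := ε :* con ½ :+ ε :* con ½ :* con ½ :+ ε :* con ½ :* con ½) refl ε) ⟩
    ε                                       ∎
  where open ≤-Reasoning
...   | no y≮ε/2 = ⊥-elim (¬null-x null-x)
  where
  η = ε * ½ * ½
  y≥η : ∀ i → N ℕ.≤ i → η ≤ ∣ seq y i ∣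
  y≥η i i≥ = begin
    η                                              ≡⟨ solve 1 (λ ε → ε :* con ½ :* con ½ := ε :* con ½ :- ε :* con ½ :* con ½) refl ε ⟩
    ε * ½ - η                                      ≤⟨ +-mono-≤ (≮⇒≥ y≮ε/2) (neg-antimono-≤ (<⇒≤ (close N i ℕ.≤-refl i≥))) ⟩
    ∣ seq y N ∣ - ∣ seq y N - seq y i ∣
      ≤⟨ ≤-by (∣ seq y i ∣ + ∣ seq y N - seq y i ∣ - ∣ seq y N ∣) (0≤q-p triangle)
           (solve 3 (λ a b d → b := a :- d :+ (b :+ d :- a)) refl (∣ seq y N ∣) (∣ seq y i ∣) (∣ seq y N - seq y i ∣)) ⟩
    ∣ seq y i ∣                                    ∎
    where
    open ≤-Reasoning
    triangle : ∣ seq y N ∣ ≤ ∣ seq y i ∣ + ∣ seq y N - seq y i ∣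
    triangle = subst (λ u → ∣ u ∣ ≤ ∣ seq y i ∣ + ∣ seq y N - seq y i ∣)
      (solve 2 (λ a b → b :+ (a :- b) := a) refl (seq y N) (seq y i)) (∣p+q∣≤∣p∣+∣q∣ (seq y i) (seq y N - seq y i))
  null-x : Null (seq x)
  null-x δ 0<δ with null-xy (δ * η) (0<* 0<δ (0<* (0<* 0<ε 0<½) 0<½))
  ... | M , small-xy = N ℕ.⊔ M , λ i i≥ → *-cancelʳ-<-nonNeg ∣ seq y i ∣ {{∣-∣-nonNeg (seq y i)}} (begin-strict
      ∣ seq x i ∣ * ∣ seq y i ∣    ≡⟨ sym (∣p*q∣≡∣p∣*∣q∣ (seq x i) (seq y i)) ⟩
      ∣ seq x i * seq y i ∣        <⟨ small-xy i (ℕ.m⊔n≤o⇒n≤o N M i≥) ⟩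
      δ * η                        ≤⟨ *-monoˡ δ (<⇒≤ 0<δ) (y≥η i (ℕ.m⊔n≤o⇒m≤o N M i≥)) ⟩
      δ * ∣ seq y i ∣              ∎)
    where open ≤-Reasoning

0≤square : ∀ p → 0ℚ ≤ p * p
0≤square p with ≤-total 0ℚ p
... | inj₁ 0≤p = 0≤* 0≤p 0≤p
... | inj₂ p≤0 = subst (0ℚ ≤_) (solve 1 (λ p → :- p :* (:- p) := p :* p) refl p) (0≤* (neg-antimono-≤ p≤0) (neg-antimono-≤ p≤0))

null-square : ∀ {s t : ℕ → ℚ} → Null (λ i → s i * s i + t i * t i) → Null s
null-square {s} {t} null ε 0<ε with null (ε * ε) (0<* 0<ε 0<ε)
... | N , small-norm = N , bounded
  where
  bounded : ∀ i → N ℕ.≤ i → ∣ s i ∣ < ε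
  bounded i i≥ with ∣ s i ∣ <? ε
  ... | yes <ε = <ε
  ... | no ≮ε  = ⊥-elim (<-irrefl refl (begin-strict
      ε * ε                              ≤⟨ *-mono-≤ (<⇒≤ 0<ε) (<⇒≤ 0<ε) (≮⇒≥ ≮ε) (≮⇒≥ ≮ε) ⟩
      ∣ s i ∣ * ∣ s i ∣                  ≡⟨ sym (∣p*q∣≡∣p∣*∣q∣ (s i) (s i)) ⟩
      ∣ s i * s i ∣                      ≡⟨ 0≤p⇒∣p∣≡p (0≤square (s i)) ⟩
      s i * s i                          ≤⟨ ≤-by (t i * t i) (0≤square (t i)) refl ⟩
      s i * s i + t i * t i              ≤⟨ p≤∣p∣ (s i * s i + t i * t i) ⟩
      ∣ s i * s i + t i * t i ∣          <⟨ small-norm i i≥ ⟩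
      ε * ε                              ∎))
    where open ≤-Reasoning

norm : ℂ → ℝ
norm (a +i b) = a *ᴿ a +ᴿ b *ᴿ b

-- Cancellation needs no apartness, since equality of Cauchy reals is stable.
ℂ-cancel : ∀ z w → z *ᶜ w ≃ᶜ 0ᶜ → ¬ z ≃ᶜ 0ᶜ → w ≃ᶜ 0ᶜ
ℂ-cancel z@(a +i b) w@(c +i d) (r , i) z≄0 = zero⇐norm w (ℝ-cancel (norm z) (norm w) null-norms λ null → z≄0 (zero⇐norm z null))
  where
  minus-0 : ∀ {s} → Null s → Null (λ i → s i - 0ℚ)
  minus-0 {s} = null-cong (λ i → sym (+-identityʳ (s i)))

  zero⇐norm : ∀ z → Null (seq (norm z)) → z ≃ᶜ 0ᶜ
  zero⇐norm (a +i b) null = minus-0 (null-square {seq a} {seq b} null) ,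
    minus-0 (null-square {seq b} {seq a} (null-cong (λ i → +-comm (seq a i * seq a i) (seq b i * seq b i)) null))

  x = a *ᴿ c +ᴿ -ᴿ (b *ᴿ d)
  y = a *ᴿ d +ᴿ b *ᴿ c

  null-x : Null (seq x)
  null-x = null-cong (λ i → +-identityʳ (seq x i)) r

  null-y : Null (seq y)
  null-y = null-cong (λ i → +-identityʳ (seq y i)) i

  -- The norm is multiplicative, which reduces cancellation in ℂ to cancellation in ℝ.
  null-norms : Null (seq (norm z *ᴿ norm w))
  null-norms = null-cong
    (λ i → solve 4 (λ a b c d → (a :* c :- b :* d) :* (a :* c :- b :* d) :+ (a :* d :+ b :* c) :* (a :* d :+ b :* c) :=
             (a :* a :+ b :* b) :* (c :* c :+ d :* d)) refl (seq a i) (seq b i) (seq c i) (seq d i))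
    (null-+ (null-*-cauchy null-x x) (null-*-cauchy null-y y))

-- Real arguments and the pair 2, 6

open Cyclotomic ℂ-commutativeRing ℂ-cancel using (cyclotomic-U/V; coincidence⇒T≈0; *-cancelʳ-≉0)
open Eval ℂ-rawRing using () renaming (⟦_⟧ to ⟦_⟧ᶜ)

-- The equalities hold term by term, not only in the limit, so a complex equation at a real point
-- becomes a statement about the rational values along the sequence.
eval-fromℝ : ∀ x e i → seq (re (⟦ e ⟧ᶜ (fromℝ x))) i ≡ ⟦ e ⟧ (seq x i) × seq (im (⟦ e ⟧ᶜ (fromℝ x))) i ≡ 0ℚ
eval-fromℝ x (X^ zero)  i = refl , refl
eval-fromℝ x (X^ suc n) i with eval-fromℝ x (X^ n) i
... | r , s rewrite r | s =
  solve 2 (λ a b → a :* b :- con 0ℚ :* con 0ℚ := a :* b) refl (seq x i) (seq x i ^ n) ,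
  solve 2 (λ a b → a :* con 0ℚ :+ con 0ℚ :* b := con 0ℚ) refl (seq x i) (seq x i ^ n)
eval-fromℝ x (e ⊕ f) i with eval-fromℝ x e i | eval-fromℝ x f i
... | r , s | r′ , s′ = cong₂ _+_ r r′ , cong₂ _+_ s s′
eval-fromℝ x (e ⊖ f) i with eval-fromℝ x e i | eval-fromℝ x f i
... | r , s | r′ , s′ = cong₂ _-_ r r′ , cong₂ _-_ s s′
eval-fromℝ x (e ⊗ f) i with eval-fromℝ x e i | eval-fromℝ x f i
... | r , s | r′ , s′ rewrite r | s | r′ | s′ =
  solve 2 (λ a b → a :* b :- con 0ℚ :* con 0ℚ := a :* b) refl (⟦ e ⟧ (seq x i)) (⟦ f ⟧ (seq x i)) ,
  solve 2 (λ a b → a :* con 0ℚ :+ con 0ℚ :* b := con 0ℚ) refl (⟦ e ⟧ (seq x i)) (⟦ f ⟧ (seq x i))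

null-eval : ∀ x e → ⟦ e ⟧ᶜ (fromℝ x) ≃ᶜ 0ᶜ → Null (λ i → ⟦ e ⟧ (seq x i))
null-eval x e (r , _) = null-cong (λ i → trans (+-identityʳ (seq (re (⟦ e ⟧ᶜ (fromℝ x))) i)) (proj₁ (eval-fromℝ x e i))) r

-- Φ₆(t) − Φ₂(t) = t (t − 2), times the two denominators.
T-2-6 : ∀ t → 2ℚ - ½ ≤ t → ∣ t - 2ℚ ∣ * (½ * ½) ≤ ∣ ⟦ T 1 (2 ∷ 3 ∷ []) 1 (2 ∷ []) ⟧ t ∣
T-2-6 t 3/2≤t = begin
  ∣ t - 2ℚ ∣ * (½ * ½)                ≤⟨ *-monoˡ ∣ t - 2ℚ ∣ (0≤∣p∣ (t - 2ℚ)) g≥ ⟩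
  ∣ t - 2ℚ ∣ * g                      ≤⟨ *-monoˡ ∣ t - 2ℚ ∣ (0≤∣p∣ (t - 2ℚ)) (p≤∣p∣ g) ⟩
  ∣ t - 2ℚ ∣ * ∣ g ∣                  ≡⟨ sym (∣p*q∣≡∣p∣*∣q∣ (t - 2ℚ) g) ⟩
  ∣ (t - 2ℚ) * g ∣                    ≡⟨ sym (∣-p∣≡∣p∣ ((t - 2ℚ) * g)) ⟩
  ∣ - ((t - 2ℚ) * g) ∣                ≡⟨ cong ∣_∣ (factor t) ⟩
  ∣ ⟦ T 1 (2 ∷ 3 ∷ []) 1 (2 ∷ []) ⟧ t ∣  ∎
  where
  open ≤-Reasoning
  -- From `t ≥ 3/2`: `(t − 1)² ≥ ¼`, `t³ − 1 ≥ 1` and `t (t + 1) ≥ 1`, whence the constant `½ * ½`.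
  g = (t - 1ℚ) * (t - 1ℚ) * ((t * t * t - 1ℚ) * (t * (t + 1ℚ)))
  0≤3/2 : 0ℚ ≤ 2ℚ - ½
  0≤3/2 = ≤ᵇ⇒≤ _
  1≤t : 1ℚ ≤ t
  1≤t = ≤-trans {1ℚ} {2ℚ - ½} (≤ᵇ⇒≤ _) 3/2≤t
  2≤t³ : 2ℚ * 1ℚ ≤ t * t * t
  2≤t³ = *-mono-≤ {2ℚ} {t * t} {1ℚ} {t} (<⇒≤ 0<2) 0≤1
    (≤-trans {2ℚ} {(2ℚ - ½) * (2ℚ - ½)} (≤ᵇ⇒≤ _) (*-mono-≤ {2ℚ - ½} {t} {2ℚ - ½} {t} 0≤3/2 0≤3/2 3/2≤t 3/2≤t)) 1≤t
  ½≤t-1 : ½ ≤ t - 1ℚ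
  ½≤t-1 = +-monoˡ-≤ (- 1ℚ) {2ℚ - ½} {t} 3/2≤t
  1≤t³-1 : 1ℚ ≤ t * t * t - 1ℚ
  1≤t³-1 = +-monoˡ-≤ (- 1ℚ) {2ℚ * 1ℚ} {t * t * t} 2≤t³
  1≤t+1 : 1ℚ ≤ t + 1ℚ
  1≤t+1 = ≤-trans 1≤t (p≤p+q t 0≤1)
  g≥ : ½ * ½ ≤ g
  g≥ = subst (_≤ g) (*-identityʳ (½ * ½)) (*-mono-≤ {½ * ½} {(t - 1ℚ) * (t - 1ℚ)} {1ℚ} {(t * t * t - 1ℚ) * (t * (t + 1ℚ))}
    (0≤* 0≤½ 0≤½) 0≤1 (*-mono-≤ {½} {t - 1ℚ} {½} {t - 1ℚ} 0≤½ 0≤½ ½≤t-1 ½≤t-1) (1≤ℚ* 1≤t³-1 (1≤ℚ* 1≤t 1≤t+1)))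
  factor : ∀ t → - ((t - 2ℚ) * ((t - 1ℚ) * (t - 1ℚ) * ((t * t * t - 1ℚ) * (t * (t + 1ℚ))))) ≡
                 ⟦ T 1 (2 ∷ 3 ∷ []) 1 (2 ∷ []) ⟧ t
  factor = solve 1 (λ t →
    let t² = t :* (t :* con 1ℚ)
        t³ = t :* t²
        t⁶ = t :* (t :* (t :* t³))
        1-t = con 1ℚ :- t :* con 1ℚ
        1-t² = con 1ℚ :- t²
        1-t³ = con 1ℚ :- t³
    in :- ((t :- con 2ℚ) :* ((t :- con 1ℚ) :* (t :- con 1ℚ) :* ((t :* t :* t :- con 1ℚ) :* (t :* (t :+ con 1ℚ))))) :=
       1-t :* con 1ℚ :* (con 1ℚ :* (con 1ℚ :- t⁶)) :* (1-t :* con 1ℚ) :-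
       con 1ℚ :* 1-t² :* (con 1ℚ :* 1-t³ :* (1-t² :* con 1ℚ))) refl

-- Assembling the bounds and the exceptional case

distinct : ∀ {m n a b ps qs} → Built m a ps → Built n b qs → m ≢ n → Distinct a ps b qs
distinct bm bn m≢n (refl , refl) = m≢n (trans (built-≡ bm) (sym (built-≡ bn)))

large-minus : ∀ {a b ps qs} → Shape a ps → Shape b qs → Distinct a ps b qs → NonzeroLarge minus (T a ps b qs)
large-minus shm shn ne with gap minus shm shn ne
... | inj₁ g        = T-large minus shm shn g
... | inj₂ (() , _)

T-2-6± : ∀ {a b ps qs} → Exceptional a ps b qs ⊎ Exceptional b qs a ps →
         ∀ t → 2ℚ - ½ ≤ t → ∣ t - 2ℚ ∣ * (½ * ½) ≤ ∣ ⟦ T a ps b qs ⟧ t ∣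
T-2-6± (inj₁ (refl , refl , refl , refl)) t 3/2≤t = T-2-6 t 3/2≤t
T-2-6± (inj₂ (refl , refl , refl , refl)) t 3/2≤t = subst (∣ t - 2ℚ ∣ * (½ * ½) ≤_)
  (T-swap 1 (2 ∷ 3 ∷ []) 1 (2 ∷ []) t) (T-2-6 t 3/2≤t)

exceptional-≡ : ∀ {m n a b ps qs} → Built m a ps → Built n b qs → Exceptional a ps b qs ⊎ Exceptional b qs a ps →
                (m ≡ 2 × n ≡ 6) ⊎ (m ≡ 6 × n ≡ 2)
exceptional-≡ bm bn (inj₁ (refl , refl , refl , refl)) = inj₂ (built-≡ bm , built-≡ bn)
exceptional-≡ bm bn (inj₂ (refl , refl , refl , refl)) = inj₁ (built-≡ bm , built-≡ bn)

module _ {m n a b ps qs} (bm : Built m a ps) (bn : Built n b qs) (m≢n : m ≢ n)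
         (x : ℝ) (null : Null (λ i → ⟦ T a ps b qs ⟧ (seq x i))) where

  private
    t   = T a ps b qs
    shm = built-shape bm
    shn = built-shape bn
    ne  = distinct bm bn m≢n

  Conclusion : Set
  Conclusion = (½ᴿ <ᴿ ∣ x ∣ᴿ × ∣ x ∣ᴿ <ᴿ 2ᴿ) ⊎ (x ≃ᴿ 2ᴿ × ((m ≡ 2 × n ≡ 6) ⊎ (m ≡ 6 × n ≡ 2)))

  lower-bound : ¬ (x ≃ᴿ 0ᴿ) → ½ᴿ <ᴿ ∣ x ∣ᴿ
  lower-bound = beyond-½ t x null λ σ → T-small σ shm shn ne

  upper-bound : Gap plus a ps b qs → ∣ x ∣ᴿ <ᴿ 2ᴿ
  upper-bound g = below-2 t x null λ { plus → T-large plus shm shn g ; minus → large-minus shm shn ne }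

  upper-bound-or-2 : Exceptional a ps b qs ⊎ Exceptional b qs a ps → ∣ x ∣ᴿ <ᴿ 2ᴿ ⊎ x ≃ᴿ 2ᴿ
  upper-bound-or-2 ex = below-or-2 t x null (large-minus shm shn ne) (T-2-6± ex)

  conclude : ½ᴿ <ᴿ ∣ x ∣ᴿ → Gap plus a ps b qs ⊎ (plus ≡ plus × (Exceptional a ps b qs ⊎ Exceptional b qs a ps)) → Conclusion
  conclude ½<x (inj₁ g)        = inj₁ (½<x , upper-bound g)
  conclude ½<x (inj₂ (_ , ex)) = conclude-exceptional (upper-bound-or-2 ex)
    where
    conclude-exceptional : ∣ x ∣ᴿ <ᴿ 2ᴿ ⊎ x ≃ᴿ 2ᴿ → Conclusion
    conclude-exceptional (inj₁ x<2) = inj₁ (½<x , x<2)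
    conclude-exceptional (inj₂ x≃2) = inj₂ (x≃2 , exceptional-≡ bm bn ex)

  root-bounds : ¬ (x ≃ᴿ 0ᴿ) → Conclusion
  root-bounds x≄0 = conclude (lower-bound x≄0) (gap plus shm shn ne)

built-2 : Built 2 1 (2 ∷ [])
built-2 = new prime[2] (from-no (2 ∣? 1)) [-] one

built-6 : Built 6 1 (2 ∷ 3 ∷ [])
built-6 = new prime[2] (from-no (2 ∣? 3)) (ℕ.≤-refl ∷ [-]) (new (from-yes (prime? 3)) (from-no (3 ∣? 1)) [-] one)

3ℂ : ℂ
3ℂ = fromℝ (fromℚ (1ℚ + 2ℚ))

-- Both values at 2 are 3, whichever roots of unity are chosen: the quotient formula leaves a
-- rational computation and the cancellation of a denominator that is not 0 at 2.
quotient-3 : ∀ {z} w v → ⟦ w ⟧ 2ℚ ≡ (1ℚ + 2ℚ) * ⟦ v ⟧ 2ℚ → 1ℚ ≤ ∣ ⟦ v ⟧ 2ℚ ∣ →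
             z *ᶜ ⟦ v ⟧ᶜ (fromℝ 2ᴿ) ≃ᶜ ⟦ w ⟧ᶜ (fromℝ 2ᴿ) → z ≃ᶜ 3ℂ
quotient-3 {z} w v w≡3v 1≤v zv≃w = *-cancelʳ-≉0 {z} {3ℂ} {v₂} v≄0
  (≃ᶜ-trans {z *ᶜ v₂} {w₂} {3ℂ *ᶜ v₂} zv≃w (≃ᶜ-pointwise {w₂} {3ℂ *ᶜ v₂} real-part imaginary-part))
  where
  v₂ = ⟦ v ⟧ᶜ (fromℝ 2ᴿ)
  w₂ = ⟦ w ⟧ᶜ (fromℝ 2ᴿ)

  v≄0 : ¬ v₂ ≃ᶜ 0ᶜ
  v≄0 v≃0 with null-eval 2ᴿ v v≃0 1ℚ (positive⁻¹ 1ℚ)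
  ... | N , v<1 = <-irrefl refl (<-≤-trans (v<1 N ℕ.≤-refl) 1≤v)

  real-part : ∀ i → seq (re w₂) i ≡ seq (re (3ℂ *ᶜ v₂)) i
  real-part i rewrite proj₁ (eval-fromℝ 2ᴿ w i) | proj₁ (eval-fromℝ 2ᴿ v i) | proj₂ (eval-fromℝ 2ᴿ v i) =
    trans w≡3v (sym (+-identityʳ ((1ℚ + 2ℚ) * ⟦ v ⟧ 2ℚ)))

  imaginary-part : ∀ i → seq (im w₂) i ≡ seq (im (3ℂ *ᶜ v₂)) i
  imaginary-part i rewrite proj₂ (eval-fromℝ 2ᴿ w i) | proj₁ (eval-fromℝ 2ᴿ v i) | proj₂ (eval-fromℝ 2ᴿ v i) =
    solve 1 (λ v → con 0ℚ := con 3ℚ :* con 0ℚ :+ con 0ℚ :* v) refl (⟦ v ⟧ 2ℚ)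
    where 3ℚ : ℚ
          3ℚ = 1ℚ + 2ℚ

Φ₂≃Φ₆ : (ζ₂ ζ₆ : ℂ) → IsPrimitiveRoot 2 ζ₂ → IsPrimitiveRoot 6 ζ₆ → Φ 2 ζ₂ (fromℝ 2ᴿ) ≃ᶜ Φ 6 ζ₆ (fromℝ 2ᴿ)
Φ₂≃Φ₆ ζ₂ ζ₆ ζ₂-prim ζ₆-prim = ≃ᶜ-trans {Φ 2 ζ₂ z} {3ℂ} {Φ 6 ζ₆ z}
  (quotient-3 {Φ 2 ζ₂ z} (W (2 ∷ []) 1) (V (2 ∷ []) 1) refl ≤-refl (cyclotomic-U/V built-2 ζ₂-prim z))
  (≃ᶜ-sym {Φ 6 ζ₆ z} {3ℂ}
    (quotient-3 {Φ 6 ζ₆ z} (W (2 ∷ 3 ∷ []) 1) (V (2 ∷ 3 ∷ []) 1) refl (≤ᵇ⇒≤ _) (cyclotomic-U/V built-6 ζ₆-prim z)))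
  where z = fromℝ 2ᴿ

theorem1p1 : ((m n : ℕ) → .{{_ : NonZero m}} → .{{_ : NonZero n}} → m ≢ n →
    (ζₘ ζₙ : ℂ) → IsPrimitiveRoot m ζₘ → IsPrimitiveRoot n ζₙ →
    (x : ℝ) → ¬ (x ≃ᴿ 0ᴿ) →
    Φ m ζₘ (fromℝ x) ≃ᶜ Φ n ζₙ (fromℝ x) →
    (½ᴿ <ᴿ ∣ x ∣ᴿ × ∣ x ∣ᴿ <ᴿ 2ᴿ)
    ⊎ (x ≃ᴿ 2ᴿ × ((m ≡ 2 × n ≡ 6) ⊎ (m ≡ 6 × n ≡ 2))))
    × ((ζ₂ ζ₆ : ℂ) → IsPrimitiveRoot 2 ζ₂ → IsPrimitiveRoot 6 ζ₆ →
    Φ 2 ζ₂ (fromℝ 2ᴿ) ≃ᶜ Φ 6 ζ₆ (fromℝ 2ᴿ))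
theorem1p1 = coincidence , Φ₂≃Φ₆
  where
  coincidence : (m n : ℕ) → .{{_ : NonZero m}} → .{{_ : NonZero n}} → m ≢ n →
    (ζₘ ζₙ : ℂ) → IsPrimitiveRoot m ζₘ → IsPrimitiveRoot n ζₙ →
    (x : ℝ) → ¬ (x ≃ᴿ 0ᴿ) →
    Φ m ζₘ (fromℝ x) ≃ᶜ Φ n ζₙ (fromℝ x) →
    (½ᴿ <ᴿ ∣ x ∣ᴿ × ∣ x ∣ᴿ <ᴿ 2ᴿ)
    ⊎ (x ≃ᴿ 2ᴿ × ((m ≡ 2 × n ≡ 6) ⊎ (m ≡ 6 × n ≡ 2)))
  coincidence m n m≢n ζₘ ζₙ ζₘ-prim ζₙ-prim x x≄0 Φm≃Φn with build m (ℕ.>-nonZero⁻¹ m) | build n (ℕ.>-nonZero⁻¹ n)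
  ... | a , ps , bm | b , qs , bn = root-bounds bm bn m≢n x
        (null-eval x (T a ps b qs) (coincidence⇒T≈0 bm bn ζₘ-prim ζₙ-prim (fromℝ x) Φm≃Φn)) x≄0
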